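{- Let $\beta>0$ and $m\ge1$, and let $D=\sum_{v\in V(G^n_{m,\beta})}\binom{d(v)}{2}$ be the number of pairs of adjacent half-edges in $G^n_{m,\beta}$. For any $\epsilon>0$ and $\gamma>0$ there exists $n^*$ such that for all $n\ge n^*$, \[ \Pr\left(|D-\mathbb{E}[D]|\ge n^{\frac{4+\beta}{4+2\beta}+\epsilon}\right)\le n^{ -\gamma}. \]
   Context: Fix a real $\beta>0$ and a positive integer $m$. The random tree process $(G^n_{1,\beta})_{n\ge1}$ is defined as follows. $G^1_{1,\beta}$ consists of a single vertex $v_1$ and no edges. Given $G^n_{1,\beta}$ with vertices $v_1,\dots,v_n$ and directed edges $e_2,\dots,e_n$ (where $e_i$ is the edge whose tail is $v_i$), $G^{n+1}_{1,\beta}$ is obtained by adding a vertex $v_{n+1}$ and a directed edge $e_{n+1}$ with tail $v_{n+1}$ and head a "target vertex" determined by a random variable $f_{n+1}$, independent of $f_2,\dots,f_n$, taking values in $\Omega_{n+1}=\{(i,v):1\le i\le n\}\cup\{(i,h),(i,t):2\le i\le n\}$ with $\Pr(f_{n+1}=(i,v))=\beta/((2+\beta)n-2)$ and $\Pr(f_{n+1}=(i,h))=\Pr(f_{n+1}=(i,t))=1/((2+\beta)n-2)$. If $f_{n+1}=(i,v)$ the target is $v_i$ (chosen "uniformly"); if $f_{n+1}=(i,h)$ the target is the head of $e_i$, and if $f_{n+1}=(i,t)$ the target is the tail $v_i$ of $e_i$ (chosen "preferentially", by copying the head half-edge, resp. tail half-edge, of $e_i$). Consequently the target is $v_i$ with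 probability $(d_n(v_i)+\beta)/((2+\beta)n-2)$, where $d_n(v)$ is the degree of $v$ in $G^n_{1,\beta}$. Each edge is regarded as two half-edges, one at each endpoint; the degree of a vertex is the number of half-edges at it (loops count twice). For $n\ge1$, $G^n_{m,\beta}$ is the undirected multigraph obtained from $G^{nm}_{1,\beta}$ by identifying, for each $j=1,\dots,n$, the vertices $v_{(j-1)m+1},\dots,v_{jm}$ into a single vertex $w_j$, keeping all edges (so loops and multiple edges may occur). Two distinct half-edges are adjacent if they have the same endpoint. -}

module Defs where

open import Algebra.Bundles using (CommutativeRing; Semiring)
import Algebra.Construct.NaturalChoice.Max as Max
import Algebra.Definitions.RawSemiring as RawSemiringDefs
open import Axiom.ExcludedMiddle using (ExcludedMiddle)
open import Data.Bool.Base using (if_then_else_)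
open import Data.Fin.Base using (Fin; suc; inject₁; quotient)
open import Data.Fin.Properties using (_≟_)
open import Data.List.Base as List
  using (List; []; _∷_; _++_; [_]; map; concatMap; filter; foldr; length; allFin)
open import Data.Nat.Base as ℕ using (ℕ; zero; suc; pred)
open import Data.Nat.Combinatorics using (_C_)
import Data.Nat.ListAction as ℕList
open import Data.Product.Base as Product using (∃; ∃-syntax; _×_; _,_)
open import Data.Vec.Base as Vec using (Vec; lookup; _∷ʳ_)
open import Level using (0ℓ)
open import Relation.Binary.Bundles using (TotalOrder)
open import Relation.Binary.Core using (Rel)
import Relation.Binary.Construct.NonStrictToStrict as NonStrictToStrict
open import Relation.Binary.Structures using (IsTotalOrder)
open import Relation.Nullary.Decidable.Core using (does)
open import Relation.Nullary.Negation.Core using (¬_)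

-- The real numbers, axiomatised as a Dedekind-complete ordered field.  Both
-- _⁻¹ and sup are total functions; their values at 0# and at empty or
-- unbounded sets are unspecified.
record RealField : Set₁ where
  infix 4 _≤_
  infix 8 _⁻¹
  field
    commutativeRing : CommutativeRing 0ℓ 0ℓ

  open CommutativeRing commutativeRing public

  field
    0≉1          : ¬ (0# ≈ 1#)
    _⁻¹          : Carrier → Carrier
    *-inverseʳ   : ∀ x → ¬ (x ≈ 0#) → x * x ⁻¹ ≈ 1#
    _≤_          : Rel Carrier 0ℓ
    isTotalOrder : IsTotalOrder _≈_ _≤_
    +-monoˡ-≤    : ∀ {x y} z → x ≤ y → x + z ≤ y + z
    *-nonneg     : ∀ {x y} → 0# ≤ x → 0# ≤ y → 0# ≤ x * y

  UpperBound : (Carrier → Set) → Carrier → Set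
  UpperBound P u = ∀ x → P x → x ≤ u

  field
    sup          : (Carrier → Set) → Carrier
    sup-upper    : ∀ P → ∃ P → ∃ (UpperBound P) → UpperBound P (sup P)
    sup-least    : ∀ P → ∃ P → ∃ (UpperBound P) →
                   ∀ u → UpperBound P u → sup P ≤ u

  totalOrder : TotalOrder 0ℓ 0ℓ 0ℓ
  totalOrder = record { isTotalOrder = isTotalOrder }

  open NonStrictToStrict _≈_ _≤_ public using (_<_)
  open Max totalOrder public using (_⊔_)
  open RawSemiringDefs (Semiring.rawSemiring semiring) public using (_^_)

  infixl 7 _/_
  _/_ : Carrier → Carrier → Carrier
  x / y = x * y ⁻¹

  ∣_∣ : Carrier → Carrier
  ∣ x ∣ = x ⊔ (- x)

  fromℕ : ℕ → Carrier
  fromℕ n = RawSemiringDefs._×_ (Semiring.rawSemiring semiring) n 1#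

  -- Real powers a ^ʳ x, meaningful only for a ≥ 1: the supremum of the y ≥ 0
  -- with y ≤ a^((p - r)/q) for some rational (p - r)/q ≤ x.  The conditions
  -- are cleared of denominators and of negative exponents.
  infixr 8 _^ʳ_
  _^ʳ_ : Carrier → Carrier → Carrier
  a ^ʳ x = sup λ y → 0# ≤ y × (∃[ p ] ∃[ r ] ∃[ q ]
    1 ℕ.≤ q × fromℕ p - fromℕ r ≤ fromℕ q * x × y ^ q * a ^ r ≤ a ^ p)

-- Ω_{n+1}, for a tree on n vertices.  Indices are 0-based: vertex i : Fin n is
-- v_{i+1}, and edge j : Fin (pred n) is e_{j+2}, whose tail is v_{j+2}.
data Choice (n : ℕ) : Set where
  vertex : Fin n → Choice n
  head   : Fin (pred n) → Choice n
  tail   : Fin (pred n) → Choice n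

-- The values of (f_2 , … , f_n); there are none for n = 0.
infixl 5 _▷_
data Outcome : ℕ → Set where
  start : Outcome 1
  _▷_   : ∀ {k} → Outcome (suc k) → Choice (suc k) → Outcome (suc (suc k))

tailOf : ∀ {n} → Fin (pred n) → Fin n
tailOf {suc n} j = suc j

target : ∀ {n} → Vec (Fin n) (pred n) → Choice n → Fin n
target hs (vertex i) = i
target hs (head j)   = lookup hs j
target hs (tail j)   = tailOf j

-- The heads of the edges of the tree, oldest edge first.
heads : ∀ {n} → Outcome n → Vec (Fin n) (pred n)
heads start   = Vec.[]
heads (ω ▷ c) = Vec.map inject₁ (heads ω) ∷ʳ inject₁ (target (heads ω) c)

-- Undirected multigraphs on Fin n, possibly with loops.  The order of the two
-- ends of an edge is immaterial.
Multigraph : ℕ → Set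
Multigraph n = List (Fin n × Fin n)

tree : ∀ {n} → Outcome n → Multigraph n
tree {n} ω = map (λ j → tailOf j , lookup (heads ω) j) (allFin (pred n))

-- Since quotient m i is ⌊ i / m ⌋, consecutive blocks of m tree vertices are
-- identified.
graph : ∀ n m → Outcome (n ℕ.* m) → Multigraph n
graph n m ω = map (Product.map (quotient m) (quotient m)) (tree ω)

-- Each half-edge is represented by its endpoint.
halfEdges : ∀ {n} → Multigraph n → List (Fin n)
halfEdges = concatMap λ (u , v) → u ∷ v ∷ []

degree : ∀ {n} → Multigraph n → Fin n → ℕ
degree G v = length (filter (_≟ v) (halfEdges G))

adjacentPairs : ∀ {n} → Multigraph n → ℕ
adjacentPairs {n} G = ℕList.sum (map (λ v → degree G v C 2) (allFin n))

choices : ∀ n → List (Choice n)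
choices n = map vertex (allFin n) ++ map head (allFin (pred n)) ++ map tail (allFin (pred n))

outcomes : ∀ n → List (Outcome n)
outcomes zero          = []
outcomes (suc zero)    = [ start ]
outcomes (suc (suc k)) = List.cartesianProductWith _▷_ (outcomes (suc k)) (choices (suc k))

module Process (ℝ : RealField) (β : RealField.Carrier ℝ) where
  open RealField ℝ

  normaliser : ℕ → Carrier
  normaliser n = (fromℕ 2 + β) * fromℕ n - fromℕ 2

  choiceProb : ∀ {n} → Choice n → Carrier
  choiceProb {n} (vertex _) = β / normaliser n
  choiceProb {n} (head _)   = 1# / normaliser n
  choiceProb {n} (tail _)   = 1# / normaliser n

  outcomeProb : ∀ {n} → Outcome n → Carrier
  outcomeProb start   = 1#
  outcomeProb (ω ▷ c) = outcomeProb ω * choiceProb c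

  sumOver : ∀ n → (Outcome n → Carrier) → Carrier
  sumOver n X = foldr (λ ω s → X ω + s) 0# (outcomes n)

  𝔼 : ∀ {n} → (Outcome n → Carrier) → Carrier
  𝔼 {n} X = sumOver n λ ω → outcomeProb ω * X ω

  -- Excluded middle decides which outcomes belong to the event.
  Pr : ExcludedMiddle 0ℓ → ∀ {n} → (Outcome n → Set) → Carrier
  Pr em {n} A = sumOver n λ ω → if does (em {A ω}) then outcomeProb ω else 0#

  D : ∀ n m → Outcome (n ℕ.* m) → Carrier
  D n m ω = fromℕ (adjacentPairs (graph n m ω))

{-# OPTIONS --safe #-}

-- If w_b denotes the degree of block b plus β times its size, then block b is
-- the next target with probability w_b / N, where N = (2 + β)t − 2, and 2D is
-- Σ w_b² up to a deterministic constant.  Adding a suitable multiple of the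
-- weight of the unfinished block makes the conditional expectation of this sum
-- affine, so that its deviation Z from the mean satisfies
-- Z′ = (1 + 2/N) Z + ξ, where ξ is centred given the past and at most a
-- multiple of the largest weight.  The rising factorials of order q of the
-- weights grow by the factor 1 + q/N per step, which bounds the moments of ξ.
-- Expanding (a + ξ)^(2k) to second order, and absorbing the quadratic term by
-- Young's inequality at the cost of a factor 1 + 1/t, gives
-- E Z^(2k) = O(t^(k + 2k/(2 + β) + c)) with c independent of k, so Markov's
-- inequality for large k yields the theorem.
module Submission where

open import Defs
open import Algebra.Bundles using (CommutativeRing; RawRing)
import Algebra.Properties.CommutativeSemigroup
import Algebra.Properties.CommutativeSemiring.Exp
import Algebra.Properties.Ring
import Algebra.Properties.Semiring.Mult
import Algebra.Solver.Ring
open import Algebra.Solver.Ring.AlmostCommutativeRing using (fromCommutativeRing; _-Raw-AlmostCommutative⟶_)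
open import Axiom.ExcludedMiddle using (ExcludedMiddle)
open import Data.Bool.Base using (if_then_else_)
open import Data.Empty using (⊥-elim)
open import Data.Fin.Base as Fin using (Fin; toℕ; inject₁; quotient; remQuot)
import Data.Fin.Properties as Fin
open import Data.List.Base
  using (List; []; _∷_; _++_; map; foldr; filter; length; allFin; downFrom; cartesianProductWith)
open import Data.List.Properties using (map-tabulate)
open import Data.Maybe.Base using (Maybe; just; nothing)
open import Data.Nat.Base as ℕ using (ℕ; zero; suc; pred)
open import Data.Nat.Combinatorics using (nC1≡n; nCk+nC[k+1]≡[n+1]C[k+1]) renaming (_C_ to _choose_)
import Data.Nat.DivMod as ℕ
import Data.Nat.ListAction as ℕList
import Data.Nat.Properties as ℕ
import Data.Nat.Tactic.RingSolver as ℕSolver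
open import Data.Product.Base as Product using (∃; ∃-syntax; _×_; _,_; proj₁; proj₂)
open import Data.Sum.Base using (_⊎_; inj₁; inj₂)
open import Data.Vec.Base as Vec using (Vec; lookup; _∷ʳ_)
open import Data.Vec.Properties using (lookup-map)
open import Function.Base using (_∘_; id)
open import Level using (0ℓ)
open import Relation.Binary.Bundles using (TotalOrder)
import Relation.Binary.PropositionalEquality.Core as ≡
open ≡ using (_≡_; _≢_)
import Relation.Binary.Reasoning.PartialOrder
open import Relation.Nullary using (¬_; yes; no)
open import Relation.Nullary.Decidable.Core using (does)

-- Bounded differences are too weak here: one step can move the sum of squares by the largest
-- weight, which is linear in t on unlikely outcomes although its moments put it near t^(1/(2 + β)).
-- Working with moments throughout avoids any truncation. The sum of squares alone has no affine
-- recursion, because the block being filled gains 1 + β whatever the choice, and this leaves a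
-- multiple of its weight in the conditional mean. The exponent arises as follows. Noise of size
-- s^(1/(2 + β)) at time s is amplified by (t/s)^(2/(2 + β)), and 2/(2 + β) < 1 since β > 0, so the
-- late noise decides: the variance has order t^(1 + 2/(2 + β)), and half of that exponent is (4 +
-- β)/(4 + 2β). Taking the 2k-th root of the moment bound leaves the error t^(c/2k), which is below
-- t^ε for large k. All exponents in the recursions are natural numbers, with a rational P/q
-- slightly above 1/(2 + β) standing for it. Real powers are met only at the end, through lower
-- bounds on suprema.

module Concentration (em : ExcludedMiddle 0ℓ) (ℝ : RealField) where

  open RealField ℝ public hiding (_≉_)
  module ≤ = TotalOrder totalOrder
  open Relation.Binary.Reasoning.PartialOrder ≤.poset public
  open Algebra.Properties.CommutativeSemiring.Exp commutativeSemiring public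
    using (^-congˡ; ^-congʳ; ^-homo-*; ^-assocʳ; ^-distrib-*)
  private
    module Mult = Algebra.Properties.Semiring.Mult semiring

  -- Integer coefficients for the ring solver.

  fromℕ-+ : ∀ a b → fromℕ (a ℕ.+ b) ≈ fromℕ a + fromℕ b
  fromℕ-+ = Mult.×-homo-+ 1#

  fromℕ-* : ∀ a b → fromℕ (a ℕ.* b) ≈ fromℕ a * fromℕ b
  fromℕ-* = Mult.×1-homo-*

  -- The integer p − n is the pair (p ∸ n , n ∸ p).  The cases of ⟦_⟧ make the
  -- coefficients 0 and 1 denote 0# and 1# definitionally.
  module IntegerCoefficients where

    numeral : ℕ → Carrier
    numeral 0             = 0#
    numeral 1             = 1#
    numeral (suc (suc n)) = 1# + numeral (suc n)

    numeral≈ : ∀ n → numeral n ≈ fromℕ n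
    numeral≈ 0             = refl
    numeral≈ 1             = sym (+-identityʳ 1#)
    numeral≈ (suc (suc n)) = +-congˡ (numeral≈ (suc n))

    ⟦_⟧ : ℕ × ℕ → Carrier
    ⟦ p , zero ⟧  = numeral p
    ⟦ p , suc n ⟧ = numeral p - numeral (suc n)

    open Algebra.Properties.Ring ring using (-0#≈0#; -‿distribˡ-*; -‿distribʳ-*; -‿involutive; -‿+-comm)
    open Algebra.Properties.CommutativeSemigroup (CommutativeRing.+-commutativeSemigroup commutativeRing)
      using (interchange)

    ⟦⟧≈ : ∀ p n → ⟦ p , n ⟧ ≈ fromℕ p - fromℕ n
    ⟦⟧≈ p zero    = trans (numeral≈ p) (sym (trans (+-congˡ -0#≈0#) (+-identityʳ _)))
    ⟦⟧≈ p (suc n) = +-cong (numeral≈ p) (-‿cong (numeral≈ (suc n)))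

    difference-+ : ∀ a b c d → (a + b) - (c + d) ≈ (a - c) + (b - d)
    difference-+ a b c d = trans (+-congˡ (sym (-‿+-comm c d))) (interchange a b (- c) (- d))

    difference-* : ∀ a b c d → (a * c + b * d) - (a * d + b * c) ≈ (a - b) * (c - d)
    difference-* a b c d = sym (begin-equality
      (a - b) * (c - d)                              ≈⟨ distribʳ _ _ _ ⟩
      a * (c - d) + - b * (c - d)                    ≈⟨ +-cong (distribˡ _ _ _) (distribˡ _ _ _) ⟩
      (a * c + a * - d) + (- b * c + - b * - d)      ≈⟨ +-cong (+-congˡ (-‿distribʳ-* a d))
                                                               (+-cong (-‿distribˡ-* b c) minus*minus) ⟨
      (a * c + - (a * d)) + (- (b * c) + b * d)      ≈⟨ +-congˡ (+-comm _ _) ⟩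
      (a * c + - (a * d)) + (b * d + - (b * c))      ≈⟨ difference-+ _ _ _ _ ⟨
      (a * c + b * d) - (a * d + b * c)              ∎)
      where
      minus*minus : b * d ≈ - b * - d
      minus*minus = trans (sym (-‿involutive _)) (trans (-‿cong (-‿distribˡ-* b d)) (-‿distribʳ-* (- b) d))

    normalise : ℕ → ℕ → ℕ × ℕ
    normalise p n = p ℕ.∸ n , n ℕ.∸ p

    ⟦normalise⟧ : ∀ p n → ⟦ normalise p n ⟧ ≈ fromℕ p - fromℕ n
    ⟦normalise⟧ zero    zero    = ⟦⟧≈ 0 0
    ⟦normalise⟧ zero    (suc n) = ⟦⟧≈ 0 (suc n)
    ⟦normalise⟧ (suc p) zero    = ⟦⟧≈ (suc p) 0
    ⟦normalise⟧ (suc p) (suc n) = begin-equality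
      ⟦ normalise p n ⟧                    ≈⟨ ⟦normalise⟧ p n ⟩
      fromℕ p - fromℕ n                    ≈⟨ +-identityˡ _ ⟨
      0# + (fromℕ p - fromℕ n)             ≈⟨ +-congʳ (-‿inverseʳ 1#) ⟨
      (1# - 1#) + (fromℕ p - fromℕ n)      ≈⟨ difference-+ _ _ _ _ ⟨
      fromℕ (suc p) - fromℕ (suc n)        ∎

    coefficients : RawRing 0ℓ 0ℓ
    coefficients = record
      { Carrier = ℕ × ℕ
      ; _≈_ = _≡_
      ; _+_ = λ (p , n) (p′ , n′) → normalise (p ℕ.+ p′) (n ℕ.+ n′)
      ; _*_ = λ (p , n) (p′ , n′) → normalise (p ℕ.* p′ ℕ.+ n ℕ.* n′) (p ℕ.* n′ ℕ.+ n ℕ.* p′)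
      ; -_  = λ (p , n) → n , p
      ; 0#  = 0 , 0
      ; 1#  = 1 , 0
      }

    morphism : coefficients -Raw-AlmostCommutative⟶ fromCommutativeRing commutativeRing
    morphism = record
      { ⟦_⟧    = ⟦_⟧
      ; +-homo = λ (p , n) (p′ , n′) → begin-equality
          ⟦ normalise (p ℕ.+ p′) (n ℕ.+ n′) ⟧              ≈⟨ ⟦normalise⟧ (p ℕ.+ p′) (n ℕ.+ n′) ⟩
          fromℕ (p ℕ.+ p′) - fromℕ (n ℕ.+ n′)              ≈⟨ +-cong (fromℕ-+ p p′) (-‿cong (fromℕ-+ n n′)) ⟩
          (fromℕ p + fromℕ p′) - (fromℕ n + fromℕ n′)      ≈⟨ difference-+ _ _ _ _ ⟩
          (fromℕ p - fromℕ n) + (fromℕ p′ - fromℕ n′)      ≈⟨ +-cong (⟦⟧≈ p n) (⟦⟧≈ p′ n′) ⟨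
          ⟦ p , n ⟧ + ⟦ p′ , n′ ⟧                          ∎
      ; *-homo = λ (p , n) (p′ , n′) → begin-equality
          ⟦ normalise (p ℕ.* p′ ℕ.+ n ℕ.* n′) (p ℕ.* n′ ℕ.+ n ℕ.* p′) ⟧
            ≈⟨ ⟦normalise⟧ (p ℕ.* p′ ℕ.+ n ℕ.* n′) _ ⟩
          fromℕ (p ℕ.* p′ ℕ.+ n ℕ.* n′) - fromℕ (p ℕ.* n′ ℕ.+ n ℕ.* p′)
            ≈⟨ +-cong (products p p′ n n′) (-‿cong (products p n′ n p′)) ⟩
          (fromℕ p * fromℕ p′ + fromℕ n * fromℕ n′) - (fromℕ p * fromℕ n′ + fromℕ n * fromℕ p′)
            ≈⟨ difference-* _ _ _ _ ⟩
          (fromℕ p - fromℕ n) * (fromℕ p′ - fromℕ n′)      ≈⟨ *-cong (⟦⟧≈ p n) (⟦⟧≈ p′ n′) ⟨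
          ⟦ p , n ⟧ * ⟦ p′ , n′ ⟧                          ∎
      ; -‿homo = λ (p , n) → begin-equality
          ⟦ n , p ⟧                ≈⟨ ⟦⟧≈ n p ⟩
          fromℕ n - fromℕ p        ≈⟨ +-comm _ _ ⟩
          - fromℕ p + fromℕ n      ≈⟨ +-congˡ (-‿involutive _) ⟨
          - fromℕ p - - fromℕ n    ≈⟨ -‿+-comm _ _ ⟩
          - (fromℕ p - fromℕ n)    ≈⟨ -‿cong (⟦⟧≈ p n) ⟨
          - ⟦ p , n ⟧              ∎
      ; 0-homo = refl
      ; 1-homo = refl
      }
      where
      products : ∀ a b c d → fromℕ (a ℕ.* b ℕ.+ c ℕ.* d) ≈ fromℕ a * fromℕ b + fromℕ c * fromℕ d
      products a b c d = trans (fromℕ-+ (a ℕ.* b) (c ℕ.* d)) (+-cong (fromℕ-* a b) (fromℕ-* c d))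

    _≟_ : ∀ i j → Maybe (⟦ i ⟧ ≈ ⟦ j ⟧)
    (p , n) ≟ (p′ , n′) with p ℕ.≟ p′ | n ℕ.≟ n′
    ... | yes ≡.refl | yes ≡.refl = just refl
    ... | _          | _          = nothing

  module Solver = Algebra.Solver.Ring IntegerCoefficients.coefficients
    (fromCommutativeRing commutativeRing) IntegerCoefficients.morphism IntegerCoefficients._≟_
  open Solver public using (solve; con; _:=_; _:+_; _:*_; _:-_; :-_)

  -- `:2` is spelt as `1 + (1 + 0)` so that it denotes `fromℕ 2` definitionally; larger numerals are
  -- built in the same way.
  :0 :1 :2 : ∀ {n} → Solver.Polynomial n
  :0 = con (0 , 0)
  :1 = con (1 , 0)
  :2 = :1 :+ (:1 :+ :0)

  -- Ordered fields

  -- The standard way to an inequality below: name the nonnegative difference and leave the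
  -- remaining identity to the solver.
  ≤-by : ∀ {x y d} → 0# ≤ d → y ≈ x + d → x ≤ y
  ≤-by {x} {y} {d} 0≤d y≈x+d = begin
    x      ≈⟨ +-identityˡ x ⟨
    0# + x ≤⟨ +-monoˡ-≤ x 0≤d ⟩
    d + x  ≈⟨ +-comm d x ⟩
    x + d  ≈⟨ y≈x+d ⟨
    y      ∎

  0≤y-x : ∀ {x y} → x ≤ y → 0# ≤ y - x
  0≤y-x {x} {y} x≤y = begin
    0#    ≈⟨ -‿inverseʳ x ⟨
    x - x ≤⟨ +-monoˡ-≤ (- x) x≤y ⟩
    y - x ∎

  +-mono-≤ : ∀ {a b c d} → a ≤ b → c ≤ d → a + c ≤ b + d
  +-mono-≤ {a} {b} {c} {d} a≤b c≤d = begin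
    a + c ≤⟨ +-monoˡ-≤ c a≤b ⟩
    b + c ≈⟨ +-comm b c ⟩
    c + b ≤⟨ +-monoˡ-≤ b c≤d ⟩
    d + b ≈⟨ +-comm d b ⟩
    b + d ∎

  +-monoʳ-≤ : ∀ {x y} z → x ≤ y → z + x ≤ z + y
  +-monoʳ-≤ z = +-mono-≤ ≤.refl

  +-nonneg : ∀ {x y} → 0# ≤ x → 0# ≤ y → 0# ≤ x + y
  +-nonneg {x} {y} 0≤x 0≤y = ≤.trans (≤.reflexive (sym (+-identityʳ 0#))) (+-mono-≤ 0≤x 0≤y)

  *-monoʳ-≤ : ∀ {x y} z → 0# ≤ z → x ≤ y → z * x ≤ z * y
  *-monoʳ-≤ {x} {y} z 0≤z x≤y = ≤-by (*-nonneg 0≤z (0≤y-x x≤y))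
    (solve 3 (λ x y z → z :* y := z :* x :+ z :* (y :- x)) refl x y z)

  *-monoˡ-≤ : ∀ {x y} z → 0# ≤ z → x ≤ y → x * z ≤ y * z
  *-monoˡ-≤ {x} {y} z 0≤z x≤y = begin
    x * z ≈⟨ *-comm x z ⟩
    z * x ≤⟨ *-monoʳ-≤ z 0≤z x≤y ⟩
    z * y ≈⟨ *-comm z y ⟩
    y * z ∎

  *-mono-≤ : ∀ {a b c d} → 0# ≤ a → 0# ≤ d → a ≤ b → c ≤ d → a * c ≤ b * d
  *-mono-≤ {a} {b} {c} {d} 0≤a 0≤d a≤b c≤d = ≤.trans (*-monoʳ-≤ a 0≤a c≤d) (*-monoˡ-≤ d 0≤d a≤b)

  -‿nonneg : ∀ {x} → x ≤ 0# → 0# ≤ - x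
  -‿nonneg {x} x≤0 = ≤.trans (0≤y-x x≤0) (≤.reflexive (+-identityˡ (- x)))

  square-nonneg : ∀ x → 0# ≤ x * x
  square-nonneg x with ≤.total 0# x
  ... | inj₁ 0≤x = *-nonneg 0≤x 0≤x
  ... | inj₂ x≤0 = ≤.trans (*-nonneg (-‿nonneg x≤0) (-‿nonneg x≤0))
    (≤.reflexive (solve 1 (λ x → :- x :* :- x := x :* x) refl x))

  0≤1 : 0# ≤ 1#
  0≤1 = ≤.trans (square-nonneg 1#) (≤.reflexive (*-identityˡ 1#))

  ¬1≤0 : ¬ (1# ≤ 0#)
  ¬1≤0 1≤0 = 0≉1 (≤.antisym 0≤1 1≤0)

  0<1 : 0# < 1#
  0<1 = 0≤1 , 0≉1

  ≰⇒≥ : ∀ {x y} → ¬ (x ≤ y) → y ≤ x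
  ≰⇒≥ {x} {y} x≰y with ≤.total x y
  ... | inj₁ x≤y = ⊥-elim (x≰y x≤y)
  ... | inj₂ y≤x = y≤x

  ≰⇒> : ∀ {x y} → ¬ (x ≤ y) → y < x
  ≰⇒> x≰y = ≰⇒≥ x≰y , λ y≈x → x≰y (≤.reflexive (sym y≈x))

  <⇒≱ : ∀ {x y} → x < y → ¬ (y ≤ x)
  <⇒≱ (x≤y , x≉y) y≤x = x≉y (≤.antisym x≤y y≤x)

  <⇒≤ : ∀ {x y} → x < y → x ≤ y
  <⇒≤ = proj₁

  <-≤-trans : ∀ {x y z} → x < y → y ≤ z → x < z
  <-≤-trans x<y y≤z = ≰⇒> λ z≤x → <⇒≱ x<y (≤.trans y≤z z≤x)

  ≤-<-trans : ∀ {x y z} → x ≤ y → y < z → x < z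
  ≤-<-trans x≤y y<z = ≰⇒> λ z≤x → <⇒≱ y<z (≤.trans z≤x x≤y)

  <-by : ∀ {x y d} → 0# < d → y ≈ x + d → x < y
  <-by {x} {y} {d} 0<d y≈x+d = ≰⇒> λ y≤x → <⇒≱ 0<d (≤-by (0≤y-x y≤x)
    (trans (solve 2 (λ x d → :0 := d :+ (x :- (x :+ d))) refl x d) (+-congˡ (+-congˡ (-‿cong (sym y≈x+d))))))

  0<y-x : ∀ {x y} → x < y → 0# < y - x
  0<y-x {x} {y} x<y = ≰⇒> λ h → <⇒≱ x<y (≤-by (-‿nonneg h) (solve 2 (λ x y → x := y :+ :- (y :- x)) refl x y))

  *-pos : ∀ {x y} → 0# < x → 0# < y → 0# < x * y
  *-pos {x} {y} 0<x@(_ , 0≉x) 0<y@(_ , 0≉y) = *-nonneg (<⇒≤ 0<x) (<⇒≤ 0<y) , λ 0≈xy → 0≉y (begin-equality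
    0#               ≈⟨ zeroʳ _ ⟨
    x ⁻¹ * 0#        ≈⟨ *-congˡ 0≈xy ⟩
    x ⁻¹ * (x * y)   ≈⟨ solve 3 (λ i x y → i :* (x :* y) := (x :* i) :* y) refl (x ⁻¹) x y ⟩
    (x * x ⁻¹) * y   ≈⟨ *-congʳ (*-inverseʳ x (λ x≈0 → 0≉x (sym x≈0))) ⟩
    1# * y           ≈⟨ *-identityˡ y ⟩
    y                ∎)

  +-pos-nonneg : ∀ {x y} → 0# < x → 0# ≤ y → 0# < x + y
  +-pos-nonneg {x} {y} 0<x 0≤y = <-≤-trans 0<x (≤-by 0≤y refl)

  x*x⁻¹≈1 : ∀ {x} → 0# < x → x * x ⁻¹ ≈ 1#
  x*x⁻¹≈1 {x} (_ , 0≉x) = *-inverseʳ x λ x≈0 → 0≉x (sym x≈0)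

  ⁻¹-nonneg : ∀ {x} → 0# < x → 0# ≤ x ⁻¹
  ⁻¹-nonneg {x} 0<x with ≤.total 0# (x ⁻¹)
  ... | inj₁ h = h
  ... | inj₂ h = ⊥-elim (¬1≤0 (begin
    1#             ≈⟨ x*x⁻¹≈1 0<x ⟨
    x * x ⁻¹       ≤⟨ *-monoʳ-≤ x (<⇒≤ 0<x) h ⟩
    x * 0#         ≈⟨ zeroʳ x ⟩
    0#             ∎))

  /-cancel : ∀ {y} x → 0# < y → y * (x / y) ≈ x
  /-cancel {y} x 0<y = begin-equality
    y * (x * y ⁻¹)   ≈⟨ solve 3 (λ x y i → y :* (x :* i) := x :* (y :* i)) refl x y (y ⁻¹) ⟩
    x * (y * y ⁻¹)   ≈⟨ *-congˡ (x*x⁻¹≈1 0<y) ⟩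
    x * 1#           ≈⟨ *-identityʳ x ⟩
    x                ∎

  /-nonneg : ∀ {x y} → 0# ≤ x → 0# < y → 0# ≤ x / y
  /-nonneg 0≤x 0<y = *-nonneg 0≤x (⁻¹-nonneg 0<y)

  *-cancelˡ-≤ : ∀ {x y} z → 0# < z → z * x ≤ z * y → x ≤ y
  *-cancelˡ-≤ {x} {y} z 0<z zx≤zy = begin
    x                ≈⟨ rearrange x ⟨
    z ⁻¹ * (z * x)   ≤⟨ *-monoʳ-≤ (z ⁻¹) (⁻¹-nonneg 0<z) zx≤zy ⟩
    z ⁻¹ * (z * y)   ≈⟨ rearrange y ⟩
    y                ∎
    where
    rearrange : ∀ x → z ⁻¹ * (z * x) ≈ x
    rearrange x = trans (solve 3 (λ i z x → i :* (z :* x) := z :* (x :* i)) refl (z ⁻¹) z x) (/-cancel x 0<z)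

  /-≤ : ∀ {x y z} → 0# < y → x ≤ y * z → x / y ≤ z
  /-≤ {x} {y} 0<y h = *-cancelˡ-≤ y 0<y (≤.trans (≤.reflexive (/-cancel x 0<y)) h)

  fromℕ-nonneg : ∀ n → 0# ≤ fromℕ n
  fromℕ-nonneg zero    = ≤.refl
  fromℕ-nonneg (suc n) = +-nonneg 0≤1 (fromℕ-nonneg n)

  fromℕ-mono-≤ : ∀ {m n} → m ℕ.≤ n → fromℕ m ≤ fromℕ n
  fromℕ-mono-≤ {n = n} ℕ.z≤n = fromℕ-nonneg n
  fromℕ-mono-≤ (ℕ.s≤s m≤n)   = +-monoʳ-≤ 1# (fromℕ-mono-≤ m≤n)

  fromℕ-cancel-≤ : ∀ {m n} → fromℕ m ≤ fromℕ n → m ℕ.≤ n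
  fromℕ-cancel-≤ {m} {n} h with m ℕ.≤? n
  ... | yes m≤n = m≤n
  ... | no  m≰n = ⊥-elim (¬1≤0 (≤-by (0≤y-x (≤.trans (fromℕ-mono-≤ (ℕ.≰⇒> m≰n)) h))
    (solve 1 (λ n → :0 := :1 :+ (n :- (:1 :+ n))) refl (fromℕ n))))

  fromℕ-1 : fromℕ 1 ≈ 1#
  fromℕ-1 = +-identityʳ 1#

  1≤fromℕ : ∀ {n} → 1 ℕ.≤ n → 1# ≤ fromℕ n
  1≤fromℕ 1≤n = ≤.trans (≤.reflexive (sym fromℕ-1)) (fromℕ-mono-≤ 1≤n)

  0<fromℕ : ∀ {n} → 1 ℕ.≤ n → 0# < fromℕ n
  0<fromℕ 1≤n = <-≤-trans 0<1 (1≤fromℕ 1≤n)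

  ^-nonneg : ∀ {x} n → 0# ≤ x → 0# ≤ x ^ n
  ^-nonneg zero    0≤x = 0≤1
  ^-nonneg (suc n) 0≤x = *-nonneg 0≤x (^-nonneg n 0≤x)

  ^-pos : ∀ {x} n → 0# < x → 0# < x ^ n
  ^-pos zero    0<x = 0<1
  ^-pos (suc n) 0<x = *-pos 0<x (^-pos n 0<x)

  ^-monoˡ-≤ : ∀ {x y} n → 0# ≤ x → x ≤ y → x ^ n ≤ y ^ n
  ^-monoˡ-≤ zero    0≤x x≤y = ≤.refl
  ^-monoˡ-≤ (suc n) 0≤x x≤y = *-mono-≤ 0≤x (^-nonneg n (≤.trans 0≤x x≤y)) x≤y (^-monoˡ-≤ n 0≤x x≤y)

  1≤^ : ∀ {x} n → 1# ≤ x → 1# ≤ x ^ n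
  1≤^ zero    1≤x = ≤.refl
  1≤^ (suc n) 1≤x = begin
    1#        ≈⟨ *-identityʳ 1# ⟨
    1# * 1#   ≤⟨ *-mono-≤ 0≤1 (^-nonneg n (≤.trans 0≤1 1≤x)) 1≤x (1≤^ n 1≤x) ⟩
    _         ∎

  ^-monoʳ-≤ : ∀ {x m n} → 1# ≤ x → m ℕ.≤ n → x ^ m ≤ x ^ n
  ^-monoʳ-≤ {n = n} 1≤x ℕ.z≤n = 1≤^ n 1≤x
  ^-monoʳ-≤ {x} 1≤x (ℕ.s≤s m≤n) = *-monoʳ-≤ x (≤.trans 0≤1 1≤x) (^-monoʳ-≤ 1≤x m≤n)

  ^-cancelˡ-≤ : ∀ {x y} n → 1 ℕ.≤ n → 0# ≤ x → 0# ≤ y → x ^ n ≤ y ^ n → x ≤ y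
  ^-cancelˡ-≤ {x} {y} (suc n) _ 0≤x 0≤y h with em {x ≤ y}
  ... | yes x≤y = x≤y
  ... | no  x≰y = ⊥-elim (<⇒≱ (0<y-x (≰⇒> x≰y)) (*-cancelˡ-≤ (x ^ n) (^-pos n (≤-<-trans 0≤y (≰⇒> x≰y))) (begin
    x ^ n * (x - y)             ≈⟨ solve 3 (λ p x y → p :* (x :- y) := x :* p :- y :* p) refl (x ^ n) x y ⟩
    x * x ^ n - y * x ^ n       ≤⟨ +-monoˡ-≤ _ h ⟩
    y * y ^ n - y * x ^ n       ≤⟨ ≤-by (*-nonneg 0≤y (0≤y-x (^-monoˡ-≤ n 0≤y (≰⇒≥ x≰y))))
                                     (solve 3 (λ y p q → :0 := (y :* q :- y :* p) :+ y :* (p :- q)) refl y (x ^ n) (y ^ n)) ⟩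
    0#                          ≈⟨ zeroʳ _ ⟨
    x ^ n * 0#                  ∎)))

  bernoulli : ∀ {x} n → 0# ≤ x → 1# + fromℕ n * x ≤ (1# + x) ^ n
  bernoulli {x} zero    0≤x = ≤.reflexive (solve 1 (λ x → :1 :+ :0 :* x := :1) refl x)
  bernoulli {x} (suc n) 0≤x = begin
    1# + fromℕ (suc n) * x           ≤⟨ ≤-by (*-nonneg (fromℕ-nonneg n) (square-nonneg x))
      (solve 2 (λ x n → (:1 :+ x) :* (:1 :+ n :* x) := (:1 :+ (:1 :+ n) :* x) :+ n :* (x :* x)) refl x (fromℕ n)) ⟩
    (1# + x) * (1# + fromℕ n * x)    ≤⟨ *-monoʳ-≤ _ (+-nonneg 0≤1 0≤x) (bernoulli n 0≤x) ⟩
    (1# + x) ^ suc n                 ∎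

  -- If the naturals were bounded, the supremum minus 1 would still bound everything below some
  -- natural, since each `n` has a successor.
  archimedean : ∀ x → ∃[ n ] x ≤ fromℕ n
  archimedean x with em {∃[ n ] x ≤ fromℕ n}
  ... | yes h = h
  ... | no ¬h = ⊥-elim (¬1≤0 (≤-by (0≤y-x (sup-least P nonempty bounded (s - 1#) λ y (n , y≤n) → begin
      y                     ≤⟨ y≤n ⟩
      fromℕ n               ≈⟨ solve 1 (λ n → n := (:1 :+ n) :- :1) refl (fromℕ n) ⟩
      fromℕ (suc n) - 1#    ≤⟨ +-monoˡ-≤ _ (sup-upper P nonempty bounded (fromℕ (suc n)) (suc n , ≤.refl)) ⟩
      s - 1#                ∎))
    (solve 1 (λ s → :0 := :1 :+ ((s :- :1) :- s)) refl s)))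
    where
    P : Carrier → Set
    P y = ∃[ n ] y ≤ fromℕ n
    s : Carrier
    s = sup P
    nonempty : ∃ P
    nonempty = 0# , 0 , ≤.refl
    bounded : ∃ (UpperBound P)
    bounded = x , λ y (n , y≤n) → ≤.trans y≤n (≰⇒≥ λ x≤n → ¬h (n , x≤n))

  archimedean-* : ∀ {d} x → 0# < d → ∃[ n ] x ≤ fromℕ n * d
  archimedean-* {d} x 0<d with archimedean (x / d)
  ... | n , h = n , (begin
    x             ≈⟨ /-cancel x 0<d ⟨
    d * (x / d)   ≤⟨ *-monoʳ-≤ d (<⇒≤ 0<d) h ⟩
    d * fromℕ n   ≈⟨ *-comm _ _ ⟩
    fromℕ n * d   ∎)

  ∣∣-elim : ∀ {x z} → z ≤ ∣ x ∣ → z ≤ x ⊎ z ≤ - x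
  ∣∣-elim {x} {z} h with ≤.total (- x) x
  ... | inj₁ _ = inj₁ h
  ... | inj₂ _ = inj₂ h

  ∣∣-square : ∀ {x z} → 0# ≤ z → z ≤ ∣ x ∣ → z * z ≤ x * x
  ∣∣-square {x} {z} 0≤z h with ∣∣-elim h
  ... | inj₁ z≤x  = *-mono-≤ 0≤z (≤.trans 0≤z z≤x) z≤x z≤x
  ... | inj₂ z≤-x = ≤.trans (*-mono-≤ 0≤z (≤.trans 0≤z z≤-x) z≤-x z≤-x)
    (≤.reflexive (solve 1 (λ x → :- x :* :- x := x :* x) refl x))

  -- Real powers and powers of sums

  -- Stands in for continuity of powers: a small increase of `z` keeps `z ^ q` below any strict
  -- upper bound.
  ^-locally-lipschitz : ∀ q z → 0# ≤ z →
    ∃[ C ] (0# ≤ C × (∀ {η} → 0# ≤ η → η ≤ 1# → (z + η) ^ q ≤ z ^ q + η * C))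
  ^-locally-lipschitz zero    z 0≤z = 0# , ≤.refl , λ {η} _ _ →
    ≤.reflexive (solve 1 (λ η → :1 := :1 :+ η :* :0) refl η)
  ^-locally-lipschitz (suc q) z 0≤z with ^-locally-lipschitz q z 0≤z
  ... | C , 0≤C , bound = z ^ q + z * C + C , +-nonneg (+-nonneg (^-nonneg q 0≤z) (*-nonneg 0≤z 0≤C)) 0≤C ,
    λ {η} 0≤η η≤1 → begin
      (z + η) * (z + η) ^ q      ≤⟨ *-monoʳ-≤ _ (+-nonneg 0≤z 0≤η) (bound 0≤η η≤1) ⟩
      (z + η) * (z ^ q + η * C)  ≤⟨ ≤-by (*-nonneg (*-nonneg 0≤η 0≤C) (0≤y-x η≤1))
         (solve 4 (λ z η p C → z :* p :+ η :* (p :+ z :* C :+ C)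
           := (z :+ η) :* (p :+ η :* C) :+ (η :* C) :* (:1 :- η)) refl z η (z ^ q) C) ⟩
      z * z ^ q + η * (z ^ q + z * C + C) ∎

  module _ {a} (1≤a : 1# ≤ a) where

    private
      0≤a : 0# ≤ a
      0≤a = ≤.trans 0≤1 1≤a

    -- `sup-upper` applies only to a bounded set. A natural `X ≥ x` supplies the bound `a ^ X`,
    -- because `(p - r)/q ≤ X` gives `p ≤ r + X q`.
    ≤-^ʳ : ∀ {x y} p r q → 1 ℕ.≤ q → 0# ≤ y → fromℕ p - fromℕ r ≤ fromℕ q * x → y ^ q * a ^ r ≤ a ^ p → y ≤ a ^ʳ x
    ≤-^ʳ {x} {y} p r q 1≤q 0≤y h k = sup-upper _ (y , member) (bound (archimedean x)) y member
      where
      member = 0≤y , p , r , q , 1≤q , h , k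
      bound : ∃[ X ] x ≤ fromℕ X → ∃ (UpperBound _)
      bound (X , x≤X) = a ^ X , λ y (0≤y , p , r , q , 1≤q , h , k) →
        ^-cancelˡ-≤ q 1≤q 0≤y (^-nonneg X 0≤a) (*-cancelˡ-≤ (a ^ r) (^-pos r (<-≤-trans 0<1 1≤a)) (begin
          a ^ r * y ^ q          ≈⟨ *-comm _ _ ⟩
          y ^ q * a ^ r          ≤⟨ k ⟩
          a ^ p                  ≤⟨ ^-monoʳ-≤ {m = p} 1≤a (fromℕ-cancel-≤ {p} {r ℕ.+ X ℕ.* q} (begin
            fromℕ p                          ≈⟨ solve 2 (λ p r → p := r :+ (p :- r)) refl (fromℕ p) (fromℕ r) ⟩
            fromℕ r + (fromℕ p - fromℕ r)    ≤⟨ +-monoʳ-≤ _ (≤.trans h (*-monoʳ-≤ _ (fromℕ-nonneg q) x≤X)) ⟩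
            fromℕ r + fromℕ q * fromℕ X      ≈⟨ +-congˡ (*-comm _ _) ⟩
            fromℕ r + fromℕ X * fromℕ q      ≈⟨ +-congˡ (fromℕ-* X q) ⟨
            fromℕ r + fromℕ (X ℕ.* q)        ≈⟨ fromℕ-+ r (X ℕ.* q) ⟨
            fromℕ (r ℕ.+ X ℕ.* q)            ∎)) ⟩
          a ^ (r ℕ.+ X ℕ.* q)    ≈⟨ ^-homo-* a r (X ℕ.* q) ⟩
          a ^ r * a ^ (X ℕ.* q)  ≈⟨ *-congˡ (^-assocʳ a X q) ⟨
          a ^ r * (a ^ X) ^ q    ∎))

    module _ {x} r q (1≤q : 1 ℕ.≤ q) (r≤qx : fromℕ r ≤ fromℕ q * x) where

      private
        ≤-^ʳ-power : ∀ {y} → 0# ≤ y → y ^ q ≤ a ^ r → y ≤ a ^ʳ x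
        ≤-^ʳ-power {y} 0≤y k = ≤-^ʳ r 0 q 1≤q 0≤y
          (≤.trans (≤.reflexive (solve 1 (λ r → r :- :0 := r) refl (fromℕ r))) r≤qx)
          (≤.trans (≤.reflexive (*-identityʳ _)) k)

      0≤^ʳ : 0# ≤ a ^ʳ x
      0≤^ʳ = ≤-^ʳ-power ≤.refl (≤.trans (≤.reflexive (0^ q 1≤q)) (^-nonneg r 0≤a))
        where
        0^ : ∀ q → 1 ℕ.≤ q → 0# ^ q ≈ 0#
        0^ (suc q) _ = zeroˡ _

      -- Otherwise the supremum could be enlarged by a small `η` with its `q`-th power still at most
      -- `a ^ r`, and the enlarged number would belong to the set.
      ^≤^ʳ-^ : a ^ r ≤ (a ^ʳ x) ^ q
      ^≤^ʳ-^ with em {a ^ r ≤ (a ^ʳ x) ^ q}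
      ... | yes h = h
      ... | no ¬h = ⊥-elim (<⇒≱ 0<η (≤-by (0≤y-x (≤-^ʳ-power (+-nonneg 0≤^ʳ (<⇒≤ 0<η)) (begin
          (z + η) ^ q     ≤⟨ lipschitz (<⇒≤ 0<η) (/-≤ 0<D (≤-by 0≤C+1 (solve 2 (λ C δ → (C :+ δ :+ :1) :* :1 := δ :+ (C :+ :1)) refl C δ))) ⟩
          z ^ q + η * C   ≤⟨ +-monoʳ-≤ _ ηC≤δ ⟩
          z ^ q + δ       ≈⟨ solve 2 (λ u v → v :+ (u :- v) := u) refl (a ^ r) (z ^ q) ⟩
          a ^ r           ∎)))
        (solve 2 (λ z η → :0 := η :+ (z :- (z :+ η))) refl z η)))
        where
        z = a ^ʳ x
        δ = a ^ r - z ^ q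
        0<δ : 0# < δ
        0<δ = 0<y-x (≰⇒> ¬h)
        C = proj₁ (^-locally-lipschitz q z 0≤^ʳ)
        0≤C = proj₁ (proj₂ (^-locally-lipschitz q z 0≤^ʳ))
        lipschitz = proj₂ (proj₂ (^-locally-lipschitz q z 0≤^ʳ))
        0≤C+1 : 0# ≤ C + 1#
        0≤C+1 = +-nonneg 0≤C 0≤1
        0<D : 0# < C + δ + 1#
        0<D = <-≤-trans 0<δ (≤-by 0≤C+1 (solve 2 (λ C δ → C :+ δ :+ :1 := δ :+ (C :+ :1)) refl C δ))
        -- The denominator is at least `δ`, which gives `η ≤ 1`, and at least `C`, which gives
        -- `η * C ≤ δ`.
        η = δ / (C + δ + 1#)
        ηD≈δ : (C + δ + 1#) * η ≈ δ
        ηD≈δ = /-cancel δ 0<D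
        0<η : 0# < η
        0<η = ≰⇒> λ η≤0 → <⇒≱ 0<δ (begin
          δ                   ≈⟨ ηD≈δ ⟨
          (C + δ + 1#) * η    ≤⟨ *-monoʳ-≤ _ (<⇒≤ 0<D) η≤0 ⟩
          (C + δ + 1#) * 0#   ≈⟨ zeroʳ _ ⟩
          0#                  ∎)
        ηC≤δ : η * C ≤ δ
        ηC≤δ = ≤.trans (≤-by (*-nonneg (<⇒≤ 0<η) (+-nonneg (<⇒≤ 0<δ) 0≤1))
          (solve 3 (λ C δ η → (C :+ δ :+ :1) :* η := η :* C :+ η :* (δ :+ :1)) refl C δ η)) (≤.reflexive ηD≈δ)

  -- The Taylor expansion of x ↦ x^(2k) to second order, for k = i + 1.
  linearCoeff quadraticConst : ℕ → Carrier
  linearCoeff zero    = fromℕ 2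
  linearCoeff (suc i) = linearCoeff i + fromℕ 2
  quadraticConst zero    = 1#
  quadraticConst (suc i) = 1# + fromℕ 4 * linearCoeff i + fromℕ 6 * quadraticConst i

  linearCoeff-nonneg : ∀ i → 0# ≤ linearCoeff i
  linearCoeff-nonneg zero    = fromℕ-nonneg 2
  linearCoeff-nonneg (suc i) = +-nonneg (linearCoeff-nonneg i) (fromℕ-nonneg 2)

  quadraticConst-nonneg : ∀ i → 0# ≤ quadraticConst i
  quadraticConst-nonneg zero    = 0≤1
  quadraticConst-nonneg (suc i) = +-nonneg (+-nonneg 0≤1 (*-nonneg (fromℕ-nonneg 4) (linearCoeff-nonneg i)))
    (*-nonneg (fromℕ-nonneg 6) (quadraticConst-nonneg i))

  module _ {u v : Carrier} (0≤u : 0# ≤ u) (0≤v : 0# ≤ v) where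

    -- Whichever of `u` and `v` is larger may replace the other in the monomial. This and the next
    -- bound remove the mixed monomials from the Taylor remainder.
    u^i*v²≤ : ∀ i → u ^ i * (v * v) ≤ u ^ suc i * v + v ^ suc (suc i)
    u^i*v²≤ i with ≤.total u v
    ... | inj₁ u≤v = begin
      u ^ i * (v * v)    ≤⟨ *-monoˡ-≤ _ (*-nonneg 0≤v 0≤v) (^-monoˡ-≤ i 0≤u u≤v) ⟩
      v ^ i * (v * v)    ≤⟨ ≤-by (*-nonneg (^-nonneg (suc i) 0≤u) 0≤v)
        (solve 3 (λ p v w → w :+ v :* (v :* p) := p :* (v :* v) :+ w) refl (v ^ i) v (u ^ suc i * v)) ⟩
      u ^ suc i * v + v ^ suc (suc i) ∎
    ... | inj₂ v≤u = begin
      u ^ i * (v * v)      ≤⟨ *-monoʳ-≤ _ (^-nonneg i 0≤u) (*-monoˡ-≤ v 0≤v v≤u) ⟩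
      u ^ i * (u * v)      ≤⟨ ≤-by (^-nonneg (suc (suc i)) 0≤v)
        (solve 4 (λ p u v w → u :* p :* v :+ w := p :* (u :* v) :+ w) refl (u ^ i) u v (v ^ suc (suc i))) ⟩
      u ^ suc i * v + v ^ suc (suc i) ∎

    u*v^[1+i]≤ : ∀ i → u * v ^ suc i ≤ u ^ suc i * v + v ^ suc (suc i)
    u*v^[1+i]≤ i with ≤.total u v
    ... | inj₁ u≤v = begin
      u * v ^ suc i        ≤⟨ *-monoˡ-≤ _ (^-nonneg (suc i) 0≤v) u≤v ⟩
      v ^ suc (suc i)      ≤⟨ ≤-by (*-nonneg (^-nonneg (suc i) 0≤u) 0≤v) (+-comm _ _) ⟩
      u ^ suc i * v + v ^ suc (suc i) ∎
    ... | inj₂ v≤u = begin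
      u * v ^ suc i        ≤⟨ *-monoʳ-≤ u 0≤u (*-monoʳ-≤ v 0≤v (^-monoˡ-≤ i 0≤v v≤u)) ⟩
      u * (v * u ^ i)      ≤⟨ ≤-by (^-nonneg (suc (suc i)) 0≤v)
        (solve 4 (λ p u v w → u :* p :* v :+ w := u :* (v :* p) :+ w) refl (u ^ i) u v (v ^ suc (suc i))) ⟩
      u ^ suc i * v + v ^ suc (suc i) ∎

  -- The linear term is kept exactly, since it vanishes on averaging over centred `ξ`; only the
  -- remainder is estimated. The induction multiplies by the square `(a + ξ)²`, which preserves the
  -- inequality.
  even-power-expansion : ∀ i a ξ → let u = a * a; v = ξ * ξ in
    ((a + ξ) * (a + ξ)) ^ suc i ≤
    u ^ suc i + linearCoeff i * (a * u ^ i) * ξ + quadraticConst i * (u ^ i * v + v ^ suc i)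
  even-power-expansion zero a ξ = ≤-by (square-nonneg ξ)
    (solve 2 (λ a ξ → a :* a :* :1 :+ :2 :* (a :* :1) :* ξ :+ :1 :* (:1 :* (ξ :* ξ) :+ (ξ :* ξ) :* :1)
      := (a :+ ξ) :* (a :+ ξ) :* :1 :+ ξ :* ξ) refl a ξ)
  even-power-expansion (suc i) a ξ = begin
    s * s ^ suc i
      ≤⟨ *-monoʳ-≤ s (square-nonneg (a + ξ)) (even-power-expansion i a ξ) ⟩
    s * (u ^ suc i + ℓ * (a * p) * ξ + K * (p * v + v ^ suc i))
      -- Two nonnegative terms are added to clear cross terms: the one with `u - a ξ + v` cancels
      -- `a ξ v`, and `(a - ξ)²` turns the factor `(a + ξ)²` of `K` into `2 u + 2 v`.
      ≤⟨ ≤-by (+-nonneg (*-nonneg (*-nonneg 0≤ℓ (*-nonneg 0≤p 0≤v)) 0≤c) (*-nonneg 0≤K (*-nonneg 0≤d 0≤e)))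
          (solve 6 (λ a ξ p w ℓ K →
              (u′ a :* (u′ a :* p) :+ (ℓ :+ :2) :* (a :* (u′ a :* p)) :* ξ
                :+ ((:1 :+ :3 :* ℓ) :* (u′ a :* p :* u′ ξ) :+ ℓ :* (p :* (u′ ξ :* u′ ξ))
                   :+ :2 :* K :* (u′ a :* p :* u′ ξ :+ u′ a :* w :+ p :* (u′ ξ :* u′ ξ) :+ u′ ξ :* w)))
              := ((a :+ ξ) :* (a :+ ξ)) :* (u′ a :* p :+ ℓ :* (a :* p) :* ξ :+ K :* (p :* u′ ξ :+ w))
                 :+ (ℓ :* (p :* u′ ξ) :* (u′ a :- a :* ξ :+ u′ ξ) :+ K :* (((a :- ξ) :* (a :- ξ)) :* (p :* u′ ξ :+ w))))
            refl a ξ p (v ^ suc i) ℓ K) ⟩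
    u ^ suc (suc i) + (ℓ + fromℕ 2) * (a * u ^ suc i) * ξ
      + ((1# + fromℕ 3 * ℓ) * (u ^ suc i * v) + ℓ * (p * (v * v))
         + fromℕ 2 * K * (u ^ suc i * v + u * v ^ suc i + p * (v * v) + v ^ suc (suc i)))
      ≤⟨ +-monoʳ-≤ _ (+-mono-≤ (+-monoʳ-≤ _ (*-monoʳ-≤ ℓ 0≤ℓ (u^i*v²≤ 0≤u 0≤v i)))
           (*-monoʳ-≤ _ (*-nonneg (fromℕ-nonneg 2) 0≤K)
             (+-monoˡ-≤ _ (+-mono-≤ (+-monoʳ-≤ _ (u*v^[1+i]≤ 0≤u 0≤v i)) (u^i*v²≤ 0≤u 0≤v i))))) ⟩
    u ^ suc (suc i) + (ℓ + fromℕ 2) * (a * u ^ suc i) * ξ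
      + ((1# + fromℕ 3 * ℓ) * x + ℓ * (x + y) + fromℕ 2 * K * (x + (x + y) + (x + y) + y))
      ≤⟨ +-monoʳ-≤ _ (≤-by (*-nonneg (+-nonneg 0≤1 (*-nonneg (fromℕ-nonneg 3) 0≤ℓ)) (^-nonneg (suc (suc i)) 0≤v))
          (solve 4 (λ x y ℓ K → (:1 :+ :4 :* ℓ :+ :6 :* K) :* (x :+ y)
            := ((:1 :+ :3 :* ℓ) :* x :+ ℓ :* (x :+ y) :+ :2 :* K :* (x :+ (x :+ y) :+ (x :+ y) :+ y))
               :+ (:1 :+ :3 :* ℓ) :* y) refl x y ℓ K)) ⟩
    u ^ suc (suc i) + (ℓ + fromℕ 2) * (a * u ^ suc i) * ξ + quadraticConst (suc i) * (x + y) ∎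
    where
    s = (a + ξ) * (a + ξ)
    u = a * a
    v = ξ * ξ
    p = u ^ i
    ℓ = linearCoeff i
    K = quadraticConst i
    x = u ^ suc i * v
    y = v ^ suc (suc i)
    0≤u = square-nonneg a
    0≤v = square-nonneg ξ
    0≤ℓ = linearCoeff-nonneg i
    0≤K = quadraticConst-nonneg i
    0≤p = ^-nonneg i 0≤u
    0≤e : 0# ≤ p * v + v ^ suc i
    0≤e = +-nonneg (*-nonneg 0≤p 0≤v) (^-nonneg (suc i) 0≤v)
    0≤d = square-nonneg (a - ξ)
    0≤c : 0# ≤ u - a * ξ + v
    0≤c = *-cancelˡ-≤ (fromℕ 2) (0<fromℕ {2} (ℕ.s≤s ℕ.z≤n)) (≤-by (+-nonneg (+-nonneg 0≤d 0≤u) 0≤v)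
      (solve 2 (λ a ξ → :2 :* (a :* a :- a :* ξ :+ ξ :* ξ) := :2 :* :0 :+ ((a :- ξ) :* (a :- ξ) :+ a :* a :+ ξ :* ξ)) refl a ξ))
    u′ : ∀ {n} → Solver.Polynomial n → Solver.Polynomial n
    u′ a = a :* a
    :3 :4 :6 : ∀ {n} → Solver.Polynomial n
    :3 = :1 :+ :2
    :4 = :1 :+ :3
    :6 = :1 :+ (:1 :+ :4)

  -- Compare `K * s * v` with `u`: in either case one of the two terms on the right is already
  -- enough.
  weighted-young : ∀ i {K s u v} → 0# ≤ K → 0# < s → 0# ≤ u → 0# ≤ v →
    K * (u ^ i * v) ≤ s ⁻¹ * u ^ suc i + K * (K * s) ^ i * v ^ suc i
  weighted-young i {K} {s} {u} {v} 0≤K 0<s 0≤u 0≤v with ≤.total (K * s * v) u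
  ... | inj₁ h = begin
    K * (u ^ i * v)                      ≈⟨ *-identityˡ _ ⟨
    1# * (K * (u ^ i * v))               ≈⟨ *-congʳ (x*x⁻¹≈1 0<s) ⟨
    s * s ⁻¹ * (K * (u ^ i * v))
      ≈⟨ solve 5 (λ s j K p v → s :* j :* (K :* (p :* v)) := j :* (K :* s :* v :* p)) refl s (s ⁻¹) K (u ^ i) v ⟩
    s ⁻¹ * (K * s * v * u ^ i)           ≤⟨ *-monoʳ-≤ _ (⁻¹-nonneg 0<s) (*-monoˡ-≤ _ (^-nonneg i 0≤u) h) ⟩
    s ⁻¹ * u ^ suc i                     ≤⟨ ≤-by (*-nonneg (*-nonneg 0≤K (^-nonneg i (*-nonneg 0≤K (<⇒≤ 0<s))))
                                                   (^-nonneg (suc i) 0≤v)) refl ⟩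
    _                                    ∎
  ... | inj₂ h = begin
    K * (u ^ i * v)                      ≤⟨ *-monoʳ-≤ K 0≤K (*-monoˡ-≤ v 0≤v (^-monoˡ-≤ i 0≤u h)) ⟩
    K * ((K * s * v) ^ i * v)            ≈⟨ *-congˡ (*-congʳ (^-distrib-* (K * s) v i)) ⟩
    K * ((K * s) ^ i * v ^ i * v)        ≈⟨ solve 4 (λ K p q v → K :* (p :* q :* v) := K :* p :* (v :* q)) refl K _ _ v ⟩
    K * (K * s) ^ i * v ^ suc i          ≤⟨ ≤-by (*-nonneg (⁻¹-nonneg 0<s) (^-nonneg (suc i) 0≤u)) (+-comm _ _) ⟩
    _                                    ∎

  -- Used with `s` equal to the time, so that the factor `1 + s ⁻¹` costs one power of t in total,
  -- while the noise moment is multiplied by `s ^ i`.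
  even-power-step : ∀ i → ∃[ C ] (0# ≤ C × (∀ {s} a ξ → 1# ≤ s →
    ((a + ξ) * (a + ξ)) ^ suc i ≤
    (1# + s ⁻¹) * (a * a) ^ suc i + linearCoeff i * (a * (a * a) ^ i) * ξ + C * s ^ i * (ξ * ξ) ^ suc i))
  even-power-step i = K * K ^ i + K , +-nonneg (*-nonneg 0≤K (^-nonneg i 0≤K)) 0≤K , λ {s} a ξ 1≤s →
    let u = a * a; v = ξ * ξ; l = linearCoeff i * (a * u ^ i) * ξ in begin
    ((a + ξ) * (a + ξ)) ^ suc i
      ≤⟨ even-power-expansion i a ξ ⟩
    u ^ suc i + l + K * (u ^ i * v + v ^ suc i)
      ≈⟨ +-congˡ (distribˡ K _ _) ⟩
    u ^ suc i + l + (K * (u ^ i * v) + K * v ^ suc i)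
      ≤⟨ +-monoʳ-≤ _ (+-mono-≤ (weighted-young i 0≤K (<-≤-trans 0<1 1≤s) (square-nonneg a) (square-nonneg ξ))
           (≤-by (*-nonneg (*-nonneg 0≤K (^-nonneg (suc i) (square-nonneg ξ))) (0≤y-x (1≤^ i 1≤s)))
             (solve 3 (λ K p w → K :* p :* w := K :* w :+ K :* w :* (p :- :1)) refl K (s ^ i) (v ^ suc i)))) ⟩
    u ^ suc i + l + (s ⁻¹ * u ^ suc i + K * (K * s) ^ i * v ^ suc i + K * s ^ i * v ^ suc i)
      ≈⟨ +-congˡ (+-congʳ (+-congˡ (*-congʳ (*-congˡ (^-distrib-* K s i))))) ⟩
    u ^ suc i + l + (s ⁻¹ * u ^ suc i + K * (K ^ i * s ^ i) * v ^ suc i + K * s ^ i * v ^ suc i)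
      ≈⟨ solve 7 (λ U l j K p q w → U :+ l :+ (j :* U :+ K :* (p :* q) :* w :+ K :* q :* w)
           := (:1 :+ j) :* U :+ l :+ (K :* p :+ K) :* q :* w) refl (u ^ suc i) l (s ⁻¹) K (K ^ i) (s ^ i) (v ^ suc i) ⟩
    (1# + s ⁻¹) * u ^ suc i + l + (K * K ^ i + K) * s ^ i * v ^ suc i ∎
    where
    K = quadraticConst i
    0≤K = quadraticConst-nonneg i

  -- Recursions with polynomial growth.

  growth : ℕ → Carrier
  growth t = 1# + fromℕ t ⁻¹

  growth-nonneg : ∀ {t} → 1 ℕ.≤ t → 0# ≤ growth t
  growth-nonneg {t} 1≤t = +-nonneg 0≤1 (⁻¹-nonneg (0<fromℕ {t} 1≤t))

  fromℕ*growth : ∀ {t} → 1 ℕ.≤ t → fromℕ t * growth t ≈ fromℕ (suc t)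
  fromℕ*growth {t} 1≤t = begin-equality
    fromℕ t * (1# + fromℕ t ⁻¹)        ≈⟨ solve 2 (λ t i → t :* (:1 :+ i) := t :* i :+ t) refl (fromℕ t) _ ⟩
    fromℕ t * fromℕ t ⁻¹ + fromℕ t     ≈⟨ +-congʳ (x*x⁻¹≈1 (0<fromℕ {t} 1≤t)) ⟩
    fromℕ (suc t)                      ∎

  -- Since `t * growth t = t + 1`, the factor `growth t ^ a` turns `t ^ a` into `(t + 1) ^ a`
  -- without loss. Each source term is then at most `K (t + 1)^a t^i`, just what raising the
  -- remaining factor from `t` to `t + 1` provides.
  polynomial-growth : ∀ (v : ℕ → Carrier) t₀ a i {C} → 1 ℕ.≤ t₀ → 0# ≤ C → 0# ≤ v t₀ →
    (∀ t → t₀ ℕ.≤ t → v (suc t) ≤ growth t ^ a * v t + C * fromℕ t ^ (a ℕ.+ i)) →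
    ∀ t → t₀ ℕ.≤ t → v t ≤ (v t₀ + C) * fromℕ t ^ suc (a ℕ.+ i)
  polynomial-growth v t₀ a i {C} 1≤t₀ 0≤C 0≤v step t t₀≤t =
    ≡.subst (λ t → v t ≤ K * fromℕ t ^ E) (ℕ.m∸n+n≡m t₀≤t) (from-start (t ℕ.∸ t₀))
    where
    K = v t₀ + C
    E = suc (a ℕ.+ i)
    0≤K : 0# ≤ K
    0≤K = +-nonneg 0≤v 0≤C
    from-start : ∀ d → v (d ℕ.+ t₀) ≤ K * fromℕ (d ℕ.+ t₀) ^ E
    from-start zero = begin
      v t₀                ≤⟨ ≤-by 0≤C refl ⟩
      K                   ≈⟨ *-identityʳ K ⟨
      K * 1#              ≤⟨ *-monoʳ-≤ K 0≤K (1≤^ E (1≤fromℕ {t₀} 1≤t₀)) ⟩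
      K * fromℕ t₀ ^ E    ∎
    from-start (suc d) = begin
      v (suc n)
        ≤⟨ step n t₀≤n ⟩
      g ^ a * v n + C * T ^ (a ℕ.+ i)
        ≤⟨ +-mono-≤ (*-monoʳ-≤ _ (^-nonneg a (growth-nonneg 1≤n)) (from-start d))
                    (≤.reflexive (*-congˡ (^-homo-* T a i))) ⟩
      g ^ a * (K * (T * T ^ (a ℕ.+ i))) + C * (T ^ a * T ^ i)
        ≈⟨ +-congʳ (*-congˡ (*-congˡ (*-congˡ (^-homo-* T a i)))) ⟩
      g ^ a * (K * (T * (T ^ a * T ^ i))) + C * (T ^ a * T ^ i)
        ≈⟨ solve 6 (λ g K T P Q C → g :* (K :* (T :* (P :* Q))) :+ C :* (P :* Q)
             := K :* (P :* g) :* (T :* Q) :+ C :* P :* Q) refl (g ^ a) K T (T ^ a) (T ^ i) C ⟩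
      K * (T ^ a * g ^ a) * (T * T ^ i) + C * T ^ a * T ^ i
        ≈⟨ +-congʳ (*-congʳ (*-congˡ (trans (sym (^-distrib-* T g a)) (^-congˡ a (fromℕ*growth 1≤n))))) ⟩
      K * T₁ ^ a * (T * T ^ i) + C * T ^ a * T ^ i
        ≤⟨ +-monoʳ-≤ _ (*-monoˡ-≤ _ (^-nonneg i 0≤T) (*-mono-≤ 0≤C (^-nonneg a 0≤T₁)
             (≤-by 0≤v (+-comm _ _)) (^-monoˡ-≤ a 0≤T T≤T₁))) ⟩
      K * T₁ ^ a * (T * T ^ i) + K * T₁ ^ a * T ^ i
        ≈⟨ solve 3 (λ x T Q → x :* (T :* Q) :+ x :* Q := x :* ((:1 :+ T) :* Q)) refl (K * T₁ ^ a) T (T ^ i) ⟩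
      K * T₁ ^ a * (T₁ * T ^ i)
        ≤⟨ *-monoʳ-≤ _ (*-nonneg 0≤K (^-nonneg a 0≤T₁)) (*-monoʳ-≤ T₁ 0≤T₁ (^-monoˡ-≤ i 0≤T T≤T₁)) ⟩
      K * T₁ ^ a * (T₁ * T₁ ^ i)
        ≈⟨ solve 4 (λ K P T Q → K :* P :* (T :* Q) := K :* (T :* (P :* Q))) refl K (T₁ ^ a) T₁ (T₁ ^ i) ⟩
      K * (T₁ * (T₁ ^ a * T₁ ^ i))
        ≈⟨ *-congˡ (*-congˡ (^-homo-* T₁ a i)) ⟨
      K * T₁ ^ E ∎
      where
      n = d ℕ.+ t₀
      t₀≤n : t₀ ℕ.≤ n
      t₀≤n = ℕ.m≤n+m t₀ d
      1≤n = ℕ.≤-trans 1≤t₀ t₀≤n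
      g = growth n
      T = fromℕ n
      T₁ = fromℕ (suc n)
      0≤T = fromℕ-nonneg n
      0≤T₁ = fromℕ-nonneg (suc n)
      T≤T₁ : T ≤ T₁
      T≤T₁ = fromℕ-mono-≤ (ℕ.n≤1+n n)

  -- Bernoulli's inequality points the wrong way for the left-hand side. Its counterpart
  -- `(1 + y)^k (1 - k y) ≤ 1`, valid for either sign of `1 - k y`, bounds that side, and Bernoulli
  -- is applied to `growth t`.
  growth-power : ∀ {y} k p {t} → 1 ℕ.≤ t → 0# ≤ y → 1# ≤ (1# - fromℕ k * y) * (1# + fromℕ p * fromℕ t ⁻¹) →
    (1# + y) ^ k ≤ growth t ^ p
  growth-power {y} k p {t} 1≤t 0≤y h = begin
    (1# + y) ^ k                          ≈⟨ *-identityʳ _ ⟨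
    (1# + y) ^ k * 1#                     ≤⟨ *-monoʳ-≤ _ (^-nonneg k 0≤1+y) h ⟩
    (1# + y) ^ k * ((1# - fromℕ k * y) * (1# + fromℕ p * fromℕ t ⁻¹))
                                          ≈⟨ *-assoc _ _ _ ⟨
    (1# + y) ^ k * (1# - fromℕ k * y) * (1# + fromℕ p * fromℕ t ⁻¹)
                                          ≤⟨ *-monoˡ-≤ _ (+-nonneg 0≤1 (*-nonneg (fromℕ-nonneg p) 0≤t⁻¹)) (converse-bernoulli k) ⟩
    1# * (1# + fromℕ p * fromℕ t ⁻¹)      ≈⟨ *-identityˡ _ ⟩
    1# + fromℕ p * fromℕ t ⁻¹             ≤⟨ bernoulli p 0≤t⁻¹ ⟩
    growth t ^ p                          ∎
    where
    0≤t⁻¹ = ⁻¹-nonneg (0<fromℕ {t} 1≤t)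
    0≤1+y = +-nonneg 0≤1 0≤y
    converse-bernoulli : ∀ k → (1# + y) ^ k * (1# - fromℕ k * y) ≤ 1#
    converse-bernoulli zero    = ≤.reflexive (solve 1 (λ y → :1 :* (:1 :- :0 :* y) := :1) refl y)
    converse-bernoulli (suc k) = begin
      (1# + y) * (1# + y) ^ k * (1# - fromℕ (suc k) * y)
        ≤⟨ ≤-by (*-nonneg (^-nonneg k 0≤1+y) (*-nonneg (fromℕ-nonneg (suc k)) (square-nonneg y)))
             (solve 3 (λ y p k → p :* (:1 :- k :* y) := (:1 :+ y) :* p :* (:1 :- (:1 :+ k) :* y) :+ p :* ((:1 :+ k) :* (y :* y)))
               refl y ((1# + y) ^ k) (fromℕ k)) ⟩
      (1# + y) ^ k * (1# - fromℕ k * y) ≤⟨ converse-bernoulli k ⟩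
      1# ∎

  -- Rising factorials.

  rising : ℕ → Carrier → Carrier
  rising zero    x = 1#
  rising (suc q) x = rising q x * (x + fromℕ q)

  rising-nonneg : ∀ q {x} → 0# ≤ x → 0# ≤ rising q x
  rising-nonneg zero    0≤x = 0≤1
  rising-nonneg (suc q) 0≤x = *-nonneg (rising-nonneg q 0≤x) (+-nonneg 0≤x (fromℕ-nonneg q))

  rising-mono : ∀ q {x y} → 0# ≤ x → x ≤ y → rising q x ≤ rising q y
  rising-mono zero    0≤x x≤y = ≤.refl
  rising-mono (suc q) 0≤x x≤y = *-mono-≤ (rising-nonneg q 0≤x) (+-nonneg (≤.trans 0≤x x≤y) (fromℕ-nonneg q))
    (rising-mono q 0≤x x≤y) (+-monoˡ-≤ _ x≤y)

  rising-cong : ∀ q {x y} → x ≈ y → rising q x ≈ rising q y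
  rising-cong zero    x≈y = refl
  rising-cong (suc q) x≈y = *-cong (rising-cong q x≈y) (+-congʳ x≈y)

  rising-zero : ∀ q → rising (suc q) 0# ≈ 0#
  rising-zero zero    = solve 0 (:1 :* (:0 :+ :0) := :0) refl
  rising-zero (suc q) = trans (*-congʳ (rising-zero q)) (zeroˡ _)

  -- If a block of weight x is hit with probability x / N, this identity shows that
  -- the expectation of its rising factorial gains exactly the factor 1 + q / N.
  rising-shift : ∀ q x → rising q (x + 1#) * x ≈ rising q x * (x + fromℕ q)
  rising-shift zero    x = *-congˡ (sym (+-identityʳ x))
  rising-shift (suc q) x = begin-equality
    rising q (x + 1#) * (x + 1# + fromℕ q) * x
      ≈⟨ solve 3 (λ r x q → r :* (x :+ :1 :+ q) :* x := r :* x :* (x :+ (:1 :+ q))) refl (rising q (x + 1#)) x (fromℕ q) ⟩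
    rising q (x + 1#) * x * (x + fromℕ (suc q))   ≈⟨ *-congʳ (rising-shift q x) ⟩
    rising (suc q) x * (x + fromℕ (suc q))        ∎

  ^≤rising : ∀ q {x} → 0# ≤ x → x ^ q ≤ rising q x
  ^≤rising zero    0≤x = ≤.refl
  ^≤rising (suc q) {x} 0≤x = ≤.trans (≤.reflexive (*-comm x _))
    (*-mono-≤ (^-nonneg q 0≤x) (+-nonneg 0≤x (fromℕ-nonneg q)) (^≤rising q 0≤x) (≤-by (fromℕ-nonneg q) refl))

  -- Finite sums and expectations

  module _ {A : Set} where

    sum : List A → (A → Carrier) → Carrier
    sum xs f = foldr (λ a s → f a + s) 0# xs

    sum-cong : ∀ xs {f g} → (∀ a → f a ≈ g a) → sum xs f ≈ sum xs g
    sum-cong []       h = refl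
    sum-cong (x ∷ xs) h = +-cong (h x) (sum-cong xs h)

    sum-mono : ∀ xs {f g} → (∀ a → f a ≤ g a) → sum xs f ≤ sum xs g
    sum-mono []       h = ≤.refl
    sum-mono (x ∷ xs) h = +-mono-≤ (h x) (sum-mono xs h)

    sum-zero : ∀ xs → sum xs (λ _ → 0#) ≈ 0#
    sum-zero []       = refl
    sum-zero (x ∷ xs) = trans (+-identityˡ _) (sum-zero xs)

    sum-nonneg : ∀ xs {f} → (∀ a → 0# ≤ f a) → 0# ≤ sum xs f
    sum-nonneg xs h = ≤.trans (≤.reflexive (sym (sum-zero xs))) (sum-mono xs h)

    sum-+ : ∀ xs {f g} → sum xs (λ a → f a + g a) ≈ sum xs f + sum xs g
    sum-+ []       = sym (+-identityʳ 0#)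
    sum-+ (x ∷ xs) {f} {g} = trans (+-congˡ (sum-+ xs))
      (solve 4 (λ a b c d → a :+ b :+ (c :+ d) := a :+ c :+ (b :+ d)) refl (f x) (g x) (sum xs f) (sum xs g))

    sum-*ˡ : ∀ xs c {f} → sum xs (λ a → c * f a) ≈ c * sum xs f
    sum-*ˡ []       c = sym (zeroʳ c)
    sum-*ˡ (x ∷ xs) c = trans (+-congˡ (sum-*ˡ xs c)) (sym (distribˡ c _ _))

    sum-++ : ∀ xs ys {f} → sum (xs ++ ys) f ≈ sum xs f + sum ys f
    sum-++ []       ys = sym (+-identityˡ _)
    sum-++ (x ∷ xs) ys = trans (+-congˡ (sum-++ xs ys)) (sym (+-assoc _ _ _))

  sum-map : ∀ {A B : Set} (g : A → B) xs {f} → sum (map g xs) f ≡ sum xs (f ∘ g)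
  sum-map g []       = ≡.refl
  sum-map g (x ∷ xs) = ≡.cong (_ +_) (sum-map g xs)

  sum-cartesianProductWith : ∀ {A B C : Set} (g : A → B → C) xs ys {f} →
    sum (cartesianProductWith g xs ys) f ≈ sum xs λ a → sum ys λ b → f (g a b)
  sum-cartesianProductWith g []       ys = refl
  sum-cartesianProductWith g (x ∷ xs) ys = trans (sum-++ (map (g x) ys) _)
    (+-cong (reflexive (sum-map (g x) ys)) (sum-cartesianProductWith g xs ys))

  sum-allFin-suc : ∀ n {f : Fin (suc n) → Carrier} → sum (allFin (suc n)) f ≡ f Fin.zero + sum (allFin n) (f ∘ Fin.suc)
  sum-allFin-suc n {f} = ≡.cong (f Fin.zero +_)
    (≡.trans (≡.cong (λ xs → sum xs f) (≡.sym (map-tabulate id Fin.suc))) (sum-map Fin.suc (allFin n)))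

  sum-lookup-∷ʳ : ∀ {A : Set} {n} (xs : Vec A n) x (F : A → Carrier) →
    sum (allFin (suc n)) (F ∘ lookup (xs ∷ʳ x)) ≈ sum (allFin n) (F ∘ lookup xs) + F x
  sum-lookup-∷ʳ Vec.[] x F = trans (+-identityʳ _) (sym (+-identityˡ _))
  sum-lookup-∷ʳ {n = suc n} (y Vec.∷ xs) x F = begin-equality
    sum (allFin (suc (suc n))) (F ∘ lookup ((y Vec.∷ xs) ∷ʳ x))              ≡⟨ sum-allFin-suc (suc n) ⟩
    F y + sum (allFin (suc n)) (F ∘ lookup (xs ∷ʳ x))                     ≈⟨ +-congˡ (sum-lookup-∷ʳ xs x F) ⟩
    F y + (sum (allFin n) (F ∘ lookup xs) + F x)                          ≈⟨ +-assoc _ _ _ ⟨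
    F y + sum (allFin n) (F ∘ lookup xs) + F x                            ≡⟨ ≡.cong (_+ F x) (sum-allFin-suc n) ⟨
    sum (allFin (suc n)) (F ∘ lookup (y Vec.∷ xs)) + F x                  ∎

  sum-toℕ-last : ∀ n (F : ℕ → Carrier) → sum (allFin (suc n)) (F ∘ toℕ) ≈ sum (allFin n) (F ∘ toℕ) + F n
  sum-toℕ-last zero    F = trans (+-identityʳ _) (sym (+-identityˡ _))
  sum-toℕ-last (suc n) F = begin-equality
    sum (allFin (suc (suc n))) (F ∘ toℕ)                  ≡⟨ sum-allFin-suc (suc n) ⟩
    F 0 + sum (allFin (suc n)) (F ∘ suc ∘ toℕ)            ≈⟨ +-congˡ (sum-toℕ-last n (F ∘ suc)) ⟩
    F 0 + (sum (allFin n) (F ∘ suc ∘ toℕ) + F (suc n))    ≈⟨ +-assoc _ _ _ ⟨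
    F 0 + sum (allFin n) (F ∘ suc ∘ toℕ) + F (suc n)      ≡⟨ ≡.cong (_+ F (suc n)) (sum-allFin-suc n) ⟨
    sum (allFin (suc n)) (F ∘ toℕ) + F (suc n)            ∎

  sum-toℕ : ∀ n (F : ℕ → Carrier) → sum (allFin n) (F ∘ toℕ) ≈ sum (downFrom n) F
  sum-toℕ zero    F = refl
  sum-toℕ (suc n) F = trans (sum-toℕ-last n F) (trans (+-comm _ _) (+-congˡ (sum-toℕ n F)))

  sum-downFrom-cong : ∀ n {f g} → (∀ b → b ℕ.< n → f b ≈ g b) → sum (downFrom n) f ≈ sum (downFrom n) g
  sum-downFrom-cong zero    h = refl
  sum-downFrom-cong (suc n) h = +-cong (h n ℕ.≤-refl) (sum-downFrom-cong n λ b b<n → h b (ℕ.m≤n⇒m≤1+n b<n))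

  δ : ℕ → ℕ → Carrier
  δ zero    zero    = 1#
  δ zero    (suc _) = 0#
  δ (suc _) zero    = 0#
  δ (suc a) (suc b) = δ a b

  δ-≡ : ∀ {a b} → a ≡ b → δ a b ≈ 1#
  δ-≡ {zero}  ≡.refl = refl
  δ-≡ {suc a} ≡.refl = δ-≡ {a} ≡.refl

  δ-≢ : ∀ {a b} → a ≢ b → δ a b ≈ 0#
  δ-≢ {zero}  {zero}  h = ⊥-elim (h ≡.refl)
  δ-≢ {zero}  {suc b} h = refl
  δ-≢ {suc a} {zero}  h = refl
  δ-≢ {suc a} {suc b} h = δ-≢ {a} {b} (h ∘ ≡.cong suc)

  δ-nonneg : ∀ a b → 0# ≤ δ a b
  δ-nonneg zero    zero    = 0≤1
  δ-nonneg zero    (suc b) = ≤.refl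
  δ-nonneg (suc a) zero    = ≤.refl
  δ-nonneg (suc a) (suc b) = δ-nonneg a b

  δ≤1 : ∀ a b → δ a b ≤ 1#
  δ≤1 zero    zero    = ≤.refl
  δ≤1 zero    (suc b) = 0≤1
  δ≤1 (suc a) zero    = 0≤1
  δ≤1 (suc a) (suc b) = δ≤1 a b

  sum-δ : ∀ n {a} (G : ℕ → Carrier) → a ℕ.< n → sum (downFrom n) (λ b → δ a b * G b) ≈ G a
  sum-δ (suc n) {a} G a<1+n with a ℕ.≟ n
  ... | yes ≡.refl = begin-equality
    δ n n * G n + sum (downFrom n) (λ b → δ n b * G b)
      ≈⟨ +-cong (*-congʳ (δ-≡ {n} ≡.refl)) (sum-downFrom-cong n λ b b<n →
           trans (*-congʳ (δ-≢ (ℕ.>⇒≢ b<n))) (zeroˡ _)) ⟩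
    1# * G n + sum (downFrom n) (λ _ → 0#)   ≈⟨ +-cong (*-identityˡ _) (sum-zero (downFrom n)) ⟩
    G n + 0#                                 ≈⟨ +-identityʳ _ ⟩
    G n                                      ∎
  ... | no a≢n = begin-equality
    δ a n * G n + sum (downFrom n) (λ b → δ a b * G b)
      ≈⟨ +-cong (trans (*-congʳ (δ-≢ a≢n)) (zeroˡ _)) (sum-δ n G (ℕ.≤∧≢⇒< (ℕ.≤-pred a<1+n) a≢n)) ⟩
    0# + G a                                 ≈⟨ +-identityˡ _ ⟩
    G a                                      ∎

  -- Expectations over the attachment process.

  module Attachment (β : Carrier) (0<β : 0# < β) where

    open Process ℝ β public

    0≤β : 0# ≤ β
    0≤β = <⇒≤ 0<β

    normaliser-suc : ∀ k → normaliser (suc k) ≈ β + (fromℕ 2 + β) * fromℕ k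
    normaliser-suc k = solve 2 (λ β k → (:2 :+ β) :* (:1 :+ k) :- :2 := β :+ (:2 :+ β) :* k) refl β (fromℕ k)

    0<normaliser : ∀ {n} → 1 ℕ.≤ n → 0# < normaliser n
    0<normaliser {suc k} _ = <-≤-trans 0<β
      (≤-by (*-nonneg (+-nonneg (fromℕ-nonneg 2) 0≤β) (fromℕ-nonneg k)) (normaliser-suc k))

    conditional : ∀ {n} → (Choice n → Carrier) → Carrier
    conditional {n} X = sum (choices n) λ c → choiceProb c * X c

    -- The unnormalised mean of `F` at the next target: every vertex counts `β`, every half-edge
    -- counts 1.
    total : ∀ {n} → (ℕ → Carrier) → Outcome n → Carrier
    total {n} F ω = β * sum (allFin n) (F ∘ toℕ) +
      (sum (allFin (pred n)) (F ∘ toℕ ∘ lookup (heads ω)) + sum (allFin (pred n)) (F ∘ toℕ ∘ tailOf {n}))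

    conditional-target : ∀ {n} F (ω : Outcome n) →
      conditional (λ c → F (toℕ (target (heads ω) c))) ≈ normaliser n ⁻¹ * total F ω
    conditional-target {n} F ω = begin-equality
      sum (vs ++ hs ++ ts) f
        ≈⟨ trans (sum-++ vs (hs ++ ts)) (+-congˡ (sum-++ hs ts)) ⟩
      sum vs f + (sum hs f + sum ts f)
        ≈⟨ +-cong (reflexive (sum-map vertex (allFin n)))
                  (+-cong (reflexive (sum-map (head {n}) (allFin (pred n)))) (reflexive (sum-map (tail {n}) (allFin (pred n))))) ⟩
      sum (allFin n) (λ i → β * i⁻¹ * F (toℕ i)) +
        (sum (allFin (pred n)) (λ j → 1# * i⁻¹ * F (toℕ (lookup (heads ω) j))) +
         sum (allFin (pred n)) (λ j → 1# * i⁻¹ * F (toℕ (tailOf {n} j))))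
        ≈⟨ +-cong (sum-*ˡ (allFin n) _) (+-cong (sum-*ˡ (allFin (pred n)) _) (sum-*ˡ (allFin (pred n)) _)) ⟩
      β * i⁻¹ * _ + (1# * i⁻¹ * _ + 1# * i⁻¹ * _)
        ≈⟨ solve 5 (λ β i x y z → β :* i :* x :+ (:1 :* i :* y :+ :1 :* i :* z) := i :* (β :* x :+ (y :+ z))) refl β i⁻¹ _ _ _ ⟩
      i⁻¹ * total F ω ∎
      where
      i⁻¹ = normaliser n ⁻¹
      f = λ c → choiceProb c * F (toℕ (target (heads ω) c))
      vs = map vertex (allFin n)
      hs = map (head {n}) (allFin (pred n))
      ts = map (tail {n}) (allFin (pred n))

    -- The new vertex has index `suc k`; it brings `β` for itself and 1 as the tail of its edge,
    -- while the head half-edge lies at the target.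
    total-step : ∀ {k} F (ω : Outcome (suc k)) c →
      total F (ω ▷ c) ≈ total F ω + (F (toℕ (target (heads ω) c)) + (1# + β) * F (suc k))
    total-step {k} F ω c = begin-equality
      β * sum (allFin (suc (suc k))) (F ∘ toℕ) +
        (sum (allFin (suc k)) (F ∘ toℕ ∘ lookup (heads (ω ▷ c))) + sum (allFin (suc k)) (F ∘ suc ∘ toℕ))
        ≈⟨ +-cong (*-congˡ (sum-toℕ-last (suc k) F)) (+-cong
             (trans (sum-lookup-∷ʳ (Vec.map inject₁ (heads ω)) _ (F ∘ toℕ))
               (+-cong (sum-cong (allFin k) λ j → reflexive (≡.cong F
                  (≡.trans (≡.cong toℕ (lookup-map j inject₁ (heads ω))) (Fin.toℕ-inject₁ _))))
                 (reflexive (≡.cong F (Fin.toℕ-inject₁ _)))))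
             (sum-toℕ-last k (F ∘ suc))) ⟩
      β * (_ + F (suc k)) + ((_ + F (toℕ (target (heads ω) c))) + (_ + F (suc k)))
        ≈⟨ solve 6 (λ β x y z f g → β :* (x :+ g) :+ ((y :+ f) :+ (z :+ g))
             := (β :* x :+ (y :+ z)) :+ (f :+ (:1 :+ β) :* g)) refl β _ _ _ _ _ ⟩
      _ ∎

    total-cong : ∀ {n F G} (ω : Outcome n) → (∀ i → i ℕ.< n → F i ≈ G i) → total F ω ≈ total G ω
    total-cong {n} ω h = +-cong (*-congˡ (sum-cong (allFin n) λ i → h _ (Fin.toℕ<n i)))
      (+-cong (sum-cong (allFin (pred n)) λ _ → h _ (Fin.toℕ<n _)) (sum-cong (allFin (pred n)) λ _ → h _ (Fin.toℕ<n _)))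

    total-nonneg : ∀ {n F} (ω : Outcome n) → (∀ i → 0# ≤ F i) → 0# ≤ total F ω
    total-nonneg {n} ω h = +-nonneg (*-nonneg 0≤β (sum-nonneg (allFin n) λ _ → h _))
      (+-nonneg (sum-nonneg (allFin (pred n)) λ _ → h _) (sum-nonneg (allFin (pred n)) λ _ → h _))

    total-zero : ∀ {n} (ω : Outcome n) → total (λ _ → 0#) ω ≈ 0#
    total-zero {n} ω = trans (+-cong (*-congˡ (sum-zero (allFin n))) (+-cong (sum-zero (allFin (pred n))) (sum-zero (allFin (pred n)))))
      (solve 1 (λ β → β :* :0 :+ (:0 :+ :0) := :0) refl β)

    -- This is what makes the choice probabilities sum to 1, and later what makes the sum of all
    -- block weights deterministic.
    total-one : ∀ {n} (ω : Outcome n) → total (λ _ → 1#) ω ≈ normaliser n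
    total-one start = solve 1 (λ β → β :* (:1 :+ :0) :+ (:0 :+ :0) := (:2 :+ β) :* (:1 :+ :0) :- :2) refl β
    total-one (_▷_ {k} ω c) = trans (total-step (λ _ → 1#) ω c) (trans (+-congʳ (total-one ω))
      (solve 2 (λ β k → (:2 :+ β) :* (:1 :+ k) :- :2 :+ (:1 :+ (:1 :+ β) :* :1) := (:2 :+ β) :* (:1 :+ (:1 :+ k)) :- :2)
        refl β (fromℕ k)))

    1≤size : ∀ {n} → Outcome n → 1 ℕ.≤ n
    1≤size start   = ℕ.s≤s ℕ.z≤n
    1≤size (_ ▷ _) = ℕ.s≤s ℕ.z≤n

    choiceProb-nonneg : ∀ {n} → 1 ℕ.≤ n → (c : Choice n) → 0# ≤ choiceProb c
    choiceProb-nonneg 1≤n (vertex _) = /-nonneg 0≤β (0<normaliser 1≤n)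
    choiceProb-nonneg 1≤n (head _)   = /-nonneg 0≤1 (0<normaliser 1≤n)
    choiceProb-nonneg 1≤n (tail _)   = /-nonneg 0≤1 (0<normaliser 1≤n)

    conditional-cong : ∀ {n} {X Y : Choice n → Carrier} → (∀ c → X c ≈ Y c) → conditional X ≈ conditional Y
    conditional-cong {n} h = sum-cong (choices n) λ c → *-congˡ (h c)

    conditional-mono : ∀ {n} {X Y : Choice n → Carrier} → 1 ℕ.≤ n → (∀ c → X c ≤ Y c) → conditional X ≤ conditional Y
    conditional-mono {n} 1≤n h = sum-mono (choices n) λ c → *-monoʳ-≤ _ (choiceProb-nonneg 1≤n c) (h c)

    conditional-+ : ∀ {n} {X Y : Choice n → Carrier} → conditional (λ c → X c + Y c) ≈ conditional X + conditional Y
    conditional-+ {n} = trans (sum-cong (choices n) λ c → distribˡ _ _ _) (sum-+ (choices n))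

    conditional-*ˡ : ∀ {n} x {X : Choice n → Carrier} → conditional (λ c → x * X c) ≈ x * conditional X
    conditional-*ˡ {n} x {X} = trans
      (sum-cong (choices n) λ c → solve 3 (λ p x y → p :* (x :* y) := x :* (p :* y)) refl (choiceProb c) x (X c))
      (sum-*ˡ (choices n) x)

    conditional-const : ∀ {n} → Outcome n → ∀ x → conditional {n} (λ _ → x) ≈ x
    conditional-const {n} ω x = begin-equality
      conditional {n} (λ _ → x)              ≈⟨ conditional-cong {n} (λ _ → sym (*-identityʳ x)) ⟩
      conditional {n} (λ _ → x * 1#)         ≈⟨ conditional-*ˡ {n} x ⟩
      x * conditional {n} (λ _ → 1#)         ≈⟨ *-congˡ (conditional-target (λ _ → 1#) ω) ⟩
      x * (normaliser n ⁻¹ * total _ ω)      ≈⟨ *-congˡ (*-congˡ (total-one ω)) ⟩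
      x * (normaliser n ⁻¹ * normaliser n)   ≈⟨ *-congˡ (trans (*-comm _ _) (x*x⁻¹≈1 (0<normaliser (1≤size ω)))) ⟩
      x * 1#                                 ≈⟨ *-identityʳ x ⟩
      x                                      ∎

    outcomeProb-nonneg : ∀ {n} (ω : Outcome n) → 0# ≤ outcomeProb ω
    outcomeProb-nonneg start   = 0≤1
    outcomeProb-nonneg (ω ▷ c) = *-nonneg (outcomeProb-nonneg ω) (choiceProb-nonneg (ℕ.s≤s ℕ.z≤n) c)

    𝔼-cong : ∀ {n} {X Y : Outcome n → Carrier} → (∀ ω → X ω ≈ Y ω) → 𝔼 X ≈ 𝔼 Y
    𝔼-cong {n} h = sum-cong (outcomes n) λ ω → *-congˡ (h ω)

    𝔼-mono : ∀ {n} {X Y : Outcome n → Carrier} → (∀ ω → X ω ≤ Y ω) → 𝔼 X ≤ 𝔼 Y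
    𝔼-mono {n} h = sum-mono (outcomes n) λ ω → *-monoʳ-≤ _ (outcomeProb-nonneg ω) (h ω)

    𝔼-nonneg : ∀ {n} {X : Outcome n → Carrier} → (∀ ω → 0# ≤ X ω) → 0# ≤ 𝔼 X
    𝔼-nonneg {n} h = sum-nonneg (outcomes n) λ ω → *-nonneg (outcomeProb-nonneg ω) (h ω)

    𝔼-+ : ∀ {n} {X Y : Outcome n → Carrier} → 𝔼 (λ ω → X ω + Y ω) ≈ 𝔼 X + 𝔼 Y
    𝔼-+ {n} = trans (sum-cong (outcomes n) λ ω → distribˡ _ _ _) (sum-+ (outcomes n))

    𝔼-*ˡ : ∀ {n} x {X : Outcome n → Carrier} → 𝔼 (λ ω → x * X ω) ≈ x * 𝔼 X
    𝔼-*ˡ {n} x {X} = trans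
      (sum-cong (outcomes n) λ ω → solve 3 (λ p x y → p :* (x :* y) := x :* (p :* y)) refl (outcomeProb ω) x (X ω))
      (sum-*ˡ (outcomes n) x)

    𝔼-step : ∀ {k} (X : Outcome (suc (suc k)) → Carrier) → 𝔼 X ≈ 𝔼 (λ ω → conditional λ c → X (ω ▷ c))
    𝔼-step {k} X = trans (sum-cartesianProductWith _▷_ (outcomes (suc k)) (choices (suc k)))
      (sum-cong (outcomes (suc k)) λ ω → trans (sum-cong (choices (suc k)) λ c → *-assoc _ _ _) (sum-*ˡ (choices (suc k)) _))

    𝔼-const : ∀ {n} → 1 ℕ.≤ n → ∀ x → 𝔼 {n} (λ _ → x) ≈ x
    𝔼-const {suc zero}    _ x = solve 1 (λ x → :1 :* x :+ :0 := x) refl x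
    𝔼-const {suc (suc k)} _ x = trans (𝔼-step {k} (λ _ → x))
      (trans (𝔼-cong {suc k} λ ω → conditional-const ω x) (𝔼-const {suc k} (ℕ.s≤s ℕ.z≤n) x))

  -- The urn of block weights

  δ-sym : ∀ a b → δ a b ≡ δ b a
  δ-sym zero    zero    = ≡.refl
  δ-sym zero    (suc b) = ≡.refl
  δ-sym (suc a) zero    = ≡.refl
  δ-sym (suc a) (suc b) = δ-sym a b

  -- The witness is one of the values, so its rising factorial is a summand. The order is a
  -- successor because the empty range has witness 0, where `rising` of positive order vanishes.
  maximum : ∀ q n {f : ℕ → Carrier} → (∀ b → 0# ≤ f b) → ∃[ M ] (0# ≤ M × (∀ b → b ℕ.< n → f b ≤ M) ×
    rising (suc q) M ≤ sum (downFrom n) (λ b → rising (suc q) (f b)))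
  maximum q zero    0≤f = 0# , ≤.refl , (λ _ ()) , ≤.reflexive (rising-zero q)
  maximum q (suc n) {f} 0≤f with maximum q n {f} 0≤f
  ... | M , 0≤M , bound , h with ≤.total (f n) M
  ...   | inj₁ fn≤M = M , 0≤M ,
    (λ b b<1+n → case b b<1+n) , ≤.trans h (≤-by (rising-nonneg (suc q) (0≤f n)) (+-comm _ _))
    where
    case : ∀ b → b ℕ.< suc n → f b ≤ M
    case b b<1+n with b ℕ.≟ n
    ... | yes ≡.refl = fn≤M
    ... | no  b≢n    = bound b (ℕ.≤∧≢⇒< (ℕ.≤-pred b<1+n) b≢n)
  ...   | inj₂ M≤fn = f n , 0≤f n ,
    (λ b b<1+n → case b b<1+n) , ≤-by (sum-nonneg (downFrom n) λ b → rising-nonneg (suc q) (0≤f b)) refl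
    where
    case : ∀ b → b ℕ.< suc n → f b ≤ f n
    case b b<1+n with b ℕ.≟ n
    ... | yes ≡.refl = ≤.refl
    ... | no  b≢n    = ≤.trans (bound b (ℕ.≤∧≢⇒< (ℕ.≤-pred b<1+n) b≢n)) M≤fn

  module Urn (β : Carrier) (0<β : 0# < β) (m-1 : ℕ) where

    open Attachment β 0<β public

    m : ℕ
    m = suc m-1

    block : ℕ → ℕ
    block i = i ℕ./ m

    block≤ : ∀ i → block i ℕ.≤ i
    block≤ i = ℕ.m/n≤m i m

    block*m≤ : ∀ i → block i ℕ.* m ℕ.≤ i
    block*m≤ i = ℕ.m/n*n≤m i m

    <[1+block]*m : ∀ i → i ℕ.< suc (block i) ℕ.* m
    <[1+block]*m i = ≡.subst (ℕ._< suc (block i) ℕ.* m) (≡.sym (ℕ.m≡m%n+[m/n]*n i m))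
      (ℕ.+-monoˡ-< (block i ℕ.* m) (ℕ.m%n<n i m))

    weight : ∀ {n} → Outcome n → ℕ → Carrier
    weight ω b = total (λ i → δ (block i) b) ω

    targetBlock : ∀ {n} → Outcome n → Choice n → ℕ
    targetBlock ω c = block (toℕ (target (heads ω) c))

    targetBlock< : ∀ {n} (ω : Outcome n) c → targetBlock ω c ℕ.< n
    targetBlock< ω c = ℕ.≤-<-trans (block≤ _) (Fin.toℕ<n (target (heads ω) c))

    weight-step : ∀ {k} (ω : Outcome (suc k)) c b →
      weight (ω ▷ c) b ≈ weight ω b + (δ (targetBlock ω c) b + (1# + β) * δ (block (suc k)) b)
    weight-step ω c b = total-step (λ i → δ (block i) b) ω c

    weight-nonneg : ∀ {n} (ω : Outcome n) b → 0# ≤ weight ω b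
    weight-nonneg ω b = total-nonneg ω λ i → δ-nonneg (block i) b

    weight-absent : ∀ {n} (ω : Outcome n) b → (∀ i → i ℕ.< n → block i ≢ b) → weight ω b ≈ 0#
    weight-absent ω b h = trans (total-cong ω λ i i<n → δ-≢ (h i i<n)) (total-zero ω)

    weight-future : ∀ {n} (ω : Outcome n) b → n ℕ.≤ b ℕ.* m → weight ω b ≈ 0#
    weight-future ω b n≤bm = weight-absent ω b λ { i i<n ≡.refl → ℕ.<⇒≱ i<n (ℕ.≤-trans n≤bm (block*m≤ i)) }

    weight-last : ∀ {n} (ω : Outcome n) → weight ω n ≈ 0#
    weight-last {n} ω = weight-future ω n (ℕ.m≤m*n n m)

    -- No sum is rearranged: both sides satisfy the recursion of `total-step`, so induction on the
    -- outcome suffices.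
    total-block : ∀ {n} (ω : Outcome n) (G : ℕ → Carrier) →
      total (G ∘ block) ω ≈ sum (downFrom n) (λ b → weight ω b * G b)
    total-block start G = solve 2 (λ β g → β :* (g :+ :0) :+ (:0 :+ :0)
      := (β :* (:1 :+ :0) :+ (:0 :+ :0)) :* g :+ :0) refl β (G 0)
    total-block (_▷_ {k} ω c) G = sym (begin-equality
      sum (downFrom (suc n)) (λ b → weight (ω ▷ c) b * G b)
        ≈⟨ sum-cong (downFrom (suc n)) (λ b → trans (*-congʳ (weight-step ω c b))
             (solve 5 (λ w d β e g → (w :+ (d :+ (:1 :+ β) :* e)) :* g := w :* g :+ (d :* g :+ (:1 :+ β) :* (e :* g)))
               refl (weight ω b) (δ τ b) β (δ (block n) b) (G b))) ⟩
      sum (downFrom (suc n)) (λ b → weight ω b * G b + (δ τ b * G b + (1# + β) * (δ (block n) b * G b)))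
        ≈⟨ trans (sum-+ (downFrom (suc n))) (+-congˡ (trans (sum-+ (downFrom (suc n))) (+-congˡ (sum-*ˡ (downFrom (suc n)) _)))) ⟩
      weight ω n * G n + sum (downFrom n) (λ b → weight ω b * G b) +
        (sum (downFrom (suc n)) (λ b → δ τ b * G b) + (1# + β) * sum (downFrom (suc n)) (λ b → δ (block n) b * G b))
        ≈⟨ +-cong (trans (+-congʳ (trans (*-congʳ (weight-last ω)) (zeroˡ _))) (+-identityˡ _))
             (+-cong (sum-δ (suc n) G (ℕ.m≤n⇒m≤1+n (targetBlock< ω c))) (*-congˡ (sum-δ (suc n) G (ℕ.s≤s (block≤ n))))) ⟩
      sum (downFrom n) (λ b → weight ω b * G b) + (G τ + (1# + β) * G (block n))
        ≈⟨ +-congʳ (total-block ω G) ⟨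
      total (G ∘ block) ω + (G τ + (1# + β) * G (block n))
        ≈⟨ total-step (G ∘ block) ω c ⟨
      total (G ∘ block) (ω ▷ c) ∎)
      where
      n = suc k
      τ = targetBlock ω c

    conditional-targetBlock : ∀ {n} (ω : Outcome n) (G : ℕ → Carrier) →
      conditional (λ c → G (targetBlock ω c)) ≈ normaliser n ⁻¹ * sum (downFrom n) (λ b → weight ω b * G b)
    conditional-targetBlock ω G = trans (conditional-target (G ∘ block) ω) (*-congˡ (total-block ω G))

    -- While a block is filled, each of its vertices raises its weight by at most `2 + β`: `1 + β`
    -- for the vertex and its tail, and 1 if the new edge points into the block. Truncated
    -- subtraction covers blocks not yet begun.
    weight-growing : ∀ {n} (ω : Outcome n) b → n ℕ.≤ suc b ℕ.* m → weight ω b ≤ (fromℕ 2 + β) * fromℕ (n ℕ.∸ b ℕ.* m)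
    weight-growing {n} ω b n≤ with n ℕ.≤? b ℕ.* m
    ... | yes n≤bm = ≤.trans (≤.reflexive (weight-future ω b n≤bm))
      (*-nonneg (+-nonneg (fromℕ-nonneg 2) 0≤β) (fromℕ-nonneg (n ℕ.∸ b ℕ.* m)))
    weight-growing start zero n≤ | no _ = ≤-by (fromℕ-nonneg 2)
      (solve 1 (λ β → (:2 :+ β) :* (:1 :+ :0) := β :* (:1 :+ :0) :+ (:0 :+ :0) :+ :2) refl β)
    weight-growing start (suc b) n≤ | no 1≰ = ⊥-elim (1≰ (ℕ.s≤s ℕ.z≤n))
    weight-growing {n} (_▷_ {k} ω c) b n≤ | no n≰bm = begin
      weight (ω ▷ c) b
        ≈⟨ weight-step ω c b ⟩
      weight ω b + (δ (targetBlock ω c) b + (1# + β) * δ (block (suc k)) b)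
        ≤⟨ +-mono-≤ (weight-growing ω b (ℕ.≤-trans (ℕ.n≤1+n _) n≤))
             (+-mono-≤ (δ≤1 (targetBlock ω c) b) (*-monoʳ-≤ _ (+-nonneg 0≤1 0≤β) (δ≤1 (block (suc k)) b))) ⟩
      (fromℕ 2 + β) * fromℕ (suc k ℕ.∸ b ℕ.* m) + (1# + (1# + β) * 1#)
        ≈⟨ solve 2 (λ β x → (:2 :+ β) :* x :+ (:1 :+ (:1 :+ β) :* :1) := (:2 :+ β) :* (:1 :+ x))
             refl β (fromℕ (suc k ℕ.∸ b ℕ.* m)) ⟩
      (fromℕ 2 + β) * fromℕ (suc (suc k ℕ.∸ b ℕ.* m))
        ≡⟨ ≡.cong (λ x → (fromℕ 2 + β) * fromℕ x) (ℕ.+-∸-assoc 1 {suc k} {b ℕ.* m} (ℕ.≤-pred (ℕ.≰⇒> n≰bm))) ⟨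
      (fromℕ 2 + β) * fromℕ (suc (suc k) ℕ.∸ b ℕ.* m) ∎

    blockBound : Carrier
    blockBound = (fromℕ 2 + β) * fromℕ m

    weight-growing-bound : ∀ {n} (ω : Outcome n) b → n ℕ.≤ suc b ℕ.* m → weight ω b ≤ blockBound
    weight-growing-bound {n} ω b n≤ = ≤.trans (weight-growing ω b n≤)
      (*-monoʳ-≤ _ (+-nonneg (fromℕ-nonneg 2) 0≤β)
        (fromℕ-mono-≤ (ℕ.m≤n+o⇒m∸n≤o n (b ℕ.* m) (≡.subst (n ℕ.≤_) (ℕ.+-comm m (b ℕ.* m)) n≤))))

    -- The range need not follow the number of blocks: `block i ≤ i` places every nonempty block
    -- below `n`, and an empty block contributes 0 when `q` is positive.
    moment : ∀ q {n} → Outcome n → Carrier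
    moment q {n} ω = sum (downFrom n) λ b → rising q (weight ω b)

    moment-nonneg : ∀ q {n} (ω : Outcome n) → 0# ≤ moment q ω
    moment-nonneg q {n} ω = sum-nonneg (downFrom n) λ b → rising-nonneg q (weight-nonneg ω b)

    module _ (q-1 : ℕ) {k} (ω : Outcome (suc k)) where

      private
        q = suc q-1
        n = suc k
        w = weight ω
        increment : ℕ → Carrier
        increment b = rising q (w b + 1#) - rising q (w b)

        0≤increment : ∀ b → 0# ≤ increment b
        0≤increment b = 0≤y-x (rising-mono q (weight-nonneg ω b) (≤-by 0≤1 refl))

      -- The current block also receives a deterministic `1 + β`, which does not fit the
      -- rising-factorial recursion. Its whole new value is bounded by a constant instead; any other
      -- block changes by exactly 0 or 1.
      rising-weight-step : ∀ c b → rising q (weight (ω ▷ c) b) ≤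
        rising q (w b) + (δ (targetBlock ω c) b * increment b + δ (block n) b * rising q blockBound)
      rising-weight-step c b with block n ℕ.≟ b
      ... | yes ≡.refl = begin
        rising q (weight (ω ▷ c) b)    ≤⟨ rising-mono q (weight-nonneg (ω ▷ c) b)
                                            (weight-growing-bound (ω ▷ c) b (<[1+block]*m n)) ⟩
        rising q blockBound            ≈⟨ trans (*-congʳ (δ-≡ {b} ≡.refl)) (*-identityˡ _) ⟨
        δ b b * rising q blockBound    ≤⟨ ≤-by (+-nonneg (rising-nonneg q (weight-nonneg ω b))
                                                 (*-nonneg (δ-nonneg (targetBlock ω c) b) (0≤increment b)))
                                            (solve 3 (λ x y z → x :+ (y :+ z) := z :+ (x :+ y)) refl _ _ _) ⟩
        _                              ∎
      ... | no block≢b with targetBlock ω c ℕ.≟ b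
      ...   | yes τ≡b = ≤.reflexive (begin-equality
        rising q (weight (ω ▷ c) b)
          ≈⟨ rising-cong q (trans (weight-step ω c b) (+-congˡ (+-cong (δ-≡ τ≡b) (*-congˡ (δ-≢ block≢b))))) ⟩
        rising q (w b + (1# + (1# + β) * 0#))
          ≈⟨ rising-cong q (+-congˡ (trans (+-congˡ (zeroʳ _)) (+-identityʳ 1#))) ⟩
        rising q (w b + 1#)
          ≈⟨ solve 3 (λ x y z → x := y :+ (:1 :* (x :- y) :+ :0 :* z)) refl _ (rising q (w b)) (rising q blockBound) ⟩
        rising q (w b) + (1# * increment b + 0# * rising q blockBound)
          ≈⟨ +-congˡ (+-cong (*-congʳ (δ-≡ τ≡b)) (*-congʳ (δ-≢ block≢b))) ⟨
        _ ∎)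
      ...   | no τ≢b = ≤.reflexive (begin-equality
        rising q (weight (ω ▷ c) b)
          ≈⟨ rising-cong q (trans (weight-step ω c b) (+-congˡ (+-cong (δ-≢ τ≢b) (*-congˡ (δ-≢ block≢b))))) ⟩
        rising q (w b + (0# + (1# + β) * 0#))
          ≈⟨ rising-cong q (solve 2 (λ w β → w :+ (:0 :+ (:1 :+ β) :* :0) := w) refl (w b) β) ⟩
        rising q (w b)
          ≈⟨ solve 3 (λ y i z → y := y :+ (:0 :* i :+ :0 :* z)) refl _ (increment b) (rising q blockBound) ⟩
        rising q (w b) + (0# * increment b + 0# * rising q blockBound)
          ≈⟨ +-congˡ (+-cong (*-congʳ (δ-≢ τ≢b)) (*-congʳ (δ-≢ block≢b))) ⟨
        _ ∎)

      moment-▷ : ∀ c → moment q (ω ▷ c) ≤ (moment q ω + rising q blockBound) + increment (targetBlock ω c)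
      moment-▷ c = begin
        moment q (ω ▷ c)
          ≤⟨ sum-mono (downFrom (suc n)) (rising-weight-step c) ⟩
        sum (downFrom (suc n)) (λ b → rising q (w b) + (δ τ b * increment b + δ (block n) b * rising q blockBound))
          ≈⟨ trans (sum-+ (downFrom (suc n))) (+-congˡ (sum-+ (downFrom (suc n)))) ⟩
        rising q (w n) + moment q ω + (sum (downFrom (suc n)) (λ b → δ τ b * increment b) +
          sum (downFrom (suc n)) (λ b → δ (block n) b * rising q blockBound))
          ≈⟨ +-cong (+-congʳ (trans (rising-cong q (weight-last ω)) (rising-zero q-1)))
               (+-cong (sum-δ (suc n) increment (ℕ.m≤n⇒m≤1+n (targetBlock< ω c)))
                       (sum-δ (suc n) (λ _ → rising q blockBound) (ℕ.s≤s (block≤ n)))) ⟩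
        0# + moment q ω + (increment τ + rising q blockBound)
          ≈⟨ solve 3 (λ x y z → :0 :+ x :+ (y :+ z) := x :+ z :+ y) refl (moment q ω) (increment τ) _ ⟩
        moment q ω + rising q blockBound + increment τ ∎
        where
        τ = targetBlock ω c

      -- Block `b` is hit with probability `w b / N`, and `rising-shift` turns `w b * increment b`
      -- into `q * rising q (w b)`. The estimate is inexact only at the current block.
      conditional-moment : conditional (λ c → moment q (ω ▷ c)) ≤
        (1# + fromℕ q * normaliser n ⁻¹) * moment q ω + rising q blockBound
      conditional-moment = begin
        conditional (λ c → moment q (ω ▷ c))
          ≤⟨ conditional-mono (ℕ.s≤s ℕ.z≤n) moment-▷ ⟩
        conditional (λ c → x + increment (targetBlock ω c))
          ≈⟨ trans (conditional-+ {n}) (+-cong (conditional-const ω x) (conditional-targetBlock ω increment)) ⟩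
        x + normaliser n ⁻¹ * sum (downFrom n) (λ b → w b * increment b)
          ≈⟨ +-congˡ (*-congˡ (trans (sum-cong (downFrom n) λ b → begin-equality
               w b * (rising q (w b + 1#) - rising q (w b))
                 ≈⟨ solve 3 (λ w x y → w :* (x :- y) := x :* w :- y :* w) refl (w b) _ _ ⟩
               rising q (w b + 1#) * w b - rising q (w b) * w b
                 ≈⟨ +-congʳ (rising-shift q (w b)) ⟩
               rising q (w b) * (w b + fromℕ q) - rising q (w b) * w b
                 ≈⟨ solve 3 (λ w q y → y :* (w :+ q) :- y :* w := q :* y) refl (w b) (fromℕ q) _ ⟩
               fromℕ q * rising q (w b) ∎) (sum-*ˡ (downFrom n) (fromℕ q)))) ⟩
        x + normaliser n ⁻¹ * (fromℕ q * moment q ω)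
          ≈⟨ solve 4 (λ s r i q → s :+ r :+ i :* (q :* s) := (:1 :+ q :* i) :* s :+ r) refl (moment q ω) (rising q blockBound) _ (fromℕ q) ⟩
        _ ∎
        where
        x = moment q ω + rising q blockBound

  -- The martingale part of the sum of squares

  module Deviation (β : Carrier) (0<β : 0# < β) (m-1 : ℕ) where

    open Urn β 0<β m-1 public

    0≤1+β : 0# ≤ 1# + β
    0≤1+β = +-nonneg 0≤1 0≤β

    quadratic : ∀ {n} → Outcome n → Carrier
    quadratic {n} ω = sum (downFrom n) λ b → weight ω b * weight ω b

    private
      e : Carrier
      e = fromℕ 2 * (1# + β)

      0≤e : 0# ≤ e
      0≤e = *-nonneg (fromℕ-nonneg 2) 0≤1+β

    -- slope r n is the coefficient, at time n, of the weight of the unfinished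
    -- block with r vertices to come; the recursion is the condition for
    -- potential-▷ to be affine in the potential.
    slope : ℕ → ℕ → Carrier
    slope zero    n = 0#
    slope (suc r) n = (normaliser n + 1#) / (normaliser n + fromℕ 2) * (fromℕ 2 * (1# + β) + slope r (suc n))

    0<normaliser+2 : ∀ {n} → 1 ℕ.≤ n → 0# < normaliser n + fromℕ 2
    0<normaliser+2 1≤n = +-pos-nonneg (0<normaliser 1≤n) (fromℕ-nonneg 2)

    slope-nonneg : ∀ r {n} → 1 ℕ.≤ n → 0# ≤ slope r n
    slope-nonneg zero    1≤n = ≤.refl
    slope-nonneg (suc r) 1≤n = *-nonneg
      (/-nonneg (+-nonneg (<⇒≤ (0<normaliser 1≤n)) 0≤1) (0<normaliser+2 1≤n))
      (+-nonneg 0≤e (slope-nonneg r (ℕ.s≤s ℕ.z≤n)))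

    slope≤ : ∀ r {n} → 1 ℕ.≤ n → slope r n ≤ fromℕ r * (fromℕ 2 * (1# + β))
    slope≤ zero    1≤n = ≤.reflexive (sym (zeroˡ _))
    slope≤ (suc r) {n} 1≤n = begin
      (normaliser n + 1#) / (normaliser n + fromℕ 2) * (e + slope r (suc n))
        ≤⟨ *-mono-≤ (/-nonneg (+-nonneg (<⇒≤ (0<normaliser 1≤n)) 0≤1) (0<normaliser+2 1≤n))
             (+-nonneg 0≤e (*-nonneg (fromℕ-nonneg r) 0≤e))
             (/-≤ (0<normaliser+2 1≤n) (≤-by 0≤1 (solve 1 (λ x → (x :+ :2) :* :1 := x :+ :1 :+ :1) refl (normaliser n))))
             (+-monoʳ-≤ e (slope≤ r (ℕ.s≤s ℕ.z≤n))) ⟩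
      1# * (e + fromℕ r * e)
        ≈⟨ solve 2 (λ e r → :1 :* (e :+ r :* e) := (:1 :+ r) :* e) refl e (fromℕ r) ⟩
      fromℕ (suc r) * e ∎

    remaining : ℕ → ℕ
    remaining n = suc (block n) ℕ.* m ℕ.∸ n

    nextSlope : ℕ → Carrier
    nextSlope n = slope (suc (block n) ℕ.* m ℕ.∸ suc n) (suc n)

    potential : ∀ {n} → Outcome n → Carrier
    potential {n} ω = quadratic ω + slope (remaining n) n * weight ω (block n)

    -- Vertex `n` itself is still to come in its block, so `remaining n` is positive and the
    -- recursive clause of `slope` always applies.
    slope-remaining : ∀ n → slope (remaining n) n ≡
      (normaliser n + 1#) / (normaliser n + fromℕ 2) * (fromℕ 2 * (1# + β) + nextSlope n)
    slope-remaining n = ≡.cong (λ r → slope r n) (ℕ.+-∸-assoc 1 (<[1+block]*m n))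

    nextSlope-nonneg : ∀ n → 0# ≤ nextSlope n
    nextSlope-nonneg n = slope-nonneg (suc (block n) ℕ.* m ℕ.∸ suc n) (ℕ.s≤s ℕ.z≤n)

    nextSlope≤ : ∀ n → nextSlope n ≤ fromℕ m * (fromℕ 2 * (1# + β))
    nextSlope≤ n = ≤.trans (slope≤ r (ℕ.s≤s ℕ.z≤n))
      (*-monoˡ-≤ e 0≤e (fromℕ-mono-≤ (ℕ.m≤n+o⇒m∸n≤o (suc (block n) ℕ.* m) (suc n)
        (≡.subst (suc (block n) ℕ.* m ℕ.≤_) (ℕ.+-comm m (suc n)) (ℕ.+-monoʳ-≤ m (ℕ.m≤n⇒m≤1+n (block*m≤ n)))))))
      where
      r = suc (block n) ℕ.* m ℕ.∸ suc n

    -- At the end of a block the slope has dropped to 0 and the new block is empty.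
    slope-carry : ∀ {n} (ω : Outcome (suc n)) →
      slope (remaining (suc n)) (suc n) * weight ω (block (suc n)) ≈ nextSlope n * weight ω (block n)
    slope-carry {n} ω with block (suc n) ℕ.≟ block n
    ... | yes eq = reflexive (≡.cong (λ b → slope (suc b ℕ.* m ℕ.∸ suc n) (suc n) * weight ω b) eq)
    ... | no neq = begin-equality
      slope (remaining (suc n)) (suc n) * weight ω (block (suc n))
        ≈⟨ *-congˡ (weight-absent ω _ λ i i<1+n eq → ℕ.<⇒≱ new (≡.subst (ℕ._≤ block n) eq (ℕ./-monoˡ-≤ m (ℕ.≤-pred i<1+n)))) ⟩
      slope (remaining (suc n)) (suc n) * 0#
        ≈⟨ trans (zeroʳ _) (sym (zeroˡ _)) ⟩
      0# * weight ω (block n)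
        ≡⟨ ≡.cong (λ r → slope r (suc n) * weight ω (block n))
             (ℕ.m≤n⇒m∸n≡0 (ℕ.≤-trans (ℕ.*-monoˡ-≤ m new) (block*m≤ (suc n)))) ⟨
      nextSlope n * weight ω (block n) ∎
      where
      new : block n ℕ.< block (suc n)
      new = ℕ.≤∧≢⇒< (ℕ./-monoˡ-≤ m (ℕ.n≤1+n n)) (neq ∘ ≡.sym)

    quadratic-▷ : ∀ {k} (ω : Outcome (suc k)) c → let w = weight ω; τ = targetBlock ω c; cur = block (suc k) in
      quadratic (ω ▷ c) ≈ quadratic ω + (fromℕ 2 * w τ + 1# +
        (1# + β) * (fromℕ 2 * w cur + fromℕ 2 * δ cur τ + (1# + β)))
    quadratic-▷ {k} ω c = begin-equality
      sum (downFrom (suc n)) (λ b → weight (ω ▷ c) b * weight (ω ▷ c) b)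
        ≈⟨ sum-cong (downFrom (suc n)) (λ b → trans (*-cong (weight-step ω c b) (weight-step ω c b))
             (solve 4 (λ w d e β → (w :+ (d :+ (:1 :+ β) :* e)) :* (w :+ (d :+ (:1 :+ β) :* e))
                := w :* w :+ (d :* (:2 :* w :+ d) :+ e :* ((:1 :+ β) :* (:2 :* w :+ :2 :* d :+ (:1 :+ β) :* e))))
                refl (w b) (δ τ b) (δ cur b) β)) ⟩
      sum (downFrom (suc n)) (λ b → w b * w b + (δ τ b * F b + δ cur b * G b))
        ≈⟨ trans (sum-+ (downFrom (suc n))) (+-congˡ (sum-+ (downFrom (suc n)))) ⟩
      w n * w n + quadratic ω + (sum (downFrom (suc n)) (λ b → δ τ b * F b) + sum (downFrom (suc n)) (λ b → δ cur b * G b))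
        ≈⟨ +-cong (trans (+-congʳ (trans (*-congʳ (weight-last ω)) (zeroˡ _))) (+-identityˡ _))
             (+-cong (sum-δ (suc n) F (ℕ.m≤n⇒m≤1+n (targetBlock< ω c))) (sum-δ (suc n) G (ℕ.s≤s (block≤ n)))) ⟩
      quadratic ω + (fromℕ 2 * w τ + δ τ τ + (1# + β) * (fromℕ 2 * w cur + fromℕ 2 * δ τ cur + (1# + β) * δ cur cur))
        ≈⟨ +-congˡ (+-cong (+-congˡ (δ-≡ {τ} ≡.refl)) (*-congˡ (+-cong (+-congˡ (*-congˡ (reflexive (δ-sym τ cur))))
             (trans (*-congˡ (δ-≡ {cur} ≡.refl)) (*-identityʳ _))))) ⟩
      _ ∎
      where
      n = suc k
      w = weight ω
      τ = targetBlock ω c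
      cur = block n
      F G : ℕ → Carrier
      F b = fromℕ 2 * w b + δ τ b
      G b = (1# + β) * (fromℕ 2 * w b + fromℕ 2 * δ τ b + (1# + β) * δ cur b)

    multiplier : ℕ → Carrier
    multiplier n = 1# + fromℕ 2 / normaliser n

    multiplier-nonneg : ∀ {n} → 1 ℕ.≤ n → 0# ≤ multiplier n
    multiplier-nonneg 1≤n = +-nonneg 0≤1 (/-nonneg (fromℕ-nonneg 2) (0<normaliser 1≤n))

    private
      source : ℕ → Carrier
      source n = 1# + (1# + β) * (1# + β) + (1# + β) * nextSlope n

    -- The choice-dependent part of the potential's increment, as a function of the block hit. The
    -- `δ` term is present when the new edge becomes a loop: it collects the cross term with the
    -- deterministic `1 + β` and the contribution through the slope.
    gain : ∀ {n} → Outcome n → ℕ → Carrier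
    gain {n} ω b = fromℕ 2 * weight ω b + (fromℕ 2 * (1# + β) + nextSlope n) * δ (block n) b

    gain-nonneg : ∀ {n} (ω : Outcome n) b → 0# ≤ gain ω b
    gain-nonneg {n} ω b = +-nonneg (*-nonneg (fromℕ-nonneg 2) (weight-nonneg ω b))
      (*-nonneg (+-nonneg 0≤e (nextSlope-nonneg n)) (δ-nonneg (block n) b))

    meanGain : ∀ {n} → Outcome n → Carrier
    meanGain ω = conditional λ c → gain ω (targetBlock ω c)

    noise : ∀ {n} → Outcome n → Choice n → Carrier
    noise ω c = gain ω (targetBlock ω c) - meanGain ω

    module _ {k} (ω : Outcome (suc k)) where

      private
        n = suc k
        1≤n : 1 ℕ.≤ n
        1≤n = ℕ.s≤s ℕ.z≤n
        w = weight ω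
        cur = block n
        g = nextSlope n
        h = e + g
        N = normaliser n

      meanGain≈ : meanGain ω ≈ N ⁻¹ * (fromℕ 2 * quadratic ω + h * w cur)
      meanGain≈ = trans (conditional-targetBlock ω (gain ω)) (*-congˡ (begin-equality
        sum (downFrom n) (λ b → w b * gain ω b)
          ≈⟨ sum-cong (downFrom n) (λ b →
               solve 3 (λ w h d → w :* (:2 :* w :+ h :* d) := :2 :* (w :* w) :+ h :* (d :* w)) refl (w b) h (δ cur b)) ⟩
        sum (downFrom n) (λ b → fromℕ 2 * (w b * w b) + h * (δ cur b * w b))
          ≈⟨ trans (sum-+ (downFrom n)) (+-cong (sum-*ˡ (downFrom n) _) (sum-*ˡ (downFrom n) _)) ⟩
        fromℕ 2 * quadratic ω + h * sum (downFrom n) (λ b → δ cur b * w b)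
          ≈⟨ +-congˡ (*-congˡ current) ⟩
        fromℕ 2 * quadratic ω + h * w cur ∎))
        where
        current : sum (downFrom n) (λ b → δ cur b * w b) ≈ w cur
        current = begin-equality
          sum (downFrom n) (λ b → δ cur b * w b)
            ≈⟨ +-identityˡ _ ⟨
          0# + sum (downFrom n) (λ b → δ cur b * w b)
            ≈⟨ +-congʳ (trans (*-congˡ (weight-last ω)) (zeroʳ _)) ⟨
          sum (downFrom (suc n)) (λ b → δ cur b * w b)
            ≈⟨ sum-δ (suc n) w (ℕ.s≤s (block≤ n)) ⟩
          w cur ∎

      potential-▷ : ∀ c → potential (ω ▷ c) ≈ multiplier n * potential ω + source n + noise ω c
      potential-▷ c = begin-equality
        quadratic (ω ▷ c) + slope (remaining (suc n)) (suc n) * weight (ω ▷ c) (block (suc n))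
          ≈⟨ +-cong (quadratic-▷ ω c) (trans (slope-carry (ω ▷ c)) (*-congˡ (trans (weight-step ω c cur)
               (+-congˡ (+-cong (reflexive (δ-sym τ cur)) (*-congˡ (δ-≡ {cur} ≡.refl))))))) ⟩
        quadratic ω + (fromℕ 2 * w τ + 1# + (1# + β) * (fromℕ 2 * w cur + fromℕ 2 * δ cur τ + (1# + β)))
          + g * (w cur + (δ cur τ + (1# + β) * 1#))
          ≈⟨ solve 7 (λ Q wτ β wc d g μ →
               Q :+ (:2 :* wτ :+ :1 :+ (:1 :+ β) :* (:2 :* wc :+ :2 :* d :+ (:1 :+ β))) :+ g :* (wc :+ (d :+ (:1 :+ β) :* :1))
               := (Q :+ (:2 :* (:1 :+ β) :+ g) :* wc :+ μ) :+ (:1 :+ (:1 :+ β) :* (:1 :+ β) :+ (:1 :+ β) :* g)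
                  :+ (:2 :* wτ :+ (:2 :* (:1 :+ β) :+ g) :* d :- μ))
               refl (quadratic ω) (w τ) β (w cur) (δ cur τ) g (meanGain ω) ⟩
        (quadratic ω + h * w cur + meanGain ω) + source n + noise ω c
          ≈⟨ +-congʳ (+-congʳ (+-congˡ meanGain≈)) ⟩
        (quadratic ω + h * w cur + N ⁻¹ * (fromℕ 2 * quadratic ω + h * w cur)) + source n + noise ω c
          ≈⟨ +-congʳ (+-congʳ compensated) ⟩
        multiplier n * potential ω + source n + noise ω c ∎
        where
        τ = targetBlock ω c
        N⁻¹ = N ⁻¹
        M = N + fromℕ 2
        -- The coefficient of `h * w cur` is `1 + 1/N` on the left. On the right it is
        -- `(1 + 2/N) (N + 1)/(N + 2)`, which is the same number.
        compensated : quadratic ω + h * w cur + N⁻¹ * (fromℕ 2 * quadratic ω + h * w cur) ≈ multiplier n * potential ω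
        compensated = sym (begin-equality
          (1# + fromℕ 2 * N⁻¹) * (quadratic ω + slope (remaining n) n * w cur)
            ≈⟨ *-congˡ (+-congˡ (*-congʳ (reflexive (slope-remaining n)))) ⟩
          (1# + fromℕ 2 * N⁻¹) * (quadratic ω + (N + 1#) * M ⁻¹ * h * w cur)
            ≈⟨ *-congʳ (+-congʳ NN⁻¹) ⟨
          (N * N⁻¹ + fromℕ 2 * N⁻¹) * (quadratic ω + (N + 1#) * M ⁻¹ * h * w cur)
            ≈⟨ solve 6 (λ N i j Q h w → (N :* i :+ :2 :* i) :* (Q :+ (N :+ :1) :* j :* h :* w)
                 := (N :* i :+ :2 :* i) :* Q :+ ((N :+ :2) :* j) :* (N :* i :+ i) :* (h :* w))
                 refl N N⁻¹ (M ⁻¹) (quadratic ω) h (w cur) ⟩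
          (N * N⁻¹ + fromℕ 2 * N⁻¹) * quadratic ω + (M * M ⁻¹) * (N * N⁻¹ + N⁻¹) * (h * w cur)
            ≈⟨ +-cong (*-congʳ (+-congʳ NN⁻¹)) (*-congʳ (*-cong (x*x⁻¹≈1 (0<normaliser+2 1≤n)) (+-congʳ NN⁻¹))) ⟩
          (1# + fromℕ 2 * N⁻¹) * quadratic ω + 1# * (1# + N⁻¹) * (h * w cur)
            ≈⟨ solve 3 (λ i Q x → (:1 :+ :2 :* i) :* Q :+ :1 :* (:1 :+ i) :* x := Q :+ x :+ i :* (:2 :* Q :+ x))
                 refl N⁻¹ (quadratic ω) (h * w cur) ⟩
          quadratic ω + h * w cur + N⁻¹ * (fromℕ 2 * quadratic ω + h * w cur) ∎)
          where
          NN⁻¹ : N * N⁻¹ ≈ 1#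
          NN⁻¹ = x*x⁻¹≈1 (0<normaliser 1≤n)

      conditional-noise : conditional (noise ω) ≈ 0#
      conditional-noise = trans (conditional-+ {n}) (trans (+-congˡ (conditional-const ω _)) (-‿inverseʳ _))

    𝔼-potential-step : ∀ k → 𝔼 {suc (suc k)} potential ≈ multiplier (suc k) * 𝔼 {suc k} potential + source (suc k)
    𝔼-potential-step k = begin-equality
      𝔼 {suc n} potential
        ≈⟨ 𝔼-step {k} potential ⟩
      𝔼 {n} (λ ω → conditional λ c → potential (ω ▷ c))
        ≈⟨ 𝔼-cong {n} (λ ω → begin-equality
             conditional (λ c → potential (ω ▷ c))
               ≈⟨ conditional-cong {n} (potential-▷ ω) ⟩
             conditional (λ c → (multiplier n * potential ω + source n) + noise ω c)
               ≈⟨ trans (conditional-+ {n}) (+-cong (conditional-const ω _) (conditional-noise ω)) ⟩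
             (multiplier n * potential ω + source n) + 0#
               ≈⟨ +-identityʳ _ ⟩
             multiplier n * potential ω + source n ∎) ⟩
      𝔼 {n} (λ ω → multiplier n * potential ω + source n)
        ≈⟨ trans (𝔼-+ {n}) (+-cong (𝔼-*ˡ {n} (multiplier n)) (𝔼-const {n} (ℕ.s≤s ℕ.z≤n) _)) ⟩
      multiplier n * 𝔼 {n} potential + source n ∎
      where
      n = suc k

    deviation : ∀ {n} → Outcome n → Carrier
    deviation {n} ω = potential ω - 𝔼 {n} potential

    -- The potential and its mean follow the same affine recursion, so the deterministic source
    -- cancels and only the noise remains.
    deviation-▷ : ∀ {k} (ω : Outcome (suc k)) c →
      deviation (ω ▷ c) ≈ multiplier (suc k) * deviation ω + noise ω c
    deviation-▷ {k} ω c = trans (+-cong (potential-▷ ω c) (-‿cong (𝔼-potential-step k)))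
      (solve 5 (λ μ p s x e → μ :* p :+ s :+ x :- (μ :* e :+ s) := μ :* (p :- e) :+ x)
        refl (multiplier (suc k)) (potential ω) (source (suc k)) (noise ω c) (𝔼 {suc k} potential))

  -- Moment recursions

  [x+y]^≤ : ∀ j {x y} → 0# ≤ x → 0# ≤ y → (x + y) ^ j ≤ (fromℕ 2 * x) ^ j + (fromℕ 2 * y) ^ j
  [x+y]^≤ j {x} {y} 0≤x 0≤y with ≤.total x y
  ... | inj₁ x≤y = begin
    (x + y) ^ j          ≤⟨ ^-monoˡ-≤ j (+-nonneg 0≤x 0≤y) (≤-by (0≤y-x x≤y) (solve 2 (λ x y → :2 :* y := x :+ y :+ (y :- x)) refl x y)) ⟩
    (fromℕ 2 * y) ^ j    ≤⟨ ≤-by (^-nonneg j (*-nonneg (fromℕ-nonneg 2) 0≤x)) (+-comm _ _) ⟩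
    _                    ∎
  ... | inj₂ y≤x = begin
    (x + y) ^ j          ≤⟨ ^-monoˡ-≤ j (+-nonneg 0≤x 0≤y) (≤-by (0≤y-x y≤x) (solve 2 (λ x y → :2 :* x := x :+ y :+ (x :- y)) refl x y)) ⟩
    (fromℕ 2 * x) ^ j    ≤⟨ ≤-by (^-nonneg j (*-nonneg (fromℕ-nonneg 2) 0≤y)) refl ⟩
    _                    ∎

  difference-square : ∀ {x y B} → 0# ≤ x → x ≤ B → 0# ≤ y → y ≤ B → (x - y) * (x - y) ≤ B * B
  difference-square {x} {y} {B} 0≤x x≤B 0≤y y≤B = ≤-by
    (*-nonneg (+-nonneg (0≤y-x x≤B) 0≤y) (+-nonneg (0≤y-x y≤B) 0≤x))
    (solve 3 (λ x y B → B :* B := (x :- y) :* (x :- y) :+ (B :- x :+ y) :* (B :- y :+ x)) refl x y B)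

  module DeviationMoments (β : Carrier) (0<β : 0# < β) (m-1 : ℕ) where

    open Deviation β 0<β m-1 public

    module _ (i : ℕ) where

      private
        j = suc i
        H = fromℕ 2 * (1# + β) + fromℕ m * (fromℕ 2 * (1# + β))

        16ʲ Hʲ : Carrier
        16ʲ    = fromℕ 16 ^ j
        Hʲ = (fromℕ 2 * (fromℕ 2 * (H * H))) ^ j

        0≤16ʲ : 0# ≤ 16ʲ
        0≤16ʲ = ^-nonneg j (fromℕ-nonneg 16)

        0≤Hʲ : 0# ≤ Hʲ
        0≤Hʲ = ^-nonneg j (*-nonneg (fromℕ-nonneg 2) (*-nonneg (fromℕ-nonneg 2) (square-nonneg H)))

      noiseConst : Carrier
      noiseConst = fromℕ 16 ^ suc i + (fromℕ 2 * (fromℕ 2 * (H * H))) ^ suc i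

      noiseConst-nonneg : 0# ≤ noiseConst
      noiseConst-nonneg = +-nonneg 0≤16ʲ 0≤Hʲ

      -- The gain and its mean both lie between 0 and `2 M + H`, with `M` the largest weight, so the
      -- square of the noise is at most `8 M² + 2 H²`. Separating the two terms under the power
      -- doubles each, hence 16. The power of `M` is then bounded by a single term of the moment.
      noise-moment : ∀ {n} (ω : Outcome n) c →
        (noise ω c * noise ω c) ^ suc i ≤ noiseConst * (moment (suc i ℕ.+ suc i) ω + 1#)
      noise-moment {n} ω c with maximum (i ℕ.+ suc i) n (weight-nonneg ω)
      ... | M , 0≤M , weight≤M , rising≤ = begin
        (noise ω c * noise ω c) ^ j
          ≤⟨ ^-monoˡ-≤ j (square-nonneg _) (≤.trans
               (difference-square (gain-nonneg ω _) (gain≤ c) 0≤meanGain meanGain≤)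
               (≤-by (square-nonneg (fromℕ 2 * M - H))
                 (solve 2 (λ M H → :2 :* (:2 :* :2 :* (M :* M)) :+ :2 :* (H :* H)
                   := (:2 :* M :+ H) :* (:2 :* M :+ H) :+ (:2 :* M :- H) :* (:2 :* M :- H)) refl M H))) ⟩
        (fromℕ 2 * (fromℕ 2 * fromℕ 2 * (M * M)) + fromℕ 2 * (H * H)) ^ j
          ≤⟨ [x+y]^≤ j (*-nonneg (fromℕ-nonneg 2) (*-nonneg (*-nonneg (fromℕ-nonneg 2) (fromℕ-nonneg 2)) (square-nonneg M)))
                       (*-nonneg (fromℕ-nonneg 2) (square-nonneg H)) ⟩
        (fromℕ 2 * (fromℕ 2 * (fromℕ 2 * fromℕ 2 * (M * M)))) ^ j + Hʲ
          ≈⟨ +-congʳ (trans (^-congˡ j (solve 1 (λ x → :2 :* (:2 :* (:2 :* :2 :* x)) := :16 :* x) refl (M * M)))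
               (^-distrib-* (fromℕ 16) (M * M) j)) ⟩
        16ʲ * (M * M) ^ j + Hʲ
          ≈⟨ +-congʳ (*-congˡ (trans (^-distrib-* M M j) (sym (^-homo-* M j j)))) ⟩
        16ʲ * M ^ (j ℕ.+ j) + Hʲ
          ≤⟨ +-monoˡ-≤ _ (*-monoʳ-≤ 16ʲ 0≤16ʲ (≤.trans (^≤rising (j ℕ.+ j) 0≤M) rising≤)) ⟩
        16ʲ * moment (j ℕ.+ j) ω + Hʲ
          ≤⟨ ≤-by (+-nonneg 0≤16ʲ (*-nonneg 0≤Hʲ (moment-nonneg (j ℕ.+ j) ω)))
               (solve 3 (λ x y s → (x :+ y) :* (s :+ :1) := x :* s :+ y :+ (x :+ y :* s)) refl 16ʲ Hʲ (moment (j ℕ.+ j) ω)) ⟩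
        noiseConst * (moment (j ℕ.+ j) ω + 1#) ∎
        where
        :16 : ∀ {n} → Solver.Polynomial n
        :16 = :1+ (:1+ (:1+ (:1+ (:1+ (:1+ (:1+ (:1+ (:1+ (:1+ (:1+ (:1+ (:1+ (:1+ :2)))))))))))))
          where
          :1+ : ∀ {n} → Solver.Polynomial n → Solver.Polynomial n
          :1+ p = :1 :+ p
        1≤n = 1≤size ω
        gain≤ : ∀ c → gain ω (targetBlock ω c) ≤ fromℕ 2 * M + H
        gain≤ c = +-mono-≤ (*-monoʳ-≤ _ (fromℕ-nonneg 2) (weight≤M _ (targetBlock< ω c)))
          (≤.trans (*-mono-≤ 0≤h 0≤1 ≤.refl (δ≤1 (block n) _))
            (≤.trans (≤.reflexive (*-identityʳ _)) (+-monoʳ-≤ _ (nextSlope≤ n))))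
          where
          0≤h = +-nonneg (*-nonneg (fromℕ-nonneg 2) 0≤1+β) (nextSlope-nonneg n)
        0≤meanGain : 0# ≤ meanGain ω
        0≤meanGain = ≤.trans (≤.reflexive (sym (conditional-const ω 0#)))
          (conditional-mono 1≤n λ c → gain-nonneg ω (targetBlock ω c))
        meanGain≤ : meanGain ω ≤ fromℕ 2 * M + H
        meanGain≤ = ≤.trans (conditional-mono 1≤n gain≤) (≤.reflexive (conditional-const ω _))

      deviationMoment : ℕ → Carrier
      deviationMoment n = 𝔼 {n} λ ω → (deviation ω * deviation ω) ^ suc i

      weightMoment : ℕ → Carrier
      weightMoment n = 𝔼 {n} λ ω → moment (suc i ℕ.+ suc i) ω

      private
        C = proj₁ (even-power-step i)
        0≤C = proj₁ (proj₂ (even-power-step i))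
        expand = proj₂ (proj₂ (even-power-step i))

      -- The expansion is taken around `multiplier n * deviation ω` with `s = n`. Its linear term
      -- disappears by `conditional-noise`, and the remainder is controlled by the moments of the
      -- weights.
      deviationMoment-suc : ∀ n → 1 ℕ.≤ n → deviationMoment (suc n) ≤
        growth n * (multiplier n ^ suc i * multiplier n ^ suc i) * deviationMoment n
          + C * fromℕ n ^ i * (noiseConst * (weightMoment n + 1#))
      deviationMoment-suc n@(suc k) 1≤n = begin
        deviationMoment (suc n)
          ≈⟨ 𝔼-step {k} _ ⟩
        𝔼 {n} (λ ω → conditional λ c → (deviation (ω ▷ c) * deviation (ω ▷ c)) ^ j)
          ≤⟨ 𝔼-mono {n} step ⟩
        𝔼 {n} (λ ω → growth n * (μ ^ j * μ ^ j) * (deviation ω * deviation ω) ^ j + Y * (noiseConst * (moment (j ℕ.+ j) ω + 1#)))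
          ≈⟨ trans (𝔼-+ {n}) (+-cong (𝔼-*ˡ {n} _) (trans (𝔼-*ˡ {n} Y) (*-congˡ (trans (𝔼-*ˡ {n} noiseConst)
               (*-congˡ (trans (𝔼-+ {n}) (+-congˡ (𝔼-const {n} 1≤n 1#)))))))) ⟩
        growth n * (μ ^ j * μ ^ j) * deviationMoment n + Y * (noiseConst * (weightMoment n + 1#)) ∎
        where
        μ = multiplier n
        Y = C * fromℕ n ^ i
        0≤Y : 0# ≤ Y
        0≤Y = *-nonneg 0≤C (^-nonneg i (fromℕ-nonneg n))
        step : ∀ ω → conditional (λ c → (deviation (ω ▷ c) * deviation (ω ▷ c)) ^ j) ≤
          growth n * (μ ^ j * μ ^ j) * (deviation ω * deviation ω) ^ j + Y * (noiseConst * (moment (j ℕ.+ j) ω + 1#))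
        step ω = begin
          conditional (λ c → (deviation (ω ▷ c) * deviation (ω ▷ c)) ^ j)
            ≈⟨ conditional-cong {n} (λ c → ^-congˡ j (*-cong (deviation-▷ ω c) (deviation-▷ ω c))) ⟩
          conditional (λ c → ((a + ξ c) * (a + ξ c)) ^ j)
            ≤⟨ conditional-mono 1≤n (λ c → ≤.trans (expand a (ξ c) (1≤fromℕ {n} 1≤n))
                 (+-monoʳ-≤ _ (*-monoʳ-≤ Y 0≤Y (noise-moment ω c)))) ⟩
          conditional (λ c → X + L * ξ c + Z)
            ≈⟨ trans (conditional-+ {n}) (+-cong (trans (conditional-+ {n}) (+-cong (conditional-const ω X)
                 (trans (conditional-*ˡ {n} L) (*-congˡ (conditional-noise ω))))) (conditional-const ω Z)) ⟩
          X + L * 0# + Z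
            ≈⟨ +-congʳ (trans (+-congˡ (zeroʳ L)) (+-identityʳ X)) ⟩
          X + Z
            ≈⟨ +-congʳ (*-congˡ (begin-equality
                 (a * a) ^ j
                   ≈⟨ ^-congˡ j (solve 2 (λ x d → x :* d :* (x :* d) := x :* x :* (d :* d)) refl μ (deviation ω)) ⟩
                 (μ * μ * (deviation ω * deviation ω)) ^ j
                   ≈⟨ trans (^-distrib-* (μ * μ) _ j) (*-congʳ (^-distrib-* μ μ j)) ⟩
                 μ ^ j * μ ^ j * (deviation ω * deviation ω) ^ j ∎)) ⟩
          growth n * (μ ^ j * μ ^ j * (deviation ω * deviation ω) ^ j) + Z
            ≈⟨ +-congʳ (*-assoc _ _ _) ⟨
          _ ∎
          where
          a = μ * deviation ω
          ξ = noise ω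
          X = growth n * (a * a) ^ j
          L = linearCoeff i * (a * (a * a) ^ i)
          Z = Y * (noiseConst * (moment (j ℕ.+ j) ω + 1#))

      weightMoment-nonneg : ∀ n → 0# ≤ weightMoment n
      weightMoment-nonneg n = 𝔼-nonneg {n} λ ω → moment-nonneg (j ℕ.+ j) ω

      deviationMoment-nonneg : ∀ n → 0# ≤ deviationMoment n
      deviationMoment-nonneg n = 𝔼-nonneg {n} λ ω → ^-nonneg j (square-nonneg (deviation ω))

      weightMoment-suc : ∀ n → 1 ℕ.≤ n → weightMoment (suc n) ≤
        (1# + fromℕ (suc i ℕ.+ suc i) * normaliser n ⁻¹) * weightMoment n + rising (suc i ℕ.+ suc i) blockBound
      weightMoment-suc n@(suc k) 1≤n = begin
        weightMoment (suc n)
          ≈⟨ 𝔼-step {k} _ ⟩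
        𝔼 {n} (λ ω → conditional λ c → moment (j ℕ.+ j) (ω ▷ c))
          ≤⟨ 𝔼-mono {n} (conditional-moment (i ℕ.+ j)) ⟩
        𝔼 {n} (λ ω → (1# + fromℕ (j ℕ.+ j) * normaliser n ⁻¹) * moment (j ℕ.+ j) ω + rising (j ℕ.+ j) blockBound)
          ≈⟨ trans (𝔼-+ {n}) (+-cong (𝔼-*ˡ {n} _) (𝔼-const {n} 1≤n _)) ⟩
        _ ∎

  /-mono-cross : ∀ {x y a b} → 0# < a → 0# < b → x * b ≤ y * a → x / a ≤ y / b
  /-mono-cross {x} {y} {a} {b} 0<a 0<b h = *-cancelˡ-≤ (a * b) (*-pos 0<a 0<b) (begin
    a * b * (x / a)      ≈⟨ solve 3 (λ a b z → a :* b :* z := a :* z :* b) refl a b (x / a) ⟩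
    a * (x / a) * b      ≈⟨ *-congʳ (/-cancel x 0<a) ⟩
    x * b                ≤⟨ h ⟩
    y * a                ≈⟨ *-congʳ (/-cancel y 0<b) ⟨
    b * (y / b) * a      ≈⟨ solve 3 (λ a b z → b :* z :* a := a :* b :* z) refl a b (y / b) ⟩
    a * b * (y / b)      ∎)

  -- Solving the moment recursions, with `p` a little above `2j / (2 + β)`.

  module PolynomialBounds (β : Carrier) (0<β : 0# < β) (m-1 p r : ℕ)
    (slack : fromℕ (suc (suc (p ℕ.+ r) ℕ.+ suc (p ℕ.+ r))) ≤ fromℕ p * (fromℕ 2 + β)) where

    open DeviationMoments β 0<β m-1 public

    private
      i = p ℕ.+ r
      j = suc i
      q = j ℕ.+ j

    -- `slack` exceeds `2j` by 1, which yields one spare multiple of `t`. From this time on it pays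
    -- for the `- 2` in the normaliser, multiplied by `p`, and for the product `2j * p` needed in
    -- `multiplier-factor`.
    threshold : ℕ
    threshold = suc (q ℕ.* p ℕ.+ (p ℕ.+ p))

    module _ {t} (t₀≤t : threshold ℕ.≤ t) where

      private
        1≤t : 1 ℕ.≤ t
        1≤t = ℕ.≤-trans (ℕ.s≤s ℕ.z≤n) t₀≤t
        N = normaliser t
        T = fromℕ t
        P = fromℕ p
        0<N : 0# < N
        0<N = 0<normaliser 1≤t
        0<T : 0# < T
        0<T = 0<fromℕ {t} 1≤t
        0≤T = <⇒≤ 0<T

        large : fromℕ q * P + (P + P) ≤ T
        large = begin
          fromℕ q * P + (P + P)                   ≈⟨ +-cong (fromℕ-* q p) (fromℕ-+ p p) ⟨
          fromℕ (q ℕ.* p) + fromℕ (p ℕ.+ p)       ≈⟨ fromℕ-+ (q ℕ.* p) (p ℕ.+ p) ⟨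
          fromℕ (q ℕ.* p ℕ.+ (p ℕ.+ p))           ≤⟨ fromℕ-mono-≤ (ℕ.≤-trans (ℕ.n≤1+n _) t₀≤t) ⟩
          T                                       ∎

        PN≥ : fromℕ q * T + fromℕ q * P ≤ P * N
        PN≥ = begin
          fromℕ q * T + fromℕ q * P
            ≤⟨ ≤-by (0≤y-x large) (solve 3 (λ q P T → (:1 :+ q) :* T :- (P :+ P) := q :* T :+ q :* P :+ (T :- (q :* P :+ (P :+ P))))
                                    refl (fromℕ q) P T) ⟩
          fromℕ (suc q) * T - (P + P)
            ≤⟨ +-monoˡ-≤ _ (*-monoˡ-≤ T 0≤T slack) ⟩
          P * (fromℕ 2 + β) * T - (P + P)
            ≈⟨ solve 3 (λ P β T → P :* (:2 :+ β) :* T :- (P :+ P) := P :* ((:2 :+ β) :* T :- :2)) refl P β T ⟩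
          P * N ∎

      weight-factor : 1# + fromℕ (j ℕ.+ j) * normaliser t ⁻¹ ≤ growth t ^ p
      weight-factor = ≤.trans (+-monoʳ-≤ 1# (/-mono-cross 0<N 0<T (≤.trans
          (≤-by (*-nonneg (fromℕ-nonneg q) (fromℕ-nonneg p)) refl) PN≥)))
        (bernoulli p (⁻¹-nonneg 0<T))

      -- With `y = 2 / N` the condition of `growth-power` is `N t ≤ (N - 2j) (t + p)`, a
      -- rearrangement of `PN≥`.
      multiplier-factor : multiplier t ^ j ≤ growth t ^ p
      multiplier-factor = growth-power j p 1≤t (/-nonneg (fromℕ-nonneg 2) 0<N)
        (*-cancelˡ-≤ (N * T) (*-pos 0<N 0<T) (begin
          N * T * 1#
            ≤⟨ ≤-by (0≤y-x PN≥) (solve 4 (λ N T P q → (N :- q) :* (T :+ P) := N :* T :* :1 :+ (P :* N :- (q :* T :+ q :* P)))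
                 refl N T P (fromℕ q)) ⟩
          (N - fromℕ q) * (T + P)
            ≈⟨ *-cong (+-congˡ (-‿cong (trans (fromℕ-+ j j) (trans (solve 1 (λ x → x :+ x := x :* :2) refl (fromℕ j))
                 (*-congˡ (sym (/-cancel (fromℕ 2) 0<N))))))) (+-congˡ (sym (/-cancel P 0<T))) ⟩
          (N - fromℕ j * (N * (fromℕ 2 / N))) * (T + T * (P / T))
            ≈⟨ solve 5 (λ N T y z j → (N :- j :* (N :* y)) :* (T :+ T :* z) := N :* T :* ((:1 :- j :* y) :* (:1 :+ z)))
                 refl N T (fromℕ 2 / N) (P / T) (fromℕ j) ⟩
          N * T * ((1# - fromℕ j * (fromℕ 2 / N)) * (1# + P / T)) ∎))

    1≤threshold : 1 ℕ.≤ threshold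
    1≤threshold = ℕ.s≤s ℕ.z≤n

    private
      ρ : Carrier
      ρ = rising (j ℕ.+ j) blockBound

      0≤ρ : 0# ≤ ρ
      0≤ρ = rising-nonneg (j ℕ.+ j) (*-nonneg (+-nonneg (fromℕ-nonneg 2) 0≤β) (fromℕ-nonneg m))

      weightConst : Carrier
      weightConst = weightMoment i threshold + ρ

      0≤weightConst : 0# ≤ weightConst
      0≤weightConst = +-nonneg (weightMoment-nonneg i threshold) 0≤ρ

      C = proj₁ (even-power-step i)
      0≤C = proj₁ (proj₂ (even-power-step i))

      sourceConst : Carrier
      sourceConst = C * (noiseConst i * (weightConst + 1#))

      0≤sourceConst : 0# ≤ sourceConst
      0≤sourceConst = *-nonneg 0≤C (*-nonneg (noiseConst-nonneg i) (+-nonneg 0≤weightConst 0≤1))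

    weightMoment≤ : ∀ t → threshold ℕ.≤ t → weightMoment i t ≤ weightConst * fromℕ t ^ suc (p ℕ.+ 0)
    weightMoment≤ = polynomial-growth (weightMoment i) threshold p 0 1≤threshold 0≤ρ (weightMoment-nonneg i threshold)
      λ t t₀≤t → let 1≤t = ℕ.≤-trans 1≤threshold t₀≤t in begin
        weightMoment i (suc t)
          ≤⟨ weightMoment-suc i t 1≤t ⟩
        (1# + fromℕ (j ℕ.+ j) * normaliser t ⁻¹) * weightMoment i t + ρ
          ≤⟨ +-mono-≤ (*-monoˡ-≤ _ (weightMoment-nonneg i t) (weight-factor t₀≤t))
               (≤.trans (≤.reflexive (sym (*-identityʳ ρ))) (*-monoʳ-≤ ρ 0≤ρ (1≤^ (p ℕ.+ 0) (1≤fromℕ {t} 1≤t)))) ⟩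
        growth t ^ p * weightMoment i t + ρ * fromℕ t ^ (p ℕ.+ 0) ∎

    -- The homogeneous rate is `2p + 1`: `2p` from the multipliers and 1 from Young's inequality.
    -- The source has exponent `i + (p + 1) = (2p + 1) + r`, never smaller, so it decides the final
    -- exponent, which equals `j + p + 1`.
    deviationMoment≤ : ∀ t → threshold ℕ.≤ t →
      deviationMoment i t ≤ (deviationMoment i threshold + sourceConst) * fromℕ t ^ suc (suc (p ℕ.+ p) ℕ.+ r)
    deviationMoment≤ = polynomial-growth (deviationMoment i) threshold (suc (p ℕ.+ p)) r 1≤threshold 0≤sourceConst
      (deviationMoment-nonneg i threshold) λ t t₀≤t →
      let 1≤t = ℕ.≤-trans 1≤threshold t₀≤t
          T = fromℕ t
          g = growth t
          μʲ = multiplier t ^ j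
          0≤μʲ = ^-nonneg j (multiplier-nonneg 1≤t)
          0≤gᵖ = ^-nonneg p (growth-nonneg 1≤t)
      in begin
        deviationMoment i (suc t)
          ≤⟨ deviationMoment-suc i t 1≤t ⟩
        g * (μʲ * μʲ) * deviationMoment i t + C * T ^ i * (noiseConst i * (weightMoment i t + 1#))
          ≤⟨ +-mono-≤
               (*-monoˡ-≤ _ (deviationMoment-nonneg i t) (*-monoʳ-≤ g (growth-nonneg 1≤t)
                 (*-mono-≤ 0≤μʲ 0≤gᵖ (multiplier-factor t₀≤t) (multiplier-factor t₀≤t))))
               (*-monoʳ-≤ _ (*-nonneg 0≤C (^-nonneg i (fromℕ-nonneg t))) (*-monoʳ-≤ _ (noiseConst-nonneg i)
                 (+-mono-≤ (weightMoment≤ t t₀≤t) (1≤^ (suc (p ℕ.+ 0)) (1≤fromℕ {t} 1≤t))))) ⟩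
        g * (g ^ p * g ^ p) * deviationMoment i t +
          C * T ^ i * (noiseConst i * (weightConst * T ^ suc (p ℕ.+ 0) + T ^ suc (p ℕ.+ 0)))
          ≈⟨ +-cong (*-congʳ (*-congˡ (sym (^-homo-* g p p))))
               (trans (solve 5 (λ C x n w y → C :* x :* (n :* (w :* y :+ y)) := C :* (n :* (w :+ :1)) :* (x :* y))
                 refl C (T ^ i) (noiseConst i) weightConst (T ^ suc (p ℕ.+ 0)))
                 (*-congˡ (trans (sym (^-homo-* T i (suc (p ℕ.+ 0)))) (^-congʳ T (exponent p r))))) ⟩
        g ^ suc (p ℕ.+ p) * deviationMoment i t + sourceConst * T ^ (suc (p ℕ.+ p) ℕ.+ r) ∎
      where
      exponent : ∀ p r → (p ℕ.+ r) ℕ.+ suc (p ℕ.+ 0) ≡ suc (p ℕ.+ p) ℕ.+ r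
      exponent = ℕSolver.solve-∀

  -- The degrees of the multigraph

  fromℕ-sum : ∀ {A : Set} (f : A → ℕ) xs → fromℕ (ℕList.sum (map f xs)) ≈ sum xs (fromℕ ∘ f)
  fromℕ-sum f []       = refl
  fromℕ-sum f (x ∷ xs) = trans (fromℕ-+ (f x) _) (+-congˡ (fromℕ-sum f xs))

  fromℕ-count : ∀ {n} (v : Fin n) xs → fromℕ (length (filter (Fin._≟ v) xs)) ≈ sum xs (λ u → δ (toℕ u) (toℕ v))
  fromℕ-count v []       = refl
  fromℕ-count v (u ∷ xs) with u Fin.≟ v
  ... | yes ≡.refl = +-cong (sym (δ-≡ {toℕ u} ≡.refl)) (fromℕ-count v xs)
  ... | no  u≢v    = trans (fromℕ-count v xs) (trans (sym (+-identityˡ _)) (+-congʳ (sym (δ-≢ (u≢v ∘ Fin.toℕ-injective)))))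

  sum-halfEdges : ∀ {n} (G : Multigraph n) f → sum (halfEdges G) f ≈ sum G (λ (u , v) → f u) + sum G (λ (u , v) → f v)
  sum-halfEdges []            f = sym (+-identityʳ 0#)
  sum-halfEdges ((u , v) ∷ G) f = trans (+-congˡ (+-congˡ (sum-halfEdges G f)))
    (solve 4 (λ a b c d → a :+ (b :+ (c :+ d)) := a :+ c :+ (b :+ d)) refl (f u) (f v) _ _)

  2*[nC2]+n≡n*n : ∀ n → n choose 2 ℕ.+ n choose 2 ℕ.+ n ≡ n ℕ.* n
  2*[nC2]+n≡n*n zero    = ≡.refl
  2*[nC2]+n≡n*n (suc n) = ≡.trans
    (≡.cong (λ x → x ℕ.+ x ℕ.+ suc n) (≡.trans (≡.sym (nCk+nC[k+1]≡[n+1]C[k+1] n 1)) (≡.cong (ℕ._+ n choose 2) (nC1≡n n))))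
    (≡.trans (regroup n (n choose 2)) (≡.trans (≡.cong (λ x → x ℕ.+ n ℕ.+ suc n) (2*[nC2]+n≡n*n n)) (square n)))
    where
    regroup : ∀ n c → (n ℕ.+ c) ℕ.+ (n ℕ.+ c) ℕ.+ suc n ≡ (c ℕ.+ c ℕ.+ n) ℕ.+ n ℕ.+ suc n
    regroup = ℕSolver.solve-∀
    square : ∀ n → n ℕ.* n ℕ.+ n ℕ.+ suc n ≡ suc n ℕ.* suc n
    square = ℕSolver.solve-∀

  sum-downFrom-extend : ∀ d n (f : ℕ → Carrier) → (∀ b → n ℕ.≤ b → f b ≈ 0#) → sum (downFrom (d ℕ.+ n)) f ≈ sum (downFrom n) f
  sum-downFrom-extend zero    n f h = refl
  sum-downFrom-extend (suc d) n f h = trans (+-congʳ (h _ (ℕ.m≤n+m n d)))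
    (trans (+-identityˡ _) (sum-downFrom-extend d n f h))

  sum-const : ∀ n x → sum (allFin n) (λ _ → x) ≈ fromℕ n * x
  sum-const n x = trans (sum-toℕ n (λ _ → x)) (go n)
    where
    go : ∀ n → sum (downFrom n) (λ _ → x) ≈ fromℕ n * x
    go zero    = sym (zeroˡ x)
    go (suc n) = trans (+-congˡ (go n)) (solve 2 (λ n x → x :+ n :* x := (:1 :+ n) :* x) refl (fromℕ n) x)

  module Degrees (β : Carrier) (0<β : 0# < β) (m-1 : ℕ) where

    open DeviationMoments β 0<β m-1 public

    block-≡ : ∀ {n i} → n ℕ.* m ℕ.≤ i → i ℕ.< suc n ℕ.* m → block i ≡ n
    block-≡ {n} {i} nm≤i i<[1+n]m = ℕ.≤-antisym (ℕ.≤-pred (ℕ.m<n*o⇒m/o<n i<[1+n]m))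
      (≡.subst (ℕ._≤ block i) (ℕ.m*n/n≡m n m) (ℕ./-monoˡ-≤ m nm≤i))

    toℕ-quotient : ∀ {n} (i : Fin (n ℕ.* m)) → toℕ (quotient {n} m i) ≡ block (toℕ i)
    toℕ-quotient {n} i = ≡.sym (block-≡
      (≡.subst (toℕ a ℕ.* m ℕ.≤_) (≡.sym toℕ-i) (ℕ.m≤m+n _ (toℕ b)))
      (≡.subst (ℕ._< suc (toℕ a) ℕ.* m) (≡.sym toℕ-i)
        (≡.subst (toℕ a ℕ.* m ℕ.+ toℕ b ℕ.<_) (ℕ.+-comm (toℕ a ℕ.* m) m) (ℕ.+-monoʳ-< (toℕ a ℕ.* m) (Fin.toℕ<n b)))))
      where
      a : Fin n
      a = proj₁ (remQuot {n} m i)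
      b : Fin m
      b = proj₂ (remQuot {n} m i)
      toℕ-i : toℕ i ≡ toℕ a ℕ.* m ℕ.+ toℕ b
      toℕ-i = ≡.trans (≡.cong toℕ (≡.sym (Fin.combine-remQuot {n} m i)))
        (≡.trans (Fin.toℕ-combine a b) (≡.cong (ℕ._+ toℕ b) (ℕ.*-comm m (toℕ a))))

    sum-block : ∀ n F → sum (downFrom (n ℕ.* m)) (F ∘ block) ≈ fromℕ m * sum (downFrom n) F
    sum-block zero    F = sym (zeroʳ _)
    sum-block (suc n) F = trans (partial m ℕ.≤-refl) (sym (distribˡ _ _ _))
      where
      partial : ∀ r → r ℕ.≤ m → sum (downFrom (r ℕ.+ n ℕ.* m)) (F ∘ block) ≈ fromℕ r * F n + fromℕ m * sum (downFrom n) F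
      partial zero    _   = trans (sum-block n F) (trans (sym (+-identityˡ _)) (+-congʳ (sym (zeroˡ _))))
      partial (suc r) r<m = trans
        (+-cong (reflexive (≡.cong F (block-≡ (ℕ.m≤n+m (n ℕ.* m) r) (ℕ.+-monoˡ-< (n ℕ.* m) r<m)))) (partial r (ℕ.<⇒≤ r<m)))
        (solve 3 (λ f r x → f :+ (r :* f :+ x) := (:1 :+ r) :* f :+ x) refl (F n) (fromℕ r) _)

    module _ (n : ℕ) (ω : Outcome (n ℕ.* m)) where

      private
        T = n ℕ.* m
        κ : Carrier
        κ = β * fromℕ m

      -- At time `n * m` every block is complete and has exactly `m` vertices, so weight and degree
      -- differ by the same `κ` for all `v`.
      degree-weight : ∀ v → fromℕ (degree (graph n m ω) v) + κ ≈ weight ω (toℕ v)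
      degree-weight v = begin-equality
        fromℕ (degree (graph n m ω) v) + κ
          ≈⟨ +-congʳ (trans (fromℕ-count v (halfEdges (graph n m ω))) (sum-halfEdges (graph n m ω) _)) ⟩
        sum (graph n m ω) (λ (u , _) → δ (toℕ u) b) + sum (graph n m ω) (λ (_ , u) → δ (toℕ u) b) + κ
          ≈⟨ +-congʳ (+-cong (trans (reflexive (edges _)) (sum-cong (allFin (pred T)) λ j → δ-quotient (tailOf j)))
                             (trans (reflexive (edges _)) (sum-cong (allFin (pred T)) λ j → δ-quotient (lookup (heads ω) j)))) ⟩
        sum (allFin (pred T)) (λ j → F (tailOf j)) + sum (allFin (pred T)) (λ j → F (lookup (heads ω) j)) + κ
          ≈⟨ +-congˡ (*-congˡ (begin-equality
               fromℕ m
                 ≈⟨ *-identityʳ _ ⟨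
               fromℕ m * 1#
                 ≈⟨ *-congˡ (sum-δ n (λ _ → 1#) (Fin.toℕ<n v)) ⟨
               fromℕ m * sum (downFrom n) (λ a → δ b a * 1#)
                 ≈⟨ *-congˡ (sum-cong (downFrom n) λ a → trans (*-identityʳ _) (reflexive (δ-sym b a))) ⟩
               fromℕ m * sum (downFrom n) (λ a → δ a b)
                 ≈⟨ sum-block n (λ a → δ a b) ⟨
               sum (downFrom T) (λ i → δ (block i) b)
                 ≈⟨ sum-toℕ T (λ i → δ (block i) b) ⟨
               sum (allFin T) F ∎)) ⟩
        sum (allFin (pred T)) (λ j → F (tailOf j)) + sum (allFin (pred T)) (λ j → F (lookup (heads ω) j)) + β * sum (allFin T) F
          ≈⟨ solve 3 (λ x y z → x :+ y :+ z := z :+ (y :+ x)) refl _ _ _ ⟩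
        weight ω b ∎
        where
        b = toℕ v
        F : Fin T → Carrier
        F i = δ (block (toℕ i)) b
        edges : ∀ f → sum (graph n m ω) f ≡
          sum (allFin (pred T)) (λ j → f (quotient {n} m (tailOf j) , quotient {n} m (lookup (heads ω) j)))
        edges f = ≡.trans (sum-map (Product.map (quotient {n} m) (quotient {n} m)) (tree ω))
          (sum-map (λ j → tailOf {T} j , lookup (heads ω) j) (allFin (pred T)))
        δ-quotient : ∀ i → δ (toℕ (quotient {n} m i)) b ≈ F i
        δ-quotient i = reflexive (≡.cong (λ a → δ a b) (toℕ-quotient {n} i))

      2D≈quadratic : fromℕ 2 * D n m ω ≈
        quadratic ω + (fromℕ n * (κ * κ + κ) - (fromℕ 2 * κ + 1#) * normaliser (n ℕ.* m))
      2D≈quadratic = begin-equality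
        fromℕ 2 * D n m ω
          ≈⟨ *-congˡ (fromℕ-sum (λ v → degree G v choose 2) (allFin n)) ⟩
        fromℕ 2 * sum (allFin n) (λ v → fromℕ (degree G v choose 2))
          ≈⟨ sum-*ˡ (allFin n) (fromℕ 2) ⟨
        sum (allFin n) (λ v → fromℕ 2 * fromℕ (degree G v choose 2))
          ≈⟨ sum-cong (allFin n) (λ v → begin-equality
               fromℕ 2 * fromℕ (degree G v choose 2)
                 ≈⟨ solve 2 (λ c d → :2 :* c := c :+ c :+ d :- d) refl _ (fromℕ (degree G v)) ⟩
               fromℕ (degree G v choose 2) + fromℕ (degree G v choose 2) + fromℕ (degree G v) - fromℕ (degree G v)
                 ≈⟨ +-congʳ (pairs (degree G v)) ⟩
               fromℕ (degree G v) * fromℕ (degree G v) - fromℕ (degree G v)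
                 -- With `w = d + κ`, the polynomial `d² - d` is `w²` plus an affine function of
                 -- `w`. The weights have a deterministic sum, so only `w²` is random after
                 -- summation.
                 ≈⟨ solve 2 (λ d κ → d :* d :- d := (d :+ κ) :* (d :+ κ) :+ ((κ :* κ :+ κ) :+ :- (:2 :* κ :+ :1) :* (d :+ κ)))
                      refl (fromℕ (degree G v)) κ ⟩
               (fromℕ (degree G v) + κ) * (fromℕ (degree G v) + κ) + ((κ * κ + κ) + - (fromℕ 2 * κ + 1#) * (fromℕ (degree G v) + κ))
                 ≈⟨ +-cong (*-cong (degree-weight v) (degree-weight v)) (+-congˡ (*-congˡ (degree-weight v))) ⟩
               w (toℕ v) * w (toℕ v) + ((κ * κ + κ) + - (fromℕ 2 * κ + 1#) * w (toℕ v)) ∎) ⟩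
        sum (allFin n) (λ v → w (toℕ v) * w (toℕ v) + ((κ * κ + κ) + - (fromℕ 2 * κ + 1#) * w (toℕ v)))
          ≈⟨ trans (sum-+ (allFin n)) (+-congˡ (trans (sum-+ (allFin n))
               (+-cong (sum-const n _) (sum-*ˡ (allFin n) _)))) ⟩
        sum (allFin n) (λ v → w (toℕ v) * w (toℕ v)) +
          (fromℕ n * (κ * κ + κ) + - (fromℕ 2 * κ + 1#) * sum (allFin n) (w ∘ toℕ))
          ≈⟨ +-cong (all-blocks (λ b → w b * w b) λ b n≤b → trans (*-congʳ (empty b n≤b)) (zeroˡ _))
               (+-congˡ (*-congˡ (trans (all-blocks w empty) total-weight))) ⟩
        quadratic ω + (fromℕ n * (κ * κ + κ) + - (fromℕ 2 * κ + 1#) * normaliser T)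
          ≈⟨ solve 4 (λ q x y N → q :+ (x :+ :- y :* N) := q :+ (x :- y :* N)) refl _ _ (fromℕ 2 * κ + 1#) (normaliser T) ⟩
        quadratic ω + (fromℕ n * (κ * κ + κ) - (fromℕ 2 * κ + 1#) * normaliser T) ∎
        where
        G = graph n m ω
        w = weight ω
        pairs : ∀ d → fromℕ (d choose 2) + fromℕ (d choose 2) + fromℕ d ≈ fromℕ d * fromℕ d
        pairs d = trans (sym (trans (fromℕ-+ (d choose 2 ℕ.+ d choose 2) d) (+-congʳ (fromℕ-+ (d choose 2) (d choose 2)))))
          (trans (reflexive (≡.cong fromℕ (2*[nC2]+n≡n*n d))) (fromℕ-* d d))
        empty : ∀ b → n ℕ.≤ b → w b ≈ 0#
        empty b n≤b = weight-future ω b (ℕ.*-monoˡ-≤ m n≤b)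
        all-blocks : ∀ f → (∀ b → n ℕ.≤ b → f b ≈ 0#) → sum (allFin n) (f ∘ toℕ) ≈ sum (downFrom T) f
        all-blocks f h = trans (sum-toℕ n f) (trans (sym (sum-downFrom-extend (T ℕ.∸ n) n f h))
          (reflexive (≡.cong (λ t → sum (downFrom t) f) (ℕ.m∸n+n≡m (ℕ.m≤m*n n m)))))
        total-weight : sum (downFrom T) w ≈ normaliser T
        total-weight = trans (sum-cong (downFrom T) λ b → sym (*-identityʳ (w b)))
          (trans (sym (total-block ω (λ _ → 1#))) (total-one ω))

      -- At time `n * m` the current block is number `n`, which is still empty, so the correction
      -- term vanishes.
      potential≈quadratic : potential ω ≈ quadratic ω
      potential≈quadratic = trans (+-congˡ (trans (*-congˡ (weight-future ω _ (ℕ.*-monoˡ-≤ m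
        (≡.subst (n ℕ.≤_) (≡.sym (ℕ.m*n/n≡m n m)) ℕ.≤-refl)))) (zeroʳ _))) (+-identityʳ _)

    2[D-𝔼D]≈deviation : ∀ n → 1 ℕ.≤ n ℕ.* m → (ω : Outcome (n ℕ.* m)) →
      fromℕ 2 * (D n m ω - 𝔼 (D n m)) ≈ deviation ω
    2[D-𝔼D]≈deviation n 1≤T ω = begin-equality
      fromℕ 2 * (D n m ω - 𝔼 (D n m))
        ≈⟨ solve 2 (λ d e → :2 :* (d :- e) := :2 :* d :- :2 :* e) refl (D n m ω) _ ⟩
      fromℕ 2 * D n m ω - fromℕ 2 * 𝔼 (D n m)
        ≈⟨ +-cong (2D≈potential ω) (-‿cong (trans (sym (𝔼-*ˡ {n ℕ.* m} (fromℕ 2) {D n m}))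
             (trans (𝔼-cong {n ℕ.* m} 2D≈potential) (trans (𝔼-+ {n ℕ.* m}) (+-congˡ (𝔼-const 1≤T _)))))) ⟩
      (potential ω + c) - (𝔼 {n ℕ.* m} potential + c)
        ≈⟨ solve 3 (λ p e c → p :+ c :- (e :+ c) := p :- e) refl (potential ω) (𝔼 {n ℕ.* m} potential) c ⟩
      deviation ω ∎
      where
      κ = β * fromℕ m
      c = fromℕ n * (κ * κ + κ) - (fromℕ 2 * κ + 1#) * normaliser (n ℕ.* m)
      2D≈potential : ∀ ω → fromℕ 2 * D n m ω ≈ potential ω + c
      2D≈potential ω = trans (2D≈quadratic n ω) (+-congʳ (sym (potential≈quadratic n ω)))

  -- Choice of the exponents

  -- By induction on `q`: as `1 ≤ d`, increasing `q` by 1 calls for at most one further multiple.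
  -- For positive `q` this places `P / q` above `1 / d` by at most `1 / q`.
  next-multiple : ∀ {d} → 1# ≤ d → ∀ q → ∃[ P ] (fromℕ q < fromℕ P * d × fromℕ P * d ≤ fromℕ q + d)
  next-multiple {d} 1≤d zero = 1 , <-by (<-≤-trans 0<1 1≤d) (solve 1 (λ d → (:1 :+ :0) :* d := :0 :+ d) refl d) ,
    ≤.reflexive (solve 1 (λ d → (:1 :+ :0) :* d := :0 :+ d) refl d)
  next-multiple {d} 1≤d (suc q) with next-multiple 1≤d q
  ... | P , q<Pd , Pd≤q+d with em {fromℕ P * d ≤ fromℕ (suc q)}
  ...   | no  Pd≰ = P , ≰⇒> Pd≰ , ≤.trans Pd≤q+d (≤-by 0≤1 (solve 2 (λ q d → :1 :+ q :+ d := q :+ d :+ :1) refl (fromℕ q) d))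
  ...   | yes Pd≤ = suc P ,
    <-by (+-pos-nonneg (0<y-x q<Pd) (0≤y-x 1≤d))
      (solve 3 (λ P d q → (:1 :+ P) :* d := (:1 :+ q) :+ (P :* d :- q :+ (d :- :1))) refl (fromℕ P) d (fromℕ q)) ,
    ≤-by (0≤y-x Pd≤) (solve 3 (λ P d q → :1 :+ q :+ d := (:1 :+ P) :* d :+ (:1 :+ q :- P :* d)) refl (fromℕ P) d (fromℕ q))

  -- Markov's inequality.

  module Tail (β : Carrier) (0<β : 0# < β) where

    open Attachment β 0<β

    markov : ∀ {n} {A : Outcome n → Set} {Y : Outcome n → Carrier} {c} → (∀ ω → 0# ≤ Y ω) → (∀ ω → A ω → c ≤ Y ω) →
      c * Pr em A ≤ 𝔼 Y
    markov {n} {A} {Y} {c} 0≤Y c≤Y = ≤.trans (≤.reflexive (sym (sum-*ˡ (outcomes n) c))) (sum-mono (outcomes n) pointwise)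
      where
      pointwise : ∀ ω → c * (if does (em {A ω}) then outcomeProb ω else 0#) ≤ outcomeProb ω * Y ω
      pointwise ω with em {A ω}
      ... | yes a = ≤.trans (≤.reflexive (*-comm c _)) (*-monoʳ-≤ _ (outcomeProb-nonneg ω) (c≤Y ω a))
      ... | no  _ = ≤.trans (≤.reflexive (zeroʳ c)) (*-nonneg (outcomeProb-nonneg ω) (0≤Y ω))

    Pr-nonneg : ∀ {n} (A : Outcome n → Set) → 0# ≤ Pr em A
    Pr-nonneg {n} A = sum-nonneg (outcomes n) pointwise
      where
      pointwise : ∀ ω → 0# ≤ (if does (em {A ω}) then outcomeProb ω else 0#)
      pointwise ω with em {A ω}
      ... | yes _ = outcomeProb-nonneg ω
      ... | no  _ = ≤.refl

  -- P / q is slightly larger than 1 / (2 + β), and the moment of order 2j is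
  -- used for j = J q.
  module Parameters (β : Carrier) (0<β : 0# < β) (m-1 P s g j₀ : ℕ)
    (q<P[2+β] : fromℕ (suc (P ℕ.+ P) ℕ.+ s) < fromℕ P * (fromℕ 2 + β))
    (1≤gap : 1# ≤ fromℕ j₀ * (fromℕ P * (fromℕ 2 + β) - fromℕ (suc (P ℕ.+ P) ℕ.+ s))) where

    private
      q = suc (P ℕ.+ P) ℕ.+ s
      -- `j₀` makes `J * gap` at least 1, as `slack` requires, and `J - 1` powers of `n` will be
      -- left over for the tail. The value of `r` is then forced by `j = q J`.
      J = suc (suc (g ℕ.+ j₀))
      p = J ℕ.* (P ℕ.+ P)
      r = suc (g ℕ.+ j₀) ℕ.+ J ℕ.* s
      j = suc (p ℕ.+ r)
      gap = fromℕ P * (fromℕ 2 + β) - fromℕ q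

      j≡ : ∀ J′ P s → suc (suc J′ ℕ.* (P ℕ.+ P) ℕ.+ (J′ ℕ.+ suc J′ ℕ.* s)) ≡ (suc (P ℕ.+ P) ℕ.+ s) ℕ.* suc J′
      j≡ = ℕSolver.solve-∀

      j≡qJ : j ≡ q ℕ.* J
      j≡qJ = j≡ (suc (g ℕ.+ j₀)) P s

      -- By the definition of `gap`, the right-hand side is `2j + 2 J gap`, and `J * gap` is at
      -- least 1.
      slack : fromℕ (suc (j ℕ.+ j)) ≤ fromℕ p * (fromℕ 2 + β)
      slack = begin
        fromℕ (suc (j ℕ.+ j))
          ≈⟨ +-congˡ (trans (fromℕ-+ j j) (+-cong fromℕ-j fromℕ-j)) ⟩
        1# + (fromℕ q * fromℕ J + fromℕ q * fromℕ J)
          ≤⟨ +-monoˡ-≤ _ 1≤Jgap ⟩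
        fromℕ J * gap + (fromℕ q * fromℕ J + fromℕ q * fromℕ J)
          ≤⟨ ≤-by (*-nonneg (fromℕ-nonneg J) 0≤gap)
               (solve 4 (λ J P β q → J :* (P :+ P) :* (:2 :+ β) :=
                 J :* (P :* (:2 :+ β) :- q) :+ (q :* J :+ q :* J) :+ J :* (P :* (:2 :+ β) :- q))
                 refl (fromℕ J) (fromℕ P) β (fromℕ q)) ⟩
        fromℕ J * (fromℕ P + fromℕ P) * (fromℕ 2 + β)
          ≈⟨ *-congʳ (trans (fromℕ-* J (P ℕ.+ P)) (*-congˡ (fromℕ-+ P P))) ⟨
        fromℕ p * (fromℕ 2 + β) ∎
        where
        0≤gap : 0# ≤ gap
        0≤gap = 0≤y-x (<⇒≤ q<P[2+β])
        1≤Jgap : 1# ≤ fromℕ J * gap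
        1≤Jgap = ≤.trans 1≤gap (*-monoˡ-≤ gap 0≤gap (fromℕ-mono-≤ (ℕ.m≤n+m j₀ (2 ℕ.+ g))))
        fromℕ-j : fromℕ j ≈ fromℕ q * fromℕ J
        fromℕ-j = trans (reflexive (≡.cong fromℕ j≡qJ)) (fromℕ-* q J)

    open PolynomialBounds β 0<β m-1 p r slack
    open Degrees β 0<β m-1 using (2[D-𝔼D]≈deviation)
    open Tail β 0<β

    private
      i = p ℕ.+ r
      E = suc (suc (p ℕ.+ p) ℕ.+ r)
      K = proj₁ bound
        where
        bound : ∃[ K ] (∀ t → threshold ℕ.≤ t → deviationMoment i t ≤ K * fromℕ t ^ E)
        bound = _ , deviationMoment≤

      -- The event forces the 2j-th power of the deviation above `n` to the left-hand exponent,
      -- while the moment bound has exponent `E`. The surplus `suc G` is the decay of the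
      -- probability.
      exponents : ∀ G P s → let J = suc (suc G); p = J ℕ.* (P ℕ.+ P); r = suc G ℕ.+ J ℕ.* s in
        (suc (P ℕ.+ P) ℕ.+ s ℕ.+ suc (P ℕ.+ P)) ℕ.* J ≡ suc (suc (p ℕ.+ p) ℕ.+ r) ℕ.+ suc G
      exponents = ℕSolver.solve-∀

    sufficient : ∃[ n* ] (threshold ℕ.≤ n* × K * fromℕ m ^ E ≤ fromℕ n*)
    sufficient = extend (archimedean (K * fromℕ m ^ E))
      where
      extend : ∃[ l ] K * fromℕ m ^ E ≤ fromℕ l → ∃[ n* ] (threshold ℕ.≤ n* × K * fromℕ m ^ E ≤ fromℕ n*)
      extend (l , h) = threshold ℕ.+ l , ℕ.m≤m+n threshold l , ≤.trans h (fromℕ-mono-≤ (ℕ.m≤n+m l threshold))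

    -- The conclusion has the form required for membership in the set defining `fromℕ n ^ʳ (- γ)`,
    -- with rational exponent `(0 - g) / 1`. Markov's inequality leaves `g + j₀ + 1` powers of `n`:
    -- `g` are claimed, one absorbs the constant `K * fromℕ m ^ E`, and the others are dropped.
    tail-bound : ∀ n z → proj₁ sufficient ℕ.≤ n → 0# ≤ z → fromℕ n ^ (q ℕ.+ suc (P ℕ.+ P)) ≤ z ^ (q ℕ.+ q) →
      Pr em (λ ω → z ≤ ∣ D n m ω - 𝔼 (D n m) ∣) ^ 1 * fromℕ n ^ g ≤ fromℕ n ^ 0
    tail-bound n z n*≤n 0≤z large = *-cancelˡ-≤ x 0<x (begin
      x * (pr ^ 1 * x ^ g)
        ≤⟨ *-monoʳ-≤ x (<⇒≤ 0<x) (≤.trans (*-monoʳ-≤ _ (^-nonneg 1 0≤pr) (^-monoʳ-≤ {m = g} 1≤x (ℕ.m≤m+n g j₀)))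
             (≤.reflexive (*-congʳ (*-identityʳ pr)))) ⟩
      x * (pr * x ^ (g ℕ.+ j₀))
        ≈⟨ solve 3 (λ x p y → x :* (p :* y) := x :* y :* p) refl x pr _ ⟩
      x ^ suc (g ℕ.+ j₀) * pr
        ≤⟨ *-cancelˡ-≤ (x ^ E) (^-pos E 0<x) markov-bound ⟩
      K * fromℕ m ^ E
        ≤⟨ proj₂ (proj₂ sufficient) ⟩
      fromℕ (proj₁ sufficient)
        ≤⟨ fromℕ-mono-≤ n*≤n ⟩
      x
        ≈⟨ *-identityʳ x ⟨
      x * 1# ∎)
      where
      x = fromℕ n
      T = n ℕ.* m
      threshold≤n : threshold ℕ.≤ n
      threshold≤n = ℕ.≤-trans (proj₁ (proj₂ sufficient)) n*≤n
      threshold≤T : threshold ℕ.≤ T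
      threshold≤T = ℕ.≤-trans threshold≤n (ℕ.m≤m*n n m)
      1≤n : 1 ℕ.≤ n
      1≤n = ℕ.≤-trans 1≤threshold threshold≤n
      1≤x = 1≤fromℕ {n} 1≤n
      0<x = 0<fromℕ {n} 1≤n
      A = λ ω → z ≤ ∣ D n m ω - 𝔼 (D n m) ∣
      pr = Pr em A
      0≤pr = Pr-nonneg A
      deviation-large : ∀ ω → A ω → (z * z) ^ j ≤ (deviation ω * deviation ω) ^ j
      deviation-large ω z≤ = ^-monoˡ-≤ j (square-nonneg z) (begin
        z * z                              ≤⟨ ∣∣-square 0≤z z≤ ⟩
        y * y                              ≤⟨ ≤-by (+-nonneg (+-nonneg (square-nonneg y) (square-nonneg y)) (square-nonneg y))
                                                (solve 1 (λ y → :2 :* y :* (:2 :* y) := y :* y :+ (y :* y :+ y :* y :+ y :* y)) refl y) ⟩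
        fromℕ 2 * y * (fromℕ 2 * y)        ≈⟨ *-cong dev dev ⟩
        deviation ω * deviation ω          ∎)
        where
        y = D n m ω - 𝔼 (D n m)
        dev = 2[D-𝔼D]≈deviation n (ℕ.≤-trans 1≤threshold threshold≤T) ω
      power : x ^ E * x ^ suc (g ℕ.+ j₀) ≤ (z * z) ^ j
      power = begin
        x ^ E * x ^ suc (g ℕ.+ j₀)                  ≈⟨ ^-homo-* x E (suc (g ℕ.+ j₀)) ⟨
        x ^ (E ℕ.+ suc (g ℕ.+ j₀))                  ≡⟨ ≡.cong (x ^_) (exponents (g ℕ.+ j₀) P s) ⟨
        x ^ ((q ℕ.+ suc (P ℕ.+ P)) ℕ.* J)           ≈⟨ ^-assocʳ x (q ℕ.+ suc (P ℕ.+ P)) J ⟨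
        (x ^ (q ℕ.+ suc (P ℕ.+ P))) ^ J             ≤⟨ ^-monoˡ-≤ J (^-nonneg (q ℕ.+ suc (P ℕ.+ P)) (<⇒≤ 0<x)) large ⟩
        (z ^ (q ℕ.+ q)) ^ J                         ≈⟨ ^-congˡ J (trans (^-homo-* z q q) (sym (^-distrib-* z z q))) ⟩
        ((z * z) ^ q) ^ J                           ≈⟨ ^-assocʳ (z * z) q J ⟩
        (z * z) ^ (q ℕ.* J)                         ≡⟨ ≡.cong ((z * z) ^_) j≡qJ ⟨
        (z * z) ^ j                                 ∎
      markov-bound : x ^ E * (x ^ suc (g ℕ.+ j₀) * pr) ≤ x ^ E * (K * fromℕ m ^ E)
      markov-bound = begin
        x ^ E * (x ^ suc (g ℕ.+ j₀) * pr)   ≈⟨ *-assoc _ _ _ ⟨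
        x ^ E * x ^ suc (g ℕ.+ j₀) * pr     ≤⟨ *-monoˡ-≤ pr 0≤pr power ⟩
        (z * z) ^ j * pr                    ≤⟨ markov (λ ω → ^-nonneg j (square-nonneg (deviation ω))) deviation-large ⟩
        deviationMoment i T                 ≤⟨ deviationMoment≤ T threshold≤T ⟩
        K * fromℕ T ^ E                     ≈⟨ *-congˡ (trans (^-congˡ E (fromℕ-* n m)) (^-distrib-* x (fromℕ m) E)) ⟩
        K * (x ^ E * fromℕ m ^ E)           ≈⟨ solve 3 (λ K x y → K :* (x :* y) := x :* (K :* y)) refl K _ _ ⟩
        x ^ E * (K * fromℕ m ^ E)           ∎

  module _ {β ε} (0<β : 0# < β) (0<ε : 0# < ε) where

    private
      b = fromℕ 2 + β
      0≤β = <⇒≤ 0<β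

      0<b : 0# < b
      0<b = ≤-<-trans (fromℕ-nonneg 2) (<-by 0<β refl)

      0<4+2β : 0# < fromℕ 4 + fromℕ 2 * β
      0<4+2β = +-pos-nonneg (0<fromℕ {4} (ℕ.s≤s ℕ.z≤n)) (*-nonneg (fromℕ-nonneg 2) 0≤β)

      1≤b : 1# ≤ b
      1≤b = ≤-by (+-nonneg 0≤1 0≤β) (solve 1 (λ β → :2 :+ β := :1 :+ (:1 :+ β)) refl β)

      :4 : ∀ {n} → Solver.Polynomial n
      :4 = :1 :+ (:1 :+ :2)

    exponent : Carrier
    exponent = (fromℕ 4 + β) / (fromℕ 4 + fromℕ 2 * β) + ε

    -- The first condition is `P / q > 1 / (2 + β)`; the second puts `(q + 2P + 1) / 2q`, the
    -- exponent that the moments can reach, below the required one. Writing `q` through `s` builds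
    -- in `2P < q`.
    SuitableExponents : ℕ → ℕ → Set
    SuitableExponents P s = let q = suc (P ℕ.+ P) ℕ.+ s in
      fromℕ q < fromℕ P * (fromℕ 2 + β) × fromℕ (q ℕ.+ suc (P ℕ.+ P)) ≤ fromℕ (q ℕ.+ q) * exponent

    private
      -- Rounding up to `P` costs `3 * b` in both estimates below. In `numerator-small` it is
      -- absorbed by `q * β`; in `numerator≤` it is enlarged to `4 * b` and absorbed by `2 q ε b`.
      largeDenominator : ∃[ q ] (fromℕ 2 ≤ fromℕ q * ε × fromℕ 3 * b ≤ fromℕ q * β)
      largeDenominator = combine (archimedean-* (fromℕ 2) 0<ε) (archimedean-* (fromℕ 3 * b) 0<β)
        where
        combine : ∃[ q₁ ] fromℕ 2 ≤ fromℕ q₁ * ε → ∃[ q₂ ] fromℕ 3 * b ≤ fromℕ q₂ * β →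
          ∃[ q ] (fromℕ 2 ≤ fromℕ q * ε × fromℕ 3 * b ≤ fromℕ q * β)
        combine (q₁ , h₁) (q₂ , h₂) = q₁ ℕ.+ q₂ ,
          ≤.trans h₁ (*-monoˡ-≤ ε (<⇒≤ 0<ε) (fromℕ-mono-≤ (ℕ.m≤m+n q₁ q₂))) ,
          ≤.trans h₂ (*-monoˡ-≤ β 0≤β (fromℕ-mono-≤ (ℕ.m≤n+m q₂ q₁)))

      -- A quantitative form of `2 / (2 + β) < 1`: `b (2P + 1) ≤ 2q + 3b ≤ (2 + β) q`. It is what
      -- lets the noise dominate the deviation recursion.
      numerator-small : ∀ q P → fromℕ 3 * b ≤ fromℕ q * β → fromℕ P * b ≤ fromℕ q + b → suc (P ℕ.+ P) ℕ.≤ q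
      numerator-small q P large h = fromℕ-cancel-≤ {suc (P ℕ.+ P)} {q} (*-cancelˡ-≤ b 0<b (begin
        b * fromℕ (suc (P ℕ.+ P))
          ≈⟨ *-congˡ (+-congˡ (fromℕ-+ P P)) ⟩
        b * (1# + (fromℕ P + fromℕ P))
          ≈⟨ solve 2 (λ b P → b :* (:1 :+ (P :+ P)) := P :* b :+ P :* b :+ b) refl b (fromℕ P) ⟩
        fromℕ P * b + fromℕ P * b + b
          ≤⟨ +-monoˡ-≤ b (+-mono-≤ h h) ⟩
        fromℕ q + b + (fromℕ q + b) + b
          ≈⟨ solve 2 (λ q b → q :+ b :+ (q :+ b) :+ b := q :* :2 :+ (:1 :+ :2) :* b) refl (fromℕ q) b ⟩
        fromℕ q * fromℕ 2 + fromℕ 3 * b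
          ≤⟨ +-monoʳ-≤ _ large ⟩
        fromℕ q * fromℕ 2 + fromℕ q * β
          ≈⟨ solve 2 (λ q β → q :* :2 :+ q :* β := (:2 :+ β) :* q) refl (fromℕ q) β ⟩
        b * fromℕ q ∎))

      numerator≤ : ∀ q P → fromℕ 2 ≤ fromℕ q * ε → fromℕ P * b ≤ fromℕ q + b →
        fromℕ (q ℕ.+ suc (P ℕ.+ P)) ≤ fromℕ (q ℕ.+ q) * exponent
      numerator≤ q P large h = *-cancelˡ-≤ b 0<b (begin
        b * fromℕ (q ℕ.+ suc (P ℕ.+ P))
          ≈⟨ *-congˡ (trans (fromℕ-+ q (suc (P ℕ.+ P))) (+-congˡ (+-congˡ (fromℕ-+ P P)))) ⟩
        b * (fromℕ q + (1# + (fromℕ P + fromℕ P)))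
          ≈⟨ solve 3 (λ b q P → b :* (q :+ (:1 :+ (P :+ P))) := b :* q :+ b :+ (P :* b :+ P :* b)) refl b (fromℕ q) (fromℕ P) ⟩
        b * fromℕ q + b + (fromℕ P * b + fromℕ P * b)
          ≤⟨ +-monoʳ-≤ _ (+-mono-≤ h h) ⟩
        b * fromℕ q + b + (fromℕ q + b + (fromℕ q + b))
          ≤⟨ ≤-by (<⇒≤ 0<b) (solve 2 (λ q β → q :* (:4 :+ β) :+ (:2 :+ β) :* (:2 :+ :2) :=
               (:2 :+ β) :* q :+ (:2 :+ β) :+ (q :+ (:2 :+ β) :+ (q :+ (:2 :+ β))) :+ (:2 :+ β)) refl (fromℕ q) β) ⟩
        fromℕ q * (fromℕ 4 + β) + b * (fromℕ 2 + fromℕ 2)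
          ≤⟨ +-monoʳ-≤ _ (*-monoʳ-≤ b (<⇒≤ 0<b) (+-mono-≤ large large)) ⟩
        fromℕ q * (fromℕ 4 + β) + b * (fromℕ q * ε + fromℕ q * ε)
          ≈⟨ +-congʳ (*-congˡ (/-cancel (fromℕ 4 + β) 0<4+2β)) ⟨
        fromℕ q * ((fromℕ 4 + fromℕ 2 * β) * ((fromℕ 4 + β) / (fromℕ 4 + fromℕ 2 * β))) + b * (fromℕ q * ε + fromℕ q * ε)
          ≈⟨ solve 4 (λ q β x ε → q :* ((:4 :+ :2 :* β) :* x) :+ (:2 :+ β) :* (q :* ε :+ q :* ε) := (:2 :+ β) :* ((q :+ q) :* (x :+ ε)))
               refl (fromℕ q) β _ ε ⟩
        b * ((fromℕ q + fromℕ q) * exponent)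
          ≈⟨ *-congˡ (*-congʳ (fromℕ-+ q q)) ⟨
        b * (fromℕ (q ℕ.+ q) * exponent) ∎)

    suitableExponents : ∃[ P ] ∃[ s ] SuitableExponents P s
    suitableExponents = choose (proj₁ largeDenominator) (proj₂ largeDenominator) (next-multiple 1≤b (proj₁ largeDenominator))
      where
      split : ∀ q P → fromℕ 2 ≤ fromℕ q * ε → fromℕ q < fromℕ P * b → fromℕ P * b ≤ fromℕ q + b →
        ∃[ s ] suc (P ℕ.+ P) ℕ.+ s ≡ q → ∃[ P ] ∃[ s ] SuitableExponents P s
      split q P ε-large q<Pb Pb≤ (s , ≡.refl) = P , s , q<Pb , numerator≤ q P ε-large Pb≤
      choose : ∀ q → fromℕ 2 ≤ fromℕ q * ε × fromℕ 3 * b ≤ fromℕ q * β →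
        ∃[ P ] (fromℕ q < fromℕ P * b × fromℕ P * b ≤ fromℕ q + b) → ∃[ P ] ∃[ s ] SuitableExponents P s
      choose q (ε-large , β-large) (P , q<Pb , Pb≤) =
        split q P ε-large q<Pb Pb≤ (ℕ.m≤n⇒∃[o]m+o≡n (numerator-small q P β-large Pb≤))

theorem9 : (em : ExcludedMiddle 0ℓ) (ℝ : RealField) →
    let open RealField ℝ in
    (β : Carrier) → 0# < β →
    (m : ℕ) → 1 ℕ.≤ m →
    let open Process ℝ β in
    (ε γ : Carrier) → 0# < ε → 0# < γ →
    ∃[ n* ] ((n : ℕ) → 1 ℕ.≤ n → n* ℕ.≤ n →
    Pr em (λ ω → fromℕ n ^ʳ ((fromℕ 4 + β) / (fromℕ 4 + fromℕ 2 * β) + ε)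
    ≤ ∣ D n m ω - 𝔼 (D n m) ∣)
    ≤ fromℕ n ^ʳ (- γ))
theorem9 em ℝ β 0<β (suc m-1) 1≤m ε γ 0<ε 0<γ =
  conclude (suitableExponents 0<β 0<ε) (archimedean γ)
  where
  open Concentration em ℝ
  open Process ℝ β
  open Tail β 0<β
  m = suc m-1
  Goal : Set
  Goal = ∃[ n* ] ((n : ℕ) → 1 ℕ.≤ n → n* ℕ.≤ n →
    Pr em (λ ω → fromℕ n ^ʳ exponent 0<β 0<ε ≤ ∣ D n m ω - 𝔼 (D n m) ∣) ≤ fromℕ n ^ʳ (- γ))
  fix : ∀ P s g → SuitableExponents 0<β 0<ε P s → γ ≤ fromℕ g →
    ∃[ j₀ ] 1# ≤ fromℕ j₀ * (fromℕ P * (fromℕ 2 + β) - fromℕ (suc (P ℕ.+ P) ℕ.+ s)) → Goal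
  fix P s g (q<Pb , num≤) γ≤g (j₀ , 1≤gap) = proj₁ sufficient , λ n 1≤n n*≤n →
    let 1≤x = 1≤fromℕ {n} 1≤n
        z = fromℕ n ^ʳ exponent 0<β 0<ε
    -- Of the event's threshold `z`, only `0 ≤ z` and a lower bound on `z ^ (q + q)` are needed. The
    -- latter comes from the rational `r / (q + q)`, which is at most the real exponent.
    in ≤-^ʳ 1≤x 0 g 1 (ℕ.s≤s ℕ.z≤n) (Pr-nonneg {n ℕ.* m} (λ ω → z ≤ ∣ D n m ω - 𝔼 (D n m) ∣))
      (≤-by (0≤y-x γ≤g) (solve 2 (λ γ g → (:1 :+ :0) :* (:- γ) := :0 :- g :+ (g :- γ)) refl γ (fromℕ g)))
      (tail-bound n z n*≤n (0≤^ʳ 1≤x r (q ℕ.+ q) 1≤2q num≤) (^≤^ʳ-^ 1≤x r (q ℕ.+ q) 1≤2q num≤))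
    where
    open Parameters β 0<β m-1 P s g j₀ q<Pb 1≤gap
    q = suc (P ℕ.+ P) ℕ.+ s
    r = q ℕ.+ suc (P ℕ.+ P)
    1≤2q : 1 ℕ.≤ q ℕ.+ q
    1≤2q = ℕ.s≤s ℕ.z≤n
  conclude : ∃[ P ] ∃[ s ] SuitableExponents 0<β 0<ε P s → ∃[ g ] γ ≤ fromℕ g → Goal
  conclude (P , s , suitable) (g , γ≤g) = fix P s g suitable γ≤g (archimedean-* 1# (0<y-x (proj₁ suitable)))
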